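{- Let $F$ be a simple $2$-regular graph whose cycles have lengths $h,\ell_1,\dots,\ell_r,\ell'_1,\dots,\ell'_s$, where $\ell_1,\dots,\ell_r$ are even and $\ell'_1,\dots,\ell'_s$ are odd. Set $\ell=\max\{\ell_1,\dots,\ell_r\}$ and $\ell'=\max\{\ell'_1,\dots,\ell'_s\}$. Then $OP(2,F)$ has a $1$-rotational solution whenever \[h>\begin{cases} 12r(\ell+3)+7^{s}(2\ell'+1)-6 & \text{if } r,s>0,\\ 2(r+1)(\ell+1)+5 & \text{if } r>0=s,\\ 3\cdot 7^{s-1}(2\ell'+1) & \text{if } s>0=r.\end{cases}\]
   Context: Let $v$ be the order of $F$. $2K_v$ denotes the multigraph on $v$ vertices in which every two distinct vertices are joined by exactly two edges. A solution to $OP(2,F)$ is an $F$-factorization of $2K_v$: a collection (factors need not be distinct) of spanning subgraphs of $2K_v$, each isomorphic to $F$, whose edge multisets partition the edge multiset of $2K_v$. A solution is $1$-rotational if it admits a group of automorphisms (vertex permutations mapping each factor onto a factor of the collection) which fixes exactly one vertex and acts sharply transitively on the remaining vertices. -}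

module Defs where

open import Data.Nat using (ℕ; zero; suc; _+_; _*_; _∸_; _^_; _<_; _≤_; _⊔_; _%_; _≡ᵇ_; _<ᵇ_)
open import Data.Nat.Base using (_≤ᵇ_)
open import Data.Bool using (Bool; true; false; _∧_; _∨_; if_then_else_)
open import Data.Fin using (Fin; toℕ)
open import Data.List using (List; []; _∷_; length; foldr; _++_)
open import Data.Nat.ListAction using (sum)
open import Data.List.Relation.Unary.All using (All)
open import Data.Product using (Σ; ∃; _×_; _,_)
open import Data.Empty using (⊥)
open import Relation.Binary.PropositionalEquality using (_≡_; _≢_)

record Perm (v : ℕ) : Set where
  field
    to      : Fin v → Fin v
    from    : Fin v → Fin v
    from-to : ∀ x → from (to x) ≡ x
    to-from : ∀ x → to (from x) ≡ x
open Perm public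

Graph : ℕ → Set
Graph v = Fin v → Fin v → Bool

-- The standard 2-regular graph with cycle lengths L = k₁ ∷ k₂ ∷ …,
-- on the vertex set {0,…,ΣL-1}: the first k₁ vertices form the cycle
-- 0-1-…-(k₁-1)-0, the next k₂ vertices the next cycle, etc.

-- adjacency in the cycle 0-1-…-(k-1)-0 (for k ≥ 3)
cycAdj : ℕ → ℕ → ℕ → Bool
cycAdj zero    x y = false
cycAdj (suc k) x y = ((suc x % suc k) ≡ᵇ y) ∨ ((suc y % suc k) ≡ᵇ x)

unionOfCycles : List ℕ → ℕ → ℕ → Bool
unionOfCycles []       x y = false
unionOfCycles (k ∷ ks) x y =
  if (x <ᵇ k) ∧ (y <ᵇ k) then cycAdj k x y
  else if (k ≤ᵇ x) ∧ (k ≤ᵇ y) then unionOfCycles ks (x ∸ k) (y ∸ k)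
  else false

cyclesGraph : (L : List ℕ) → Graph (sum L)
cyclesGraph L x y = unionOfCycles L (toℕ x) (toℕ y)

_≅_ : ∀ {v} → Graph v → Graph v → Set
_≅_ {v} A B = Σ (Perm v) λ φ → ∀ x y → A (to φ x) (to φ y) ≡ B x y

count : (n : ℕ) → (Fin n → Bool) → ℕ
count zero    p = 0
count (suc n) p = (if p Fin.zero then 1 else 0) + count n (λ i → p (Fin.suc i))

-- F-factorizations of 2K_v: a family (indexed by Fin n, repetitions
-- allowed) of spanning subgraphs, each isomorphic to F, such that every
-- pair of distinct vertices is an edge of exactly two of them.

record Factorization2 {v : ℕ} (F : Graph v) : Set where
  field
    n       : ℕ
    factor  : Fin n → Graph v
    isoF    : ∀ i → factor i ≅ F
    covers2 : ∀ x y → x ≢ y → count n (λ i → factor i x y) ≡ 2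
open Factorization2 public

-- A factorization is 1-rotational if it admits a group G of
-- automorphisms (vertex permutations mapping factors onto factors,
-- i.e. permuting the family of factors) fixing exactly one vertex ∞
-- and acting sharply transitively on the other vertices.
-- G is given as a finite family of permutations closed under identity,
-- composition and inverses (equality of permutations = pointwise).

record OneRotational {v : ℕ} {F : Graph v} (S : Factorization2 F) : Set where
  field
    m     : ℕ
    G     : Fin m → Perm v
    hasId   : ∃ λ e → ∀ x → to (G e) x ≡ x
    closed∘ : ∀ a b → ∃ λ c → ∀ x → to (G c) x ≡ to (G a) (to (G b) x)
    closed⁻¹ : ∀ a → ∃ λ c → ∀ x → to (G c) x ≡ from (G a) x
    auto    : ∀ a → Σ (Perm (n S)) λ σ →
                ∀ i x y → factor S (to σ i) (to (G a) x) (to (G a) y) ≡ factor S i x y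
    ∞       : Fin v
    fixes∞  : ∀ a → to (G a) ∞ ≡ ∞
    onlyFixed : ∀ x → (∀ a → to (G a) x ≡ x) → x ≡ ∞
    transitive : ∀ x y → x ≢ ∞ → y ≢ ∞ → ∃ λ a → to (G a) x ≡ y
    sharp      : ∀ x a b → x ≢ ∞ → to (G a) x ≡ to (G b) x → ∀ z → to (G a) z ≡ to (G b) z

OP2-1rot : ∀ {v} → Graph v → Set
OP2-1rot F = Σ (Factorization2 F) OneRotational

Even Odd : ℕ → Set
Even k = k % 2 ≡ 0
Odd  k = k % 2 ≡ 1

maxL : List ℕ → ℕ
maxL = foldr _⊔_ 0

-- The numerical hypothesis of the theorem, with r, s the numbers of
-- even / odd cycles, ℓ, ℓ' their maximal lengths. (Case r = s = 0 is not
-- covered by the theorem.)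
Bound : (h r s ℓ ℓ' : ℕ) → Set
Bound h zero    zero    ℓ ℓ' = ⊥
Bound h (suc r) zero    ℓ ℓ' = 2 * (suc r + 1) * (ℓ + 1) + 5 < h
Bound h zero    (suc s) ℓ ℓ' = 3 * 7 ^ s * (2 * ℓ' + 1) < h
Bound h (suc r) (suc s) ℓ ℓ' = 12 * suc r * (ℓ + 3) + 7 ^ suc s * (2 * ℓ' + 1) ∸ 6 < h

{-# OPTIONS --safe #-}

-- Label the vertices by ∞ and the residues modulo n = v - 1. If the finite edges of one copy of F have the
-- differences 1, …, n - 1, once each, then the n translates of that copy form a solution, because a pair of
-- residues at distance δ is met once through δ and once through n - δ. Cutting the h-cycle at ∞ leaves a path
-- and the remaining cycles, to be labelled gracefully: labels 0, …, n - 1 and differences 1, …, n - 1.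
-- A graceful labelling is enlarged by surrounding it with a bipartite configuration: low vertices get new
-- labels below, high vertices new labels above, and the new differences are n, n + 1, …. Rosa's zigzag paths
-- with a prescribed first vertex lengthen the path; even cycles are cut off from three parallel strands climbing
-- through one such configuration; odd cycles are inserted one at a time, the longest last, the size growing
-- roughly by a factor of 7 each time. The bounds record the size n and the label of the free end of the path.

module Submission where

open import Defs hiding (n)
import Relation.Binary.Construct.Flip.EqAndOrd as Flip
open import Data.Nat using (ℕ; zero; suc; _+_; _*_; _∸_; _^_; _<_; _≤_; _≡ᵇ_; _≤ᵇ_; _<ᵇ_; z≤n; s≤s; s≤s⁻¹; ∣_-_∣)
open import Data.Nat.Properties
open import Data.Nat.Tactic.RingSolver using (solve-∀)
open import Data.Bool using (Bool; true; false; T; if_then_else_; _∧_; _∨_)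
open import Data.List using (List; []; _∷_; _++_; map; length; lookup; downFrom; concatMap)
open import Data.List.Properties using (++-assoc; ++-identityʳ; map-id; map-++; map-∘; map-cong; length-map; length-++; length-downFrom; lookup-downFrom; concatMap-++)
open import Data.List.Relation.Binary.Permutation.Propositional using (_↭_; ↭⇒↭ₛ; ↭-refl; ↭-sym; ↭-trans; ↭-reflexive; prep; swap; module PermutationReasoning)
open import Data.List.Relation.Binary.Permutation.Propositional.Properties using (++⁺; ++⁺ˡ; ++⁺ʳ; map⁺; ++-comm; All-resp-↭; ↭-length; ↭-map-inv)
open import Data.List.Relation.Unary.All using (All; []; _∷_)
import Data.List.Relation.Unary.All as All
import Data.List.Relation.Unary.All.Properties as All
open import Data.Nat.DivMod using (_/_; _%_; m%n<n; m≡m%n+[m/n]*n; _mod_; %-distribˡ-+; m%n%n≡m%n; n%n≡0; m<n⇒m%n≡m; [m+n]%n≡m%n; [m+kn]%n≡m%n)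
open import Data.Nat.ListAction using (sum)
open import Data.Nat.ListAction.Properties using (sum-++; sum-↭)
open import Data.Maybe using (Maybe; just; nothing)
import Data.Maybe as Maybe
open import Data.Product using (∃; _×_; _,_; proj₁; proj₂)
open import Data.Sum using (_⊎_; inj₁; inj₂)
import Data.Sum as Sum
open import Function using (_∘_; id)
open import Relation.Nullary using (¬_; Dec; yes; no; contradiction)
open import Data.Empty using (⊥)
open import Data.Unit using (⊤)
open import Data.List.Relation.Unary.Linked using (Linked; _∷_)
open import Relation.Binary.Definitions using (tri<; tri≈; tri>)
open import Relation.Binary.PropositionalEquality using (_≡_; _≢_; refl; sym; trans; cong; cong₂; subst; subst₂; module ≡-Reasoning)
open import Algebra.Bundles using (AbelianGroup; Group)
import Data.Fin as Fin
open Fin using (Fin; toℕ; opposite)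
open import Data.Fin.Properties using (toℕ-fromℕ<; toℕ<n; toℕ-cast; opposite-prop; toℕ-injective) renaming (suc-injective to suc-injectiveF)
open import Relation.Binary.PropositionalEquality.Algebra using (isMagma)
open import Relation.Binary.PropositionalEquality.Properties using (setoid)
open import Relation.Nullary.Decidable using (dec-true; dec-false)
open import Data.Bool.Properties using (∧-comm; ∨-comm; ∧-zeroʳ; ∧-identityʳ)
open import Data.Fin.Permutation using (Permutation; _⟨$⟩ʳ_; _⟨$⟩ˡ_; inverseˡ; inverseʳ; cast-id; _∘ₚ_; reverse)
open import Data.List.Relation.Binary.Permutation.Homogeneous using (onIndices)
open import Data.List.Relation.Binary.Permutation.Setoid.Properties using (onIndices-lookup)
open import Algebra.Properties.CommutativeMonoid.Sum +-0-commutativeMonoid using (∑-distrib-+; sum-cong-≗) renaming (sum to ∑)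

-- A configuration can be attached to a labelling of size n only if it starts at `hi e`, where e is
-- the label of the free end: then the link has difference exactly n and the edges inside have n +
-- 1, n + 2, .... So everything is governed by e, and the lengthening paths are built to give back
-- the end label e. The far end of such a path is forced by its start; for 4e + 1 new vertices both
-- ends would be the same vertex, and this one length has to be dodged throughout. An odd cycle
-- needs an edge inside one side. That edge receives the difference n, so the size n at the moment
-- of insertion is prescribed by e and the cycle length, and the path must first be lengthened to
-- exactly this size. A cycle of length 2k + 1 then moves the end label from e to 7(e + k) + 4, the
-- origin of the powers of 7. When the forbidden length stands in the way, two more half blocks give
-- 11 in place of 7; this is affordable because e is then small compared with the new cycle.

private variable
  A B C D : Set
  u x y z : A

-- Rearranging concatenations: both sides are compared as lists of indices of blocks.

concatMap-↭ : (f : A → List B) {xs ys : List A} → xs ↭ ys → concatMap f xs ↭ concatMap f ys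
concatMap-↭ f _↭_.refl         = ↭-refl
concatMap-↭ f (_↭_.prep x p)   = ++⁺ˡ (f x) (concatMap-↭ f p)
concatMap-↭ f (_↭_.swap {xs = xs} {ys = ys} x y p) = begin
  f x ++ f y ++ concatMap f xs    ↭⟨ ++⁺ˡ (f x) (++⁺ˡ (f y) (concatMap-↭ f p)) ⟩
  f x ++ f y ++ concatMap f ys    ≡⟨ ++-assoc (f x) (f y) _ ⟨
  (f x ++ f y) ++ concatMap f ys  ↭⟨ ++⁺ʳ _ (++-comm (f x) (f y)) ⟩
  (f y ++ f x) ++ concatMap f ys  ≡⟨ ++-assoc (f y) (f x) _ ⟩
  f y ++ f x ++ concatMap f ys    ∎
  where open PermutationReasoning
concatMap-↭ f (_↭_.trans p q)  = ↭-trans (concatMap-↭ f p) (concatMap-↭ f q)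

infixr 5 _⊕_

data Ex : Set where
  #   : ℕ → Ex
  _⊕_ : Ex → Ex → Ex

atom : List (List A) → ℕ → List A
atom []       _       = []
atom (a ∷ as) zero    = a
atom (a ∷ as) (suc i) = atom as i

⟦_⟧ : Ex → List (List A) → List A
⟦ # i ⟧   ρ = atom ρ i
⟦ e ⊕ f ⟧ ρ = ⟦ e ⟧ ρ ++ ⟦ f ⟧ ρ

flat : Ex → List ℕ
flat (# i)   = i ∷ []
flat (e ⊕ f) = flat e ++ flat f

remove : ℕ → List ℕ → Maybe (List ℕ)
remove i []       = nothing
remove i (j ∷ js) with i ≡ᵇ j | remove i js
... | true  | _       = just js
... | false | just ks = just (j ∷ ks)
... | false | nothing = nothing

same : List ℕ → List ℕ → Bool
same []       []      = true
same []       (_ ∷ _) = false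
same (i ∷ is) js with remove i js
... | just ks = same is ks
... | nothing = false

flat-correct : (ρ : List (List A)) (e : Ex) → ⟦ e ⟧ ρ ≡ concatMap (atom ρ) (flat e)
flat-correct ρ (# i)   = sym (++-identityʳ _)
flat-correct ρ (e ⊕ f) =
  trans (cong₂ _++_ (flat-correct ρ e) (flat-correct ρ f)) (sym (concatMap-++ (atom ρ) (flat e) (flat f)))

remove-correct : ∀ i js {ks} → remove i js ≡ just ks → js ↭ i ∷ ks
remove-correct i (j ∷ js) eq with i ≡ᵇ j in i≡j | remove i js in r
remove-correct i (j ∷ js) refl | true  | _ =
  ↭-reflexive (cong (_∷ js) (sym (≡ᵇ⇒≡ i j (subst T (sym i≡j) _))))
remove-correct i (j ∷ js) refl | false | just ks =
  ↭-trans (prep j (remove-correct i js r)) (swap j i ↭-refl)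

same-correct : ∀ is js → same is js ≡ true → is ↭ js
same-correct []       []      _  = ↭-refl
same-correct (i ∷ is) js eq with remove i js in r
... | just ks = ↭-trans (prep i (same-correct is ks eq)) (↭-sym (remove-correct i js r))

rearrange : (ρ : List (List A)) (e f : Ex) → same (flat e) (flat f) ≡ true → ⟦ e ⟧ ρ ↭ ⟦ f ⟧ ρ
rearrange ρ e f eq = begin
  ⟦ e ⟧ ρ                    ≡⟨ flat-correct ρ e ⟩
  concatMap (atom ρ) (flat e) ↭⟨ concatMap-↭ (atom ρ) (same-correct (flat e) (flat f) eq) ⟩
  concatMap (atom ρ) (flat f) ≡⟨ flat-correct ρ f ⟨
  ⟦ f ⟧ ρ                    ∎
  where open PermutationReasoning

-- Ranges

downFrom-+ : ∀ m n → downFrom (m + n) ≡ map (_+ n) (downFrom m) ++ downFrom n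
downFrom-+ zero    n = refl
downFrom-+ (suc m) n = cong (m + n ∷_) (downFrom-+ m n)

downFrom-suc : ∀ n → downFrom (suc n) ↭ map suc (downFrom n) ++ 0 ∷ []
downFrom-suc n = ↭-reflexive (trans (cong downFrom (+-comm 1 n))
  (trans (downFrom-+ n 1) (cong (_++ 0 ∷ []) (map-cong (λ i → +-comm i 1) (downFrom n)))))

<-downFrom : ∀ n → All (_< n) (downFrom n)
<-downFrom zero    = []
<-downFrom (suc n) = ≤-refl ∷ All.map m≤n⇒m≤1+n (<-downFrom n)

map-congAll : {f g : A → B} {xs : List A} → All (λ a → f a ≡ g a) xs → map f xs ≡ map g xs
map-congAll []       = refl
map-congAll (e ∷ es) = cong₂ _∷_ e (map-congAll es)

reverse-downFrom : ∀ n → map (λ i → n ∸ suc i) (downFrom n) ↭ downFrom n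
reverse-downFrom zero    = ↭-refl
reverse-downFrom (suc n) = begin
  n ∸ n ∷ map (λ i → n ∸ i) (downFrom n)
    ≡⟨ cong₂ _∷_ (n∸n≡0 n) (map-congAll (All.map (λ i<n → sym (m∸n≡suc i<n)) (<-downFrom n))) ⟩
  0 ∷ map (λ i → suc (n ∸ suc i)) (downFrom n)
    ≡⟨ cong (0 ∷_) (map-∘ (downFrom n)) ⟩
  0 ∷ map suc (map (λ i → n ∸ suc i) (downFrom n))
    ↭⟨ prep 0 (map⁺ suc (reverse-downFrom n)) ⟩
  0 ∷ map suc (downFrom n)
    ↭⟨ ++-comm (0 ∷ []) (map suc (downFrom n)) ⟩
  map suc (downFrom n) ++ 0 ∷ []
    ↭⟨ downFrom-suc n ⟨
  downFrom (suc n) ∎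
  where
  open PermutationReasoning
  m∸n≡suc : ∀ {i n} → i < n → suc (n ∸ suc i) ≡ n ∸ i
  m∸n≡suc {i} {suc n} (s≤s i≤n) = sym (+-∸-assoc 1 i≤n)

-- Walks

infixr 5 _∷_ _▸_

-- Any nonempty sequence of labels is a walk. The ends are indices, so that linking two walks or
-- closing one needs no search for the last vertex; distinctness comes later, from `verts` being a
-- rearrangement of a range.
data Walk {A : Set} : A → A → Set where
  [_] : ∀ x → Walk x x
  _∷_ : ∀ x {y z} → Walk y z → Walk x z

verts : Walk {A} x y → List A
verts [ x ]   = x ∷ []
verts (x ∷ p) = x ∷ verts p

steps : (A → A → B) → Walk {A} x y → List B
steps d [ x ]         = []
steps d (_∷_ x {y} p) = d x y ∷ steps d p

_▸_ : Walk {A} x y → Walk z u → Walk x u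
[ x ]   ▸ q = x ∷ q
(x ∷ p) ▸ q = x ∷ (p ▸ q)

verts-▸ : (p : Walk {A} x y) (q : Walk z u) → verts (p ▸ q) ≡ verts p ++ verts q
verts-▸ [ x ]   q = refl
verts-▸ (x ∷ p) q = cong (x ∷_) (verts-▸ p q)

steps-▸ : (d : A → A → B) (p : Walk x y) (q : Walk z u) →
  steps d (p ▸ q) ≡ steps d p ++ d y z ∷ steps d q
steps-▸ d [ x ]         q = refl
steps-▸ d (_∷_ x {y} p) q = cong (d x y ∷_) (steps-▸ d p q)

rev : Walk {A} x y → Walk y x
rev [ x ]   = [ x ]
rev (x ∷ p) = rev p ▸ [ x ]

verts-rev : (p : Walk {A} x y) → verts (rev p) ↭ verts p
verts-rev [ x ]   = ↭-refl
verts-rev (x ∷ p) = ↭-trans (↭-reflexive (verts-▸ (rev p) [ x ]))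
  (↭-trans (++-comm (verts (rev p)) (x ∷ [])) (prep x (verts-rev p)))

steps-rev : (d : A → A → B) → (∀ x y → d x y ≡ d y x) → (p : Walk x y) → steps d (rev p) ↭ steps d p
steps-rev d d-sym [ x ]         = ↭-refl
steps-rev d d-sym (_∷_ x {y} p) = ↭-trans (↭-reflexive (steps-▸ d (rev p) [ x ]))
  (↭-trans (++-comm (steps d (rev p)) (d y x ∷ []))
    (↭-trans (↭-reflexive (cong (_∷ steps d (rev p)) (d-sym y x))) (prep (d x y) (steps-rev d d-sym p))))

mapW : (f : A → B) → Walk x y → Walk (f x) (f y)
mapW f [ x ]   = [ f x ]
mapW f (x ∷ p) = f x ∷ mapW f p

verts-map : (f : A → B) (p : Walk x y) → verts (mapW f p) ≡ map f (verts p)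
verts-map f [ x ]   = refl
verts-map f (x ∷ p) = cong (f x ∷_) (verts-map f p)

head-verts : {P : A → Set} (p : Walk x y) → All P (verts p) → P x
head-verts [ x ]   (h ∷ _) = h
head-verts (x ∷ p) (h ∷ _) = h

last-verts : {P : A → Set} (p : Walk x y) → All P (verts p) → P y
last-verts [ x ]   (h ∷ _)  = h
last-verts (x ∷ p) (_ ∷ hs) = last-verts p hs

steps-map : (d : A → A → C) (d′ : B → B → D) (f : A → B) (g : C → D) {P : A → Set} →
  (∀ a b → P a → P b → d′ (f a) (f b) ≡ g (d a b)) →
  (p : Walk x y) → All P (verts p) → steps d′ (mapW f p) ≡ map g (steps d p)
steps-map d d′ f g h [ x ]         _        = refl
steps-map d d′ f g h (_∷_ x {y} p) (a ∷ as) =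
  cong₂ _∷_ (h x y a (head-verts p as)) (steps-map d d′ f g h p as)

record Cycle (A : Set) : Set where
  constructor ⟲_
  field
    {first last} : A
    walk         : Walk first last
open Cycle public

cverts : Cycle A → List A
cverts c = verts (walk c)

csteps : (A → A → B) → Cycle A → List B
csteps d c = d (last c) (first c) ∷ steps d (walk c)

size : Cycle A → ℕ
size c = length (cverts c)

mapC : (A → B) → Cycle A → Cycle B
mapC f (⟲ p) = ⟲ mapW f p

allverts : List (Cycle A) → List A
allverts = concatMap cverts

allsteps : (A → A → B) → List (Cycle A) → List B
allsteps d = concatMap (csteps d)

allverts-map : (f : A → B) (cs : List (Cycle A)) → allverts (map (mapC f) cs) ≡ map f (allverts cs)
allverts-map f []       = refl
allverts-map f (c ∷ cs) =
  trans (cong₂ _++_ (verts-map f (walk c)) (allverts-map f cs)) (sym (map-++ f (cverts c) (allverts cs)))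

allsteps-map : (d : A → A → C) (d′ : B → B → D) (f : A → B) (g : C → D) {P : A → Set} →
  (∀ a b → P a → P b → d′ (f a) (f b) ≡ g (d a b)) →
  (cs : List (Cycle A)) → All P (allverts cs) → allsteps d′ (map (mapC f) cs) ≡ map g (allsteps d cs)
allsteps-map d d′ f g h []       _  = refl
allsteps-map d d′ f g h (c ∷ cs) as = trans
  (cong₂ _++_
    (cong₂ _∷_ (h _ _ (last-verts (walk c) p) (head-verts (walk c) p)) (steps-map d d′ f g h (walk c) p))
    (allsteps-map d d′ f g h cs q))
  (sym (map-++ g (csteps d c) (allsteps d cs)))
  where
  p = All.++⁻ˡ (cverts c) as
  q = All.++⁻ʳ (cverts c) as

sizes-map : (f : A → B) (cs : List (Cycle A)) → map size (map (mapC f) cs) ≡ map size cs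
sizes-map f []       = refl
sizes-map f (c ∷ cs) =
  cong₂ _∷_ (trans (cong length (verts-map f (walk c))) (length-map f (cverts c))) (sizes-map f cs)

-- Bipartite configurations

-- Around an interval of n labels, lo i stands for the i-th label below and hi j for the j-th label above it;
-- their difference is i + j + n + 1, and weight i + j is what matters.
data V : Set where
  lo hi : ℕ → V

weight : V → V → Maybe ℕ
weight (lo i) (hi j) = just (i + j)
weight (hi j) (lo i) = just (i + j)
weight (lo _) (lo _) = nothing
weight (hi _) (hi _) = nothing

weight-sym : ∀ x y → weight x y ≡ weight y x
weight-sym (lo i) (hi j) = refl
weight-sym (hi j) (lo i) = refl
weight-sym (lo _) (lo _) = refl
weight-sym (hi _) (hi _) = refl

box : ℕ → ℕ → List V
box b a = map hi (downFrom b) ++ map lo (downFrom a)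

weights : ℕ → List (Maybe ℕ)
weights m = map just (downFrom m)

-- mv and mw are the vertices and weights left out.
record Fill (b a : ℕ) (s t : V) (ls : List ℕ) (mv : List V) (mw : List (Maybe ℕ)) : Set where
  constructor fill
  field
    path   : Walk s t
    cycles : List (Cycle V)
    sizes  : map size cycles ≡ ls
    m      : ℕ
    suc-m  : suc m ≡ b + a
    vs     : mv ++ verts path ++ allverts cycles ↭ box b a
    es     : mw ++ steps weight path ++ allsteps weight cycles ↭ weights m

InBox : ℕ → ℕ → V → Set
InBox b a (lo i) = i < a
InBox b a (hi j) = j < b

box-InBox : ∀ b a → All (InBox b a) (box b a)
box-InBox b a = All.++⁺ (All.map⁺ (<-downFrom b)) (All.map⁺ (<-downFrom a))

weights-+ : ∀ m n → weights (m + n) ≡ map (Maybe.map (_+ n)) (weights m) ++ weights n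
weights-+ m n = begin
  map just (downFrom (m + n))
    ≡⟨ cong (map just) (downFrom-+ m n) ⟩
  map just (map (_+ n) (downFrom m) ++ downFrom n)
    ≡⟨ map-++ just (map (_+ n) (downFrom m)) (downFrom n) ⟩
  map just (map (_+ n) (downFrom m)) ++ weights n
    ≡⟨ cong (_++ weights n) (trans (sym (map-∘ (downFrom m))) (map-∘ (downFrom m))) ⟩
  map (Maybe.map (_+ n)) (weights m) ++ weights n ∎
  where open ≡-Reasoning

map₃ : (f : A → B) (xs ys zs : List A) → map f (xs ++ ys ++ zs) ≡ map f xs ++ map f ys ++ map f zs
map₃ f xs ys zs = trans (map-++ f xs (ys ++ zs)) (cong (map f xs ++_) (map-++ f ys zs))

-- The walk z fills a corner with the weights below q, and is linked to a shifted copy of the configuration.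
-- If the link does not use the weight q itself, it exchanges q for one of the missing weights.
prefix : ∀ {b a b′ a′ s t z₀ z₁ ls mv mw mw′ vz} (q : ℕ) (f : V → V) (z : Walk z₀ z₁) →
  (∀ x y → weight (f x) (f y) ≡ Maybe.map (_+ suc q) (weight x y)) →
  verts z ↭ vz → steps weight z ≡ weights q →
  weight z₁ (f s) ∷ mw′ ↭ just q ∷ map (Maybe.map (_+ suc q)) mw →
  vz ++ map f (box b a) ↭ box b′ a′ → b′ + a′ ≡ b + a + suc q →
  Fill b a s t ls mv mw → Fill b′ a′ z₀ (f t) ls (map f mv) mw′
prefix {b} {a} {b′} {a′} {s} {t} {z₀} {z₁} {ls} {mv} {mw} {mw′} {vz} q f z f-weight z-verts z-steps jump boxes total F = record
  { path   = z ▸ mapW f path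
  ; cycles = map (mapC f) cycles
  ; sizes  = trans (sizes-map f cycles) sizes
  ; m      = m + suc q
  ; suc-m  = trans (cong (_+ suc q) suc-m) (sym total)
  ; vs     = begin
      map f mv ++ verts (z ▸ mapW f path) ++ allverts (map (mapC f) cycles)
        ≡⟨ cong (map f mv ++_) (cong₂ _++_ (trans (verts-▸ z (mapW f path)) (cong (verts z ++_) (verts-map f path))) (allverts-map f cycles)) ⟩
      map f mv ++ (verts z ++ map f (verts path)) ++ map f (allverts cycles)
        ↭⟨ rearrange (map f mv ∷ verts z ∷ map f (verts path) ∷ map f (allverts cycles) ∷ [])
             (# 0 ⊕ (# 1 ⊕ # 2) ⊕ # 3) (# 1 ⊕ # 0 ⊕ # 2 ⊕ # 3) refl ⟩
      verts z ++ map f mv ++ map f (verts path) ++ map f (allverts cycles)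
        ≡⟨ cong (verts z ++_) (map₃ f mv (verts path) (allverts cycles)) ⟨
      verts z ++ map f (mv ++ verts path ++ allverts cycles)
        ↭⟨ ++⁺ z-verts (map⁺ f vs) ⟩
      vz ++ map f (box b a)
        ↭⟨ boxes ⟩
      box b′ a′ ∎
  ; es     = begin
      mw′ ++ steps weight (z ▸ mapW f path) ++ allsteps weight (map (mapC f) cycles)
        ≡⟨ cong (mw′ ++_) (cong₂ _++_ (trans (steps-▸ weight z (mapW f path)) (cong₂ _++_ z-steps
             (cong (j ∷_) (steps-map weight weight f g {P = λ _ → ⊤} (λ x y _ _ → f-weight x y) path (All.universal _ _)))))
             (allsteps-map weight weight f g {P = λ _ → ⊤} (λ x y _ _ → f-weight x y) cycles (All.universal _ _))) ⟩
      mw′ ++ (weights q ++ j ∷ map g (steps weight path)) ++ map g (allsteps weight cycles)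
        ↭⟨ rearrange (mw′ ∷ weights q ∷ (j ∷ []) ∷ map g (steps weight path) ∷ map g (allsteps weight cycles) ∷ [])
             (# 0 ⊕ (# 1 ⊕ # 2 ⊕ # 3) ⊕ # 4) ((# 2 ⊕ # 0) ⊕ # 3 ⊕ # 4 ⊕ # 1) refl ⟩
      (j ∷ mw′) ++ map g (steps weight path) ++ map g (allsteps weight cycles) ++ weights q
        ↭⟨ ++⁺ʳ _ jump ⟩
      (just q ∷ map g mw) ++ map g (steps weight path) ++ map g (allsteps weight cycles) ++ weights q
        ↭⟨ rearrange (map g mw ∷ weights q ∷ (just q ∷ []) ∷ map g (steps weight path) ∷ map g (allsteps weight cycles) ∷ [])
             ((# 2 ⊕ # 0) ⊕ # 3 ⊕ # 4 ⊕ # 1) ((# 0 ⊕ # 3 ⊕ # 4) ⊕ # 2 ⊕ # 1) refl ⟩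
      (map g mw ++ map g (steps weight path) ++ map g (allsteps weight cycles)) ++ weights (suc q)
        ≡⟨ cong (_++ weights (suc q)) (map₃ g mw (steps weight path) (allsteps weight cycles)) ⟨
      map g (mw ++ steps weight path ++ allsteps weight cycles) ++ weights (suc q)
        ↭⟨ ++⁺ʳ (weights (suc q)) (map⁺ g es) ⟩
      map g (weights m) ++ weights (suc q)
        ≡⟨ weights-+ m (suc q) ⟨
      weights (m + suc q) ∎
  }
  where
  open Fill F
  open PermutationReasoning
  g = Maybe.map (_+ suc q)
  j = weight z₁ (f s)

-- The indices on the two sides drop alternately, so the weight falls by exactly one at each step
-- and reaches 0. The variant `zigzag⁺` differs by ending on the other side.
zigzag : ∀ e → Walk (hi e) (hi 0)
zigzag zero    = [ hi 0 ]
zigzag (suc e) = hi (suc e) ∷ lo e ∷ zigzag e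

zigzag-verts : ∀ e → verts (zigzag e) ↭ box (suc e) e
zigzag-verts zero    = ↭-refl
zigzag-verts (suc e) = ↭-trans (prep _ (prep _ (zigzag-verts e)))
  (rearrange ((hi (suc e) ∷ []) ∷ (lo e ∷ []) ∷ map hi (downFrom (suc e)) ∷ map lo (downFrom e) ∷ [])
    (# 0 ⊕ # 1 ⊕ # 2 ⊕ # 3) ((# 0 ⊕ # 2) ⊕ # 1 ⊕ # 3) refl)

zigzag-steps : ∀ e → steps weight (zigzag e) ≡ weights (e + e)
zigzag-steps zero    = refl
zigzag-steps (suc e) = cong (just (e + suc e) ∷_)
  (trans (cong (just (e + e) ∷_) (zigzag-steps e)) (cong weights (sym (+-suc e e))))

zigzag⁺ : ∀ e → Walk (hi e) (lo 0)
zigzag⁺ zero    = hi 0 ∷ [ lo 0 ]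
zigzag⁺ (suc e) = hi (suc e) ∷ lo (suc e) ∷ zigzag⁺ e

zigzag⁺-verts : ∀ e → verts (zigzag⁺ e) ↭ box (suc e) (suc e)
zigzag⁺-verts zero    = ↭-refl
zigzag⁺-verts (suc e) = ↭-trans (prep _ (prep _ (zigzag⁺-verts e)))
  (rearrange ((hi (suc e) ∷ []) ∷ (lo (suc e) ∷ []) ∷ map hi (downFrom (suc e)) ∷ map lo (downFrom (suc e)) ∷ [])
    (# 0 ⊕ # 1 ⊕ # 2 ⊕ # 3) ((# 0 ⊕ # 2) ⊕ # 1 ⊕ # 3) refl)

zigzag⁺-steps : ∀ e → steps weight (zigzag⁺ e) ≡ weights (suc (e + e))
zigzag⁺-steps zero    = refl
zigzag⁺-steps (suc e) = cong (just (suc e + suc e) ∷_)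
  (trans (cong (just (suc e + e) ∷_) (zigzag⁺-steps e)) (cong weights (cong suc (sym (+-suc e e)))))

swapShift : ℕ → V → V
swapShift e (hi j) = lo (j + e)
swapShift e (lo i) = hi (i + suc e)

shiftBoth : ℕ → V → V
shiftBoth e (hi j) = hi (j + e)
shiftBoth e (lo i) = lo (i + e)

swapShift-weight : ∀ e x y → weight (swapShift e x) (swapShift e y) ≡ Maybe.map (_+ suc (e + e)) (weight x y)
swapShift-weight e (lo i) (hi j) = cong just (eq e i j)
  where
  eq : ∀ e i j → j + e + (i + suc e) ≡ i + j + suc (e + e)
  eq = solve-∀
swapShift-weight e (hi j) (lo i) = cong just (eq e i j)
  where
  eq : ∀ e i j → j + e + (i + suc e) ≡ i + j + suc (e + e)
  eq = solve-∀
swapShift-weight e (lo _) (lo _) = refl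
swapShift-weight e (hi _) (hi _) = refl

shiftBoth-weight : ∀ e x y → weight (shiftBoth e x) (shiftBoth e y) ≡ Maybe.map (_+ (e + e)) (weight x y)
shiftBoth-weight e (lo i) (hi j) = cong just (eq e i j)
  where
  eq : ∀ e i j → i + e + (j + e) ≡ i + j + (e + e)
  eq = solve-∀
shiftBoth-weight e (hi j) (lo i) = cong just (eq e i j)
  where
  eq : ∀ e i j → i + e + (j + e) ≡ i + j + (e + e)
  eq = solve-∀
shiftBoth-weight e (lo _) (lo _) = refl
shiftBoth-weight e (hi _) (hi _) = refl

map-downFrom-+ : ∀ (f : ℕ → A) m n → map f (downFrom (m + n)) ≡ map (λ i → f (i + n)) (downFrom m) ++ map f (downFrom n)
map-downFrom-+ f m n = trans (cong (map f) (downFrom-+ m n))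
  (trans (map-++ f (map (_+ n) (downFrom m)) (downFrom n)) (cong (_++ map f (downFrom n)) (sym (map-∘ (downFrom m)))))

swapShift-box : ∀ e b a → box (suc e) e ++ map (swapShift e) (box b a) ↭ box (a + suc e) (b + e)
swapShift-box e b a = begin
  box (suc e) e ++ map (swapShift e) (box b a)
    ≡⟨ cong (box (suc e) e ++_) (trans (map-++ (swapShift e) (map hi (downFrom b)) (map lo (downFrom a)))
         (cong₂ _++_ (sym (map-∘ (downFrom b))) (sym (map-∘ (downFrom a))))) ⟩
  box (suc e) e ++ map (λ j → lo (j + e)) (downFrom b) ++ map (λ i → hi (i + suc e)) (downFrom a)
    ↭⟨ rearrange (map hi (downFrom (suc e)) ∷ map lo (downFrom e) ∷ map (λ j → lo (j + e)) (downFrom b) ∷ map (λ i → hi (i + suc e)) (downFrom a) ∷ [])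
         ((# 0 ⊕ # 1) ⊕ # 2 ⊕ # 3) ((# 3 ⊕ # 0) ⊕ # 2 ⊕ # 1) refl ⟩
  (map (λ i → hi (i + suc e)) (downFrom a) ++ map hi (downFrom (suc e))) ++ map (λ j → lo (j + e)) (downFrom b) ++ map lo (downFrom e)
    ≡⟨ cong₂ _++_ (map-downFrom-+ hi a (suc e)) (map-downFrom-+ lo b e) ⟨
  box (a + suc e) (b + e) ∎
  where open PermutationReasoning

shiftBoth-box : ∀ e b a → box e e ++ map (shiftBoth e) (box b a) ↭ box (b + e) (a + e)
shiftBoth-box e b a = begin
  box e e ++ map (shiftBoth e) (box b a)
    ≡⟨ cong (box e e ++_) (trans (map-++ (shiftBoth e) (map hi (downFrom b)) (map lo (downFrom a)))
         (cong₂ _++_ (sym (map-∘ (downFrom b))) (sym (map-∘ (downFrom a))))) ⟩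
  box e e ++ map (λ j → hi (j + e)) (downFrom b) ++ map (λ i → lo (i + e)) (downFrom a)
    ↭⟨ rearrange (map hi (downFrom e) ∷ map lo (downFrom e) ∷ map (λ j → hi (j + e)) (downFrom b) ∷ map (λ i → lo (i + e)) (downFrom a) ∷ [])
         ((# 0 ⊕ # 1) ⊕ # 2 ⊕ # 3) ((# 2 ⊕ # 0) ⊕ # 3 ⊕ # 1) refl ⟩
  (map (λ j → hi (j + e)) (downFrom b) ++ map hi (downFrom e)) ++ map (λ i → lo (i + e)) (downFrom a) ++ map lo (downFrom e)
    ≡⟨ cong₂ _++_ (map-downFrom-+ hi b e) (map-downFrom-+ lo a e) ⟨
  box (b + e) (a + e) ∎
  where open PermutationReasoning

-- The zigzag uses the weights below 2e and stops at `hi 0`, so the rest must be entered at a low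
-- vertex. Exchanging the sides turns its start `hi e` into `lo (e + e)`, and the link gets the next
-- weight 2e.
halfBlock : ∀ {b a t ls mv mw} e → Fill b a (hi e) t ls mv mw →
  Fill (a + suc e) (b + e) (hi e) (swapShift e t) ls (map (swapShift e) mv) (map (Maybe.map (_+ suc (e + e))) mw)
halfBlock {b} {a} {mw = mw} e = prefix (e + e) (swapShift e) (zigzag e) (swapShift-weight e) (zigzag-verts e) (zigzag-steps e)
  (↭-reflexive (cong (λ k → just k ∷ map (Maybe.map (_+ suc (e + e))) mw) (+-identityʳ (e + e)))) (swapShift-box e b a) (eq b a e)
  where
  eq : ∀ b a e → a + suc e + (b + e) ≡ b + a + suc (e + e)
  eq = solve-∀

-- Here the zigzag stops at `lo 0`, so the sides are kept; the link to `hi (e + suc e)` has weight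
-- 2e + 1, the first one not in the corner.
fullBlock : ∀ {b a t ls} e → Fill b a (hi e) t ls [] [] → Fill (b + suc e) (a + suc e) (hi e) (shiftBoth (suc e) t) ls [] []
fullBlock {b} {a} e = prefix (suc (e + e)) (shiftBoth (suc e)) (zigzag⁺ e)
  (λ x y → trans (shiftBoth-weight (suc e) x y) (cong (λ k → Maybe.map (_+ suc k) (weight x y)) (+-suc e e)))
  (zigzag⁺-verts e) (zigzag⁺-steps e) (↭-reflexive (cong (λ k → just k ∷ []) (+-suc e e))) (shiftBoth-box (suc e) b a) (eq b a e)
  where
  eq : ∀ b a e → b + suc e + (a + suc e) ≡ b + a + suc (suc (e + e))
  eq = solve-∀

-- Reversing each side turns weight k into `m ∸ suc k`, which permutes the full range of weights. It
-- exchanges the roles of x and e below, and later moves `hi 1` to the far edge of a box.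
mirror : ℕ → ℕ → V → V
mirror b a (hi j) = hi (b ∸ suc j)
mirror b a (lo i) = lo (a ∸ suc i)

mirror-+ : ∀ {a b m i j} → suc m ≡ b + a → i < a → j < b → (a ∸ suc i) + (b ∸ suc j) ≡ m ∸ suc (i + j)
mirror-+ {a} {b} {m} {i} {j} m≡ i<a j<b = begin
  p + q                                    ≡⟨ m+n∸m≡n (suc (i + j)) (p + q) ⟨
  suc (i + j) + (p + q) ∸ suc (i + j)      ≡⟨ cong (_∸ suc (i + j)) (suc-injective (trans (eq i j p q) (trans (cong₂ _+_ (m+[n∸m]≡n j<b) (m+[n∸m]≡n i<a)) (sym m≡)))) ⟩
  m ∸ suc (i + j)                          ∎
  where
  open ≡-Reasoning
  p = a ∸ suc i
  q = b ∸ suc j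
  eq : ∀ i j p q → suc (suc (i + j) + (p + q)) ≡ suc j + q + (suc i + p)
  eq = solve-∀

mirror-weight : ∀ {a b m} → suc m ≡ b + a → ∀ x y → InBox b a x → InBox b a y →
  weight (mirror b a x) (mirror b a y) ≡ Maybe.map (λ k → m ∸ suc k) (weight x y)
mirror-weight m≡ (lo i) (hi j) i<a j<b = cong just (mirror-+ m≡ i<a j<b)
mirror-weight m≡ (hi j) (lo i) j<b i<a = cong just (mirror-+ m≡ i<a j<b)
mirror-weight m≡ (lo _) (lo _) _ _ = refl
mirror-weight m≡ (hi _) (hi _) _ _ = refl

mirror-box : ∀ b a → map (mirror b a) (box b a) ↭ box b a
mirror-box b a = begin
  map (mirror b a) (box b a)
    ≡⟨ map-++ (mirror b a) (map hi (downFrom b)) (map lo (downFrom a)) ⟩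
  map (mirror b a) (map hi (downFrom b)) ++ map (mirror b a) (map lo (downFrom a))
    ≡⟨ cong₂ _++_ (trans (sym (map-∘ (downFrom b))) (map-∘ (downFrom b))) (trans (sym (map-∘ (downFrom a))) (map-∘ (downFrom a))) ⟩
  map hi (map (λ j → b ∸ suc j) (downFrom b)) ++ map lo (map (λ i → a ∸ suc i) (downFrom a))
    ↭⟨ ++⁺ (map⁺ hi (reverse-downFrom b)) (map⁺ lo (reverse-downFrom a)) ⟩
  box b a ∎
  where open PermutationReasoning

reflect : ∀ {b a s t ls} → Fill b a s t ls [] [] → Fill b a (mirror b a s) (mirror b a t) ls [] []
reflect {b} {a} F = record
  { path   = mapW f path
  ; cycles = map (mapC f) cycles
  ; sizes  = trans (sizes-map f cycles) sizes
  ; m      = m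
  ; suc-m  = suc-m
  ; vs     = begin
      verts (mapW f path) ++ allverts (map (mapC f) cycles)
        ≡⟨ cong₂ _++_ (verts-map f path) (allverts-map f cycles) ⟩
      map f (verts path) ++ map f (allverts cycles)
        ≡⟨ map-++ f (verts path) (allverts cycles) ⟨
      map f (verts path ++ allverts cycles)
        ↭⟨ map⁺ f vs ⟩
      map f (box b a)
        ↭⟨ mirror-box b a ⟩
      box b a ∎
  ; es     = begin
      steps weight (mapW f path) ++ allsteps weight (map (mapC f) cycles)
        ≡⟨ cong₂ _++_ (steps-map weight weight f g (mirror-weight suc-m) path (All.++⁻ˡ _ inBox))
             (allsteps-map weight weight f g (mirror-weight suc-m) cycles (All.++⁻ʳ (verts path) inBox)) ⟩
      map g (steps weight path) ++ map g (allsteps weight cycles)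
        ≡⟨ map-++ g (steps weight path) (allsteps weight cycles) ⟨
      map g (steps weight path ++ allsteps weight cycles)
        ↭⟨ map⁺ g es ⟩
      map g (weights m)
        ≡⟨ trans (sym (map-∘ (downFrom m))) (map-∘ (downFrom m)) ⟩
      map just (map (λ k → m ∸ suc k) (downFrom m))
        ↭⟨ map⁺ just (reverse-downFrom m) ⟩
      weights m ∎
  }
  where
  open Fill F
  open PermutationReasoning
  f = mirror b a
  g = Maybe.map (λ k → m ∸ suc k)
  inBox : All (InBox b a) (verts path ++ allverts cycles)
  inBox = All-resp-↭ (↭-sym vs) (box-InBox b a)

-- Rosa's theorem: paths in which the starting vertex is prescribed

-- The far end is no matter of choice. Summing i + j over the edges counts every vertex twice except
-- the two ends; comparison with the sum of all weights forces x + e = a - 1 on 2a vertices and x +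
-- e = a on 2a + 1 vertices.
EvenPath OddPath : ℕ → ℕ → Set
EvenPath x e = Fill (x + suc e) (x + suc e) (hi e) (lo x) [] [] []
OddPath  x e = Fill (suc (x + e)) (x + e) (hi e) (hi x) [] [] []

mirrorEven : ∀ {x e} → EvenPath x e → EvenPath e x
mirrorEven {x} {e} F = subst (λ a → Fill a a (hi x) (lo e) [] [] []) (trans (+-suc x e) (trans (cong suc (+-comm x e)) (sym (+-suc e x))))
  (subst₂ (λ j i → Fill (x + suc e) (x + suc e) (hi j) (lo i) [] [] []) (m+n∸n≡m x (suc e))
    (trans (cong (_∸ suc x) (+-suc x e)) (m+n∸m≡n x e)) (reflect F))

mirrorOdd : ∀ {x e} → OddPath x e → OddPath e x
mirrorOdd {x} {e} F = subst (λ a → Fill (suc a) a (hi x) (hi e) [] [] []) (+-comm x e)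
  (subst₂ (λ j i → Fill (suc (x + e)) (x + e) (hi j) (hi i) [] [] []) (m+n∸n≡m x e) (m+n∸m≡n x e) (reflect F))

point : OddPath 0 0
point = fill [ hi 0 ] [] refl 0 refl ↭-refl ↭-refl

mutual
  -- The argument n only bounds the recursion: it drops in `oddPath<` and at the full block.
  -- Mirroring reduces to the case where the block of the start fits into the box.
  evenPath : ∀ n x e → x + e ≤ n → EvenPath x e
  evenPath n x e h with ≤-total e x
  ... | inj₁ e≤x = subst (λ x → EvenPath x e) (m∸n+n≡m e≤x) (evenPath≤ n (x ∸ e) e (subst (λ x → x + e ≤ n) (sym (m∸n+n≡m e≤x)) h))
  ... | inj₂ x≤e = mirrorEven (subst (λ e → EvenPath e x) (m∸n+n≡m x≤e)
    (evenPath≤ n (e ∸ x) x (subst (_≤ n) (trans (+-comm x e) (cong (_+ x) (sym (m∸n+n≡m x≤e)))) h)))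

  evenPath≤ : ∀ n y e → y + e + e ≤ n → EvenPath (y + e) e
  evenPath≤ n y e h with y ≟ e
  evenPath≤ n y zero h | _ = evenByHalf (oddPath n y 0 (≤-trans (m≤m+n (y + 0) 0) h) (λ _ → refl))
  evenPath≤ n y (suc e) h | no y≢e = evenByHalf (oddPath n y (suc e) (≤-trans (m≤m+n (y + suc e) (suc e)) h) (λ y≡e → contradiction y≡e y≢e))
  -- Taking off a half block would leave an odd path with coinciding ends, so a full block is taken
  -- off.
  evenPath≤ (suc n) .(suc e) (suc e) (s≤s h) | yes refl =
    subst (λ x → Fill (x + suc (suc e)) (x + suc (suc e)) (hi (suc e)) (lo x) [] [] []) (+-suc e (suc e))
      (fullBlock (suc e) (evenPath n e (suc e) (≤-trans (m≤m+n (e + suc e) (suc e)) h)))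

  evenByHalf : ∀ {y e} → OddPath y e → EvenPath (y + e) e
  evenByHalf {y} {e} F = subst (λ a → Fill (y + e + suc e) a (hi e) (lo (y + e)) [] [] []) (sym (+-suc (y + e) e)) (halfBlock e F)

  -- If x = e, the path starts and ends in the same vertex and hence consists of it alone. This is
  -- Rosa's exception.
  oddPath : ∀ n x e → x + e ≤ n → (x ≡ e → e ≡ 0) → OddPath x e
  oddPath n x e h x≢e with <-cmp e x
  ... | tri< e<x _ _ = subst (λ x → OddPath x e) (m∸n+n≡m e<x) (oddPath< n (x ∸ suc e) e (subst (λ x → x + e ≤ n) (sym (m∸n+n≡m e<x)) h))
  ... | tri≈ _ refl _ = subst (λ e → OddPath e e) (sym (x≢e refl)) point
  ... | tri> _ _ x<e = mirrorOdd (subst (λ e → OddPath e x) (m∸n+n≡m x<e)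
    (oddPath< n (e ∸ suc x) x (subst (_≤ n) (trans (+-comm x e) (cong (_+ x) (sym (m∸n+n≡m x<e)))) h)))

  oddPath< : ∀ n x e → x + suc e + e ≤ n → OddPath (x + suc e) e
  oddPath< (suc n) x e h = subst (λ b → Fill b (x + suc e + e) (hi e) (hi (x + suc e)) [] [] []) (+-suc (x + suc e) e)
    (halfBlock e (evenPath n x e (≤-pred (≤-trans (≤-trans (≤-reflexive (sym (+-suc x e))) (m≤m+n (x + suc e) e)) h))))
  oddPath< zero x e h = contradiction (≤-trans (≤-reflexive (sym (+-suc x e))) (≤-trans (m≤m+n (x + suc e) e) h)) λ ()

-- Three strands

data Position : Set where
  left middle right : Position

-- Defined by recursion so that `climb (double (suc t))` computes to `climb (double t)` with two
-- weights in front.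
double : ℕ → ℕ
double zero    = zero
double (suc t) = suc (suc (double t))

double-+ : ∀ t → double t ≡ t + t
double-+ zero    = refl
double-+ (suc t) = cong suc (trans (cong suc (double-+ t)) (sym (+-suc t t)))

-- The first strand is the path, ending in s; the other two are the ends of a fragment, which is closed into a
-- cycle or absorbed by the path. Position tells on which of the three strands the path lies.
module Strands (B : Set) (d : V → V → B) (c : ℕ → B) (d-sym : ∀ x y → d x y ≡ d y x)
  (d-cross : ∀ i j → d (lo i) (hi j) ≡ c (i + j)) (δ : ℕ) (initial : List B) (s : V) where

  climb : ℕ → List B
  climb zero    = initial
  climb (suc m) = c (3 + (m + δ)) ∷ climb m

  -- The three highest touched high vertices are the upper ends of the strands.
  end : ℕ → ℕ → V
  end t i = hi (i + (t + δ))

  pathEnd fragFirst fragLast : Position → ℕ → V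
  pathEnd   left   t = end t 0
  pathEnd   middle t = end t 1
  pathEnd   right  t = end t 2
  fragFirst left   t = end t 2
  fragFirst middle t = end t 0
  fragFirst right  t = end t 1
  fragLast  left   t = end t 1
  fragLast  middle t = end t 2
  fragLast  right  t = end t 0

  -- All weights up to 4 + 2t + δ are in use except 3 + 2t + δ.
  record State (t : ℕ) (p : Position) (φ : ℕ) (ls : List ℕ) : Set where
    constructor state
    field
      path   : Walk (pathEnd p t) s
      frag   : Walk (fragFirst p t) (fragLast p t)
      cycles : List (Cycle V)
      φ-size : length (verts frag) ≡ φ
      sizes  : map size cycles ≡ ls
      vs     : verts path ++ verts frag ++ allverts cycles ↭ box (3 + (t + δ)) (3 + t)
      es     : steps d path ++ steps d frag ++ allsteps d cycles ↭ c (4 + (double t + δ)) ∷ climb (double t)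

  record Finished (b a : ℕ) (t : V) (m : ℕ) (ls : List ℕ) : Set where
    constructor finished
    field
      path   : Walk t s
      cycles : List (Cycle V)
      sizes  : map size cycles ≡ ls
      vs     : verts path ++ allverts cycles ↭ box b a
      es     : steps d path ++ allsteps d cycles ↭ climb m

  private
    weight-double : ∀ t δ → t + (t + δ) ≡ double t + δ
    weight-double zero    δ = refl
    weight-double (suc t) δ = cong suc (trans (+-suc t (t + δ)) (cong suc (weight-double t δ)))

    lh : ∀ t i j → d (lo (i + t)) (hi (j + (t + δ))) ≡ c (i + j + (double t + δ))
    lh t i j = trans (d-cross (i + t) (j + (t + δ))) (cong c (trans (eq i j t (t + δ)) (cong (i + j +_) (weight-double t δ))))
      where
      eq : ∀ i j t u → i + t + (j + u) ≡ i + j + (t + u)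
      eq = solve-∀

    hl : ∀ t j i → d (hi (j + (t + δ))) (lo (i + t)) ≡ c (i + j + (double t + δ))
    hl t j i = trans (d-sym _ _) (lh t i j)

    l h : ℕ → ℕ → V
    l t i = lo (i + t)
    h t i = hi (i + (t + δ))

    wt : ℕ → ℕ → B
    wt t k = c (k + (double t + δ))

    extend : ∀ {new} (added added′ : List B) {old old′ target : List B} →
      new ↭ added ++ old → added ≡ added′ → old ↭ old′ → added′ ++ old′ ↭ target → new ↭ target
    extend added _ p refl q r = ↭-trans p (↭-trans (++⁺ˡ added q) r)

  -- Weights are counted from 2t + δ. The new low vertex joins the lowest strand end to the new high
  -- vertex with the weights 3 and 6: the first closes the gap, the second opens the next one at 5.
  -- The lowest end has become the highest, so the position turns from left to right to middle to
  -- left.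
  advanceLeft : ∀ {t φ ls} → State t left φ ls → State (suc t) right φ ls
  advanceLeft {t} (state path frag cycles φ-size sizes vs es) = state
    (h t 3 ∷ l t 3 ∷ path) frag cycles φ-size sizes
    (↭-trans (prep _ (prep _ vs))
      (rearrange ((h t 3 ∷ []) ∷ (l t 3 ∷ []) ∷ map hi (downFrom (3 + (t + δ))) ∷ map lo (downFrom (3 + t)) ∷ [])
        (# 0 ⊕ # 1 ⊕ # 2 ⊕ # 3) ((# 0 ⊕ # 2) ⊕ # 1 ⊕ # 3) refl))
    (extend _ (wt t 6 ∷ wt t 3 ∷ []) ↭-refl (cong₂ _∷_ (hl t 3 3) (cong₂ _∷_ (lh t 3 0) refl)) es
      (rearrange ((wt t 6 ∷ []) ∷ (wt t 3 ∷ []) ∷ (wt t 4 ∷ []) ∷ climb (double t) ∷ [])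
        (# 0 ⊕ # 1 ⊕ # 2 ⊕ # 3) (# 0 ⊕ # 2 ⊕ # 1 ⊕ # 3) refl))

  advanceMiddle : ∀ {t φ ls} → State t middle φ ls → State (suc t) left (2 + φ) ls
  advanceMiddle {t} (state path frag cycles φ-size sizes vs es) = state
    path (h t 3 ∷ l t 3 ∷ frag) cycles (cong (2 +_) φ-size) sizes
    (↭-trans
      (rearrange (verts path ∷ (h t 3 ∷ []) ∷ (l t 3 ∷ []) ∷ verts frag ∷ allverts cycles ∷ [])
        (# 0 ⊕ (# 1 ⊕ # 2 ⊕ # 3) ⊕ # 4) (# 1 ⊕ # 2 ⊕ # 0 ⊕ # 3 ⊕ # 4) refl)
      (↭-trans (prep _ (prep _ vs))
        (rearrange ((h t 3 ∷ []) ∷ (l t 3 ∷ []) ∷ map hi (downFrom (3 + (t + δ))) ∷ map lo (downFrom (3 + t)) ∷ [])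
          (# 0 ⊕ # 1 ⊕ # 2 ⊕ # 3) ((# 0 ⊕ # 2) ⊕ # 1 ⊕ # 3) refl)))
    (extend (d (h t 3) (l t 3) ∷ d (l t 3) (h t 0) ∷ []) (wt t 6 ∷ wt t 3 ∷ [])
      (rearrange (steps d path ∷ (d (h t 3) (l t 3) ∷ []) ∷ (d (l t 3) (h t 0) ∷ []) ∷ steps d frag ∷ allsteps d cycles ∷ [])
        (# 0 ⊕ (# 1 ⊕ # 2 ⊕ # 3) ⊕ # 4) ((# 1 ⊕ # 2) ⊕ # 0 ⊕ # 3 ⊕ # 4) refl)
      (cong₂ _∷_ (hl t 3 3) (cong₂ _∷_ (lh t 3 0) refl)) es
      (rearrange ((wt t 6 ∷ []) ∷ (wt t 3 ∷ []) ∷ (wt t 4 ∷ []) ∷ climb (double t) ∷ [])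
        (# 0 ⊕ # 1 ⊕ # 2 ⊕ # 3) (# 0 ⊕ # 2 ⊕ # 1 ⊕ # 3) refl))

  advanceRight : ∀ {t φ ls} → State t right φ ls → State (suc t) middle (φ + 2) ls
  advanceRight {t} (state path frag cycles φ-size sizes vs es) = state
    path (frag ▸ (l t 3 ∷ [ h t 3 ])) cycles
    (trans (cong length (verts-▸ frag _)) (trans (length-++ (verts frag)) (cong (_+ 2) φ-size))) sizes
    (↭-trans (↭-reflexive (cong (λ xs → verts path ++ xs ++ allverts cycles) (verts-▸ frag (l t 3 ∷ [ h t 3 ]))))
      (↭-trans
        (rearrange (verts path ∷ (h t 3 ∷ []) ∷ (l t 3 ∷ []) ∷ verts frag ∷ allverts cycles ∷ [])
          (# 0 ⊕ (# 3 ⊕ # 2 ⊕ # 1) ⊕ # 4) (# 1 ⊕ # 2 ⊕ # 0 ⊕ # 3 ⊕ # 4) refl)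
        (↭-trans (prep _ (prep _ vs))
          (rearrange ((h t 3 ∷ []) ∷ (l t 3 ∷ []) ∷ map hi (downFrom (3 + (t + δ))) ∷ map lo (downFrom (3 + t)) ∷ [])
            (# 0 ⊕ # 1 ⊕ # 2 ⊕ # 3) ((# 0 ⊕ # 2) ⊕ # 1 ⊕ # 3) refl))))
    (extend (d (h t 0) (l t 3) ∷ d (l t 3) (h t 3) ∷ []) (wt t 3 ∷ wt t 6 ∷ [])
      (↭-trans (↭-reflexive (cong (λ xs → steps d path ++ xs ++ allsteps d cycles) (steps-▸ d frag (l t 3 ∷ [ h t 3 ]))))
        (rearrange (steps d path ∷ (d (h t 0) (l t 3) ∷ []) ∷ (d (l t 3) (h t 3) ∷ []) ∷ steps d frag ∷ allsteps d cycles ∷ [])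
          (# 0 ⊕ (# 3 ⊕ # 1 ⊕ # 2) ⊕ # 4) ((# 1 ⊕ # 2) ⊕ # 0 ⊕ # 3 ⊕ # 4) refl))
      (cong₂ _∷_ (hl t 0 3) (cong₂ _∷_ (lh t 3 3) refl)) es
      (rearrange ((wt t 3 ∷ []) ∷ (wt t 6 ∷ []) ∷ (wt t 4 ∷ []) ∷ climb (double t) ∷ [])
        (# 0 ⊕ # 1 ⊕ # 2 ⊕ # 3) (# 1 ⊕ # 2 ⊕ # 0 ⊕ # 3) refl))

  private
    boxThree : ∀ t → h t 5 ∷ h t 4 ∷ h t 3 ∷ l t 5 ∷ l t 4 ∷ l t 3 ∷ box (3 + (t + δ)) (3 + t) ↭ box (6 + (t + δ)) (6 + t)
    boxThree t = rearrange ((h t 5 ∷ h t 4 ∷ h t 3 ∷ []) ∷ (l t 5 ∷ l t 4 ∷ l t 3 ∷ []) ∷ map hi (downFrom (3 + (t + δ))) ∷ map lo (downFrom (3 + t)) ∷ [])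
      (# 0 ⊕ # 1 ⊕ # 2 ⊕ # 3) ((# 0 ⊕ # 2) ⊕ # 1 ⊕ # 3) refl

  -- Each of three new low vertices has one task: `l t 4` closes the fragment with weights 5 and 6,
  -- `l t 3` prolongs the path with 3 and 7, `l t 5` begins a new fragment with 8 and 10. As 4 was
  -- in use, only 9 is left out, which is the gap required three levels higher.
  closeLeft : ∀ {t φ ls} → State t left φ ls → State (3 + t) middle 3 (suc φ ∷ ls)
  closeLeft {t} (state path frag cycles φ-size sizes vs es) = state
    (h t 4 ∷ l t 3 ∷ path) (h t 3 ∷ l t 5 ∷ [ h t 5 ]) ((⟲ (l t 4 ∷ frag)) ∷ cycles) refl
    (cong₂ _∷_ (cong suc φ-size) sizes)
    (↭-trans
      (rearrange ((h t 3 ∷ []) ∷ (h t 4 ∷ []) ∷ (h t 5 ∷ []) ∷ (l t 3 ∷ []) ∷ (l t 4 ∷ []) ∷ (l t 5 ∷ []) ∷ verts path ∷ verts frag ∷ allverts cycles ∷ [])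
        ((# 1 ⊕ # 3 ⊕ # 6) ⊕ (# 0 ⊕ # 5 ⊕ # 2) ⊕ (# 4 ⊕ # 7) ⊕ # 8) ((# 2 ⊕ # 1 ⊕ # 0 ⊕ # 5 ⊕ # 4 ⊕ # 3) ⊕ # 6 ⊕ # 7 ⊕ # 8) refl)
      (↭-trans (++⁺ˡ (_ ∷ _ ∷ _ ∷ _ ∷ _ ∷ _ ∷ []) vs) (boxThree t)))
    (extend (d (h t 4) (l t 3) ∷ d (l t 3) (h t 0) ∷ d (h t 3) (l t 5) ∷ d (l t 5) (h t 5) ∷ d (h t 1) (l t 4) ∷ d (l t 4) (h t 2) ∷ [])
      (wt t 7 ∷ wt t 3 ∷ wt t 8 ∷ wt t 10 ∷ wt t 5 ∷ wt t 6 ∷ [])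
      (rearrange (steps d path ∷ steps d frag ∷ allsteps d cycles ∷ (d (h t 4) (l t 3) ∷ d (l t 3) (h t 0) ∷ []) ∷ (d (h t 3) (l t 5) ∷ d (l t 5) (h t 5) ∷ []) ∷ (d (h t 1) (l t 4) ∷ d (l t 4) (h t 2) ∷ []) ∷ [])
        ((# 3 ⊕ # 0) ⊕ # 4 ⊕ (# 5 ⊕ # 1) ⊕ # 2) ((# 3 ⊕ # 4 ⊕ # 5) ⊕ # 0 ⊕ # 1 ⊕ # 2) refl)
      (cong₂ _∷_ (hl t 4 3) (cong₂ _∷_ (lh t 3 0) (cong₂ _∷_ (hl t 3 5) (cong₂ _∷_ (lh t 5 5) (cong₂ _∷_ (hl t 1 4) (cong₂ _∷_ (lh t 4 2) refl))))))
      es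
      (rearrange ((wt t 3 ∷ []) ∷ (wt t 4 ∷ []) ∷ (wt t 5 ∷ []) ∷ (wt t 6 ∷ []) ∷ (wt t 7 ∷ []) ∷ (wt t 8 ∷ []) ∷ (wt t 10 ∷ []) ∷ climb (double t) ∷ [])
        ((# 4 ⊕ # 0 ⊕ # 5 ⊕ # 6 ⊕ # 2 ⊕ # 3) ⊕ # 1 ⊕ # 7) (# 6 ⊕ # 5 ⊕ # 4 ⊕ # 3 ⊕ # 2 ⊕ # 1 ⊕ # 0 ⊕ # 7) refl))

  closeMiddle : ∀ {t φ ls} → State t middle φ ls → State (3 + t) right 3 (suc φ ∷ ls)
  closeMiddle {t} (state path frag cycles φ-size sizes vs es) = state
    (h t 5 ∷ l t 5 ∷ path) (h t 4 ∷ l t 4 ∷ [ h t 3 ]) ((⟲ (l t 3 ∷ frag)) ∷ cycles) refl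
    (cong₂ _∷_ (cong suc φ-size) sizes)
    (↭-trans
      (rearrange ((h t 3 ∷ []) ∷ (h t 4 ∷ []) ∷ (h t 5 ∷ []) ∷ (l t 3 ∷ []) ∷ (l t 4 ∷ []) ∷ (l t 5 ∷ []) ∷ verts path ∷ verts frag ∷ allverts cycles ∷ [])
        ((# 2 ⊕ # 5 ⊕ # 6) ⊕ (# 1 ⊕ # 4 ⊕ # 0) ⊕ (# 3 ⊕ # 7) ⊕ # 8) ((# 2 ⊕ # 1 ⊕ # 0 ⊕ # 5 ⊕ # 4 ⊕ # 3) ⊕ # 6 ⊕ # 7 ⊕ # 8) refl)
      (↭-trans (++⁺ˡ (_ ∷ _ ∷ _ ∷ _ ∷ _ ∷ _ ∷ []) vs) (boxThree t)))
    (extend (d (h t 5) (l t 5) ∷ d (l t 5) (h t 1) ∷ d (h t 4) (l t 4) ∷ d (l t 4) (h t 3) ∷ d (h t 2) (l t 3) ∷ d (l t 3) (h t 0) ∷ [])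
      (wt t 10 ∷ wt t 6 ∷ wt t 8 ∷ wt t 7 ∷ wt t 5 ∷ wt t 3 ∷ [])
      (rearrange (steps d path ∷ steps d frag ∷ allsteps d cycles ∷ (d (h t 5) (l t 5) ∷ d (l t 5) (h t 1) ∷ []) ∷ (d (h t 4) (l t 4) ∷ d (l t 4) (h t 3) ∷ []) ∷ (d (h t 2) (l t 3) ∷ d (l t 3) (h t 0) ∷ []) ∷ [])
        ((# 3 ⊕ # 0) ⊕ # 4 ⊕ (# 5 ⊕ # 1) ⊕ # 2) ((# 3 ⊕ # 4 ⊕ # 5) ⊕ # 0 ⊕ # 1 ⊕ # 2) refl)
      (cong₂ _∷_ (hl t 5 5) (cong₂ _∷_ (lh t 5 1) (cong₂ _∷_ (hl t 4 4) (cong₂ _∷_ (lh t 4 3) (cong₂ _∷_ (hl t 2 3) (cong₂ _∷_ (lh t 3 0) refl))))))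
      es
      (rearrange ((wt t 3 ∷ []) ∷ (wt t 4 ∷ []) ∷ (wt t 5 ∷ []) ∷ (wt t 6 ∷ []) ∷ (wt t 7 ∷ []) ∷ (wt t 8 ∷ []) ∷ (wt t 10 ∷ []) ∷ climb (double t) ∷ [])
        ((# 6 ⊕ # 3 ⊕ # 5 ⊕ # 4 ⊕ # 2 ⊕ # 0) ⊕ # 1 ⊕ # 7) (# 6 ⊕ # 5 ⊕ # 4 ⊕ # 3 ⊕ # 2 ⊕ # 1 ⊕ # 0 ⊕ # 7) refl))

  -- `closeMiddle` ends in position `right`. Letting the path swallow the fragment leads back to
  -- `middle` without producing a further cycle.
  absorbRight : ∀ {t φ ls} → State t right φ ls → State (3 + t) middle 3 ls
  absorbRight {t} (state path frag cycles φ-size sizes vs es) = state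
    (h t 4 ∷ l t 3 ∷ (rev frag ▸ (l t 4 ∷ path))) (h t 3 ∷ l t 5 ∷ [ h t 5 ]) cycles refl sizes
    (↭-trans
      (++⁺ʳ _ (prep _ (prep _ (↭-trans (↭-reflexive (verts-▸ (rev frag) (l t 4 ∷ path))) (++⁺ʳ _ (verts-rev frag))))))
      (↭-trans
        (rearrange ((h t 3 ∷ []) ∷ (h t 4 ∷ []) ∷ (h t 5 ∷ []) ∷ (l t 3 ∷ []) ∷ (l t 4 ∷ []) ∷ (l t 5 ∷ []) ∷ verts path ∷ verts frag ∷ allverts cycles ∷ [])
          ((# 1 ⊕ # 3 ⊕ # 7 ⊕ # 4 ⊕ # 6) ⊕ (# 0 ⊕ # 5 ⊕ # 2) ⊕ # 8) ((# 2 ⊕ # 1 ⊕ # 0 ⊕ # 5 ⊕ # 4 ⊕ # 3) ⊕ # 6 ⊕ # 7 ⊕ # 8) refl)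
        (↭-trans (++⁺ˡ (_ ∷ _ ∷ _ ∷ _ ∷ _ ∷ _ ∷ []) vs) (boxThree t))))
    (extend (d (h t 4) (l t 3) ∷ d (l t 3) (h t 0) ∷ d (h t 1) (l t 4) ∷ d (l t 4) (h t 2) ∷ d (h t 3) (l t 5) ∷ d (l t 5) (h t 5) ∷ [])
      (wt t 7 ∷ wt t 3 ∷ wt t 5 ∷ wt t 6 ∷ wt t 8 ∷ wt t 10 ∷ [])
      (↭-trans
        (++⁺ʳ _ (prep _ (prep _ (↭-trans (↭-reflexive (steps-▸ d (rev frag) (l t 4 ∷ path))) (++⁺ʳ _ (steps-rev d d-sym frag))))))
        (rearrange (steps d path ∷ steps d frag ∷ allsteps d cycles ∷ (d (h t 4) (l t 3) ∷ d (l t 3) (h t 0) ∷ []) ∷ (d (h t 1) (l t 4) ∷ d (l t 4) (h t 2) ∷ []) ∷ (d (h t 3) (l t 5) ∷ d (l t 5) (h t 5) ∷ []) ∷ [])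
          ((# 3 ⊕ # 1 ⊕ # 4 ⊕ # 0) ⊕ # 5 ⊕ # 2) ((# 3 ⊕ # 4 ⊕ # 5) ⊕ # 0 ⊕ # 1 ⊕ # 2) refl))
      (cong₂ _∷_ (hl t 4 3) (cong₂ _∷_ (lh t 3 0) (cong₂ _∷_ (hl t 1 4) (cong₂ _∷_ (lh t 4 2) (cong₂ _∷_ (hl t 3 5) (cong₂ _∷_ (lh t 5 5) refl))))))
      es
      (rearrange ((wt t 3 ∷ []) ∷ (wt t 4 ∷ []) ∷ (wt t 5 ∷ []) ∷ (wt t 6 ∷ []) ∷ (wt t 7 ∷ []) ∷ (wt t 8 ∷ []) ∷ (wt t 10 ∷ []) ∷ climb (double t) ∷ [])
        ((# 4 ⊕ # 0 ⊕ # 2 ⊕ # 3 ⊕ # 5 ⊕ # 6) ⊕ # 1 ⊕ # 7) (# 6 ⊕ # 5 ⊕ # 4 ⊕ # 3 ⊕ # 2 ⊕ # 1 ⊕ # 0 ⊕ # 7) refl))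

  -- Every strand climbs once, so the fragment grows by two vertices at each of its ends.
  advanceThree : ∀ {t φ ls} → State t middle φ ls → State (3 + t) middle (4 + φ) ls
  advanceThree {t} {φ} {ls} S = subst (λ φ → State (3 + t) middle φ ls) (cong (2 +_) (+-comm φ 2))
    (advanceRight (advanceLeft (advanceMiddle S)))

  advances : ∀ n {t φ ls} → State t middle φ ls → State (n * 3 + t) middle (n * 4 + φ) ls
  advances zero    S = S
  advances (suc n) S = advanceThree (advances n S)

  private
    boxOdd : ∀ t → h t 4 ∷ h t 3 ∷ l t 5 ∷ l t 4 ∷ l t 3 ∷ box (3 + (t + δ)) (3 + t) ↭ box (5 + (t + δ)) (6 + t)
    boxOdd t = rearrange ((h t 4 ∷ h t 3 ∷ []) ∷ (l t 5 ∷ l t 4 ∷ l t 3 ∷ []) ∷ map hi (downFrom (3 + (t + δ))) ∷ map lo (downFrom (3 + t)) ∷ [])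
      (# 0 ⊕ # 1 ⊕ # 2 ⊕ # 3) ((# 0 ⊕ # 2) ⊕ # 1 ⊕ # 3) refl

    boxEven : ∀ t → h t 3 ∷ l t 5 ∷ l t 4 ∷ l t 3 ∷ box (3 + (t + δ)) (3 + t) ↭ box (4 + (t + δ)) (6 + t)
    boxEven t = rearrange ((h t 3 ∷ []) ∷ (l t 5 ∷ l t 4 ∷ l t 3 ∷ []) ∷ map hi (downFrom (3 + (t + δ))) ∷ map lo (downFrom (3 + t)) ∷ [])
      (# 0 ⊕ # 1 ⊕ # 2 ⊕ # 3) ((# 0 ⊕ # 2) ⊕ # 1 ⊕ # 3) refl

    boxLong : ∀ t → h t 6 ∷ h t 5 ∷ h t 4 ∷ h t 3 ∷ l t 8 ∷ l t 7 ∷ l t 6 ∷ l t 5 ∷ l t 4 ∷ l t 3 ∷ box (3 + (t + δ)) (3 + t) ↭ box (7 + (t + δ)) (9 + t)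
    boxLong t = rearrange ((h t 6 ∷ h t 5 ∷ h t 4 ∷ h t 3 ∷ []) ∷ (l t 8 ∷ l t 7 ∷ l t 6 ∷ l t 5 ∷ l t 4 ∷ l t 3 ∷ []) ∷ map hi (downFrom (3 + (t + δ))) ∷ map lo (downFrom (3 + t)) ∷ [])
      (# 0 ⊕ # 1 ⊕ # 2 ⊕ # 3) ((# 0 ⊕ # 2) ⊕ # 1 ⊕ # 3) refl

    oddWeights : ∀ t → List (List B)
    oddWeights t = (wt t 3 ∷ []) ∷ (wt t 4 ∷ []) ∷ (wt t 5 ∷ []) ∷ (wt t 6 ∷ []) ∷ (wt t 7 ∷ []) ∷ (wt t 8 ∷ []) ∷ (wt t 9 ∷ []) ∷ climb (double t) ∷ []

    insertFrag : ∀ {x y z u} {vs₁ vs₂ vs₃ : List V} (f : Walk x y) (q : Walk z u) →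
      verts f ↭ vs₁ → vs₂ ++ verts (f ▸ q) ++ vs₃ ↭ vs₂ ++ (vs₁ ++ verts q) ++ vs₃
    insertFrag {vs₂ = vs₂} f q p = ++⁺ˡ vs₂ (++⁺ʳ _ (↭-trans (↭-reflexive (verts-▸ f q)) (++⁺ʳ _ p)))

    insertSteps : ∀ {x y z u} {ws₁ ws₂ ws₃ : List B} (f : Walk x y) (q : Walk z u) →
      steps d f ↭ ws₁ → ws₂ ++ steps d (f ▸ q) ++ ws₃ ↭ ws₂ ++ (ws₁ ++ d y z ∷ steps d q) ++ ws₃
    insertSteps {ws₂ = ws₂} f q p = ++⁺ˡ ws₂ (++⁺ʳ _ (↭-trans (↭-reflexive (steps-▸ d f q)) (++⁺ʳ _ p)))

  -- When the path is on an outer strand, the low vertex l t 3 joins it to the fragment.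
  finishOuterOdd : ∀ {t y ls} (path : Walk y s) {x} (frag : Walk (end t 1) x) (cycles : List (Cycle V)) →
    map size cycles ≡ ls →
    verts path ++ verts frag ++ allverts cycles ↭ box (3 + (t + δ)) (3 + t) →
    steps d path ++ steps d frag ++ allsteps d cycles ↭ c (4 + (double t + δ)) ∷ climb (double t) →
    d x (lo (3 + t)) ∷ d (lo (3 + t)) y ∷ [] ↭ c (3 + (double t + δ)) ∷ c (5 + (double t + δ)) ∷ [] →
    Finished (5 + (t + δ)) (6 + t) (hi (3 + (t + δ))) (7 + double t) ls
  finishOuterOdd {t} {y} path {x} frag cycles sizes vs es joint = finished
    (h t 3 ∷ l t 4 ∷ h t 4 ∷ l t 5 ∷ (frag ▸ (l t 3 ∷ path))) cycles sizes
    (↭-trans (insertFrag {vs₂ = h t 3 ∷ l t 4 ∷ h t 4 ∷ l t 5 ∷ []} frag (l t 3 ∷ path) ↭-refl)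
      (↭-trans
        (rearrange ((h t 3 ∷ []) ∷ (h t 4 ∷ []) ∷ (l t 3 ∷ []) ∷ (l t 4 ∷ []) ∷ (l t 5 ∷ []) ∷ verts path ∷ verts frag ∷ allverts cycles ∷ [])
          (# 0 ⊕ # 3 ⊕ # 1 ⊕ # 4 ⊕ (# 6 ⊕ # 2 ⊕ # 5) ⊕ # 7) ((# 1 ⊕ # 0 ⊕ # 4 ⊕ # 3 ⊕ # 2) ⊕ # 5 ⊕ # 6 ⊕ # 7) refl)
        (↭-trans (++⁺ˡ (_ ∷ _ ∷ _ ∷ _ ∷ _ ∷ []) vs) (boxOdd t))))
    (extend (d (h t 3) (l t 4) ∷ d (l t 4) (h t 4) ∷ d (h t 4) (l t 5) ∷ d (l t 5) (h t 1) ∷ [])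
      (wt t 7 ∷ wt t 8 ∷ wt t 9 ∷ wt t 6 ∷ [])
      (insertSteps {ws₂ = d (h t 3) (l t 4) ∷ d (l t 4) (h t 4) ∷ d (h t 4) (l t 5) ∷ d (l t 5) (h t 1) ∷ []} frag (l t 3 ∷ path) ↭-refl)
      (cong₂ _∷_ (hl t 3 4) (cong₂ _∷_ (lh t 4 4) (cong₂ _∷_ (hl t 4 5) (cong₂ _∷_ (lh t 5 1) refl))))
      (↭-trans
        (rearrange (steps d path ∷ steps d frag ∷ allsteps d cycles ∷ (d x (l t 3) ∷ d (l t 3) y ∷ []) ∷ [])
          ((# 1 ⊕ # 3 ⊕ # 0) ⊕ # 2) (# 3 ⊕ # 0 ⊕ # 1 ⊕ # 2) refl)
        (++⁺ joint es))
      (rearrange (oddWeights t)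
        (# 4 ⊕ # 5 ⊕ # 6 ⊕ # 3 ⊕ # 0 ⊕ # 2 ⊕ # 1 ⊕ # 7) (# 6 ⊕ # 5 ⊕ # 4 ⊕ # 3 ⊕ # 2 ⊕ # 1 ⊕ # 0 ⊕ # 7) refl))

  finishOuterEven : ∀ {t y ls} (path : Walk y s) {x} (frag : Walk (end t 1) x) (cycles : List (Cycle V)) →
    map size cycles ≡ ls →
    verts path ++ verts frag ++ allverts cycles ↭ box (3 + (t + δ)) (3 + t) →
    steps d path ++ steps d frag ++ allsteps d cycles ↭ c (4 + (double t + δ)) ∷ climb (double t) →
    d x (lo (3 + t)) ∷ d (lo (3 + t)) y ∷ [] ↭ c (3 + (double t + δ)) ∷ c (5 + (double t + δ)) ∷ [] →
    Finished (4 + (t + δ)) (6 + t) (lo (4 + t)) (6 + double t) ls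
  finishOuterEven {t} {y} path {x} frag cycles sizes vs es joint = finished
    (l t 4 ∷ h t 3 ∷ l t 5 ∷ (frag ▸ (l t 3 ∷ path))) cycles sizes
    (↭-trans (insertFrag {vs₂ = l t 4 ∷ h t 3 ∷ l t 5 ∷ []} frag (l t 3 ∷ path) ↭-refl)
      (↭-trans
        (rearrange ((h t 3 ∷ []) ∷ (l t 3 ∷ []) ∷ (l t 4 ∷ []) ∷ (l t 5 ∷ []) ∷ verts path ∷ verts frag ∷ allverts cycles ∷ [])
          (# 2 ⊕ # 0 ⊕ # 3 ⊕ (# 5 ⊕ # 1 ⊕ # 4) ⊕ # 6) ((# 0 ⊕ # 3 ⊕ # 2 ⊕ # 1) ⊕ # 4 ⊕ # 5 ⊕ # 6) refl)
        (↭-trans (++⁺ˡ (_ ∷ _ ∷ _ ∷ _ ∷ []) vs) (boxEven t))))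
    (extend (d (l t 4) (h t 3) ∷ d (h t 3) (l t 5) ∷ d (l t 5) (h t 1) ∷ [])
      (wt t 7 ∷ wt t 8 ∷ wt t 6 ∷ [])
      (insertSteps {ws₂ = d (l t 4) (h t 3) ∷ d (h t 3) (l t 5) ∷ d (l t 5) (h t 1) ∷ []} frag (l t 3 ∷ path) ↭-refl)
      (cong₂ _∷_ (lh t 4 3) (cong₂ _∷_ (hl t 3 5) (cong₂ _∷_ (lh t 5 1) refl)))
      (↭-trans
        (rearrange (steps d path ∷ steps d frag ∷ allsteps d cycles ∷ (d x (l t 3) ∷ d (l t 3) y ∷ []) ∷ [])
          ((# 1 ⊕ # 3 ⊕ # 0) ⊕ # 2) (# 3 ⊕ # 0 ⊕ # 1 ⊕ # 2) refl)
        (++⁺ joint es))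
      (rearrange (oddWeights t)
        (# 4 ⊕ # 5 ⊕ # 3 ⊕ # 0 ⊕ # 2 ⊕ # 1 ⊕ # 7) (# 5 ⊕ # 4 ⊕ # 3 ⊕ # 2 ⊕ # 1 ⊕ # 0 ⊕ # 7) refl))

  private
    jointRight : ∀ t → d (end t 0) (lo (3 + t)) ∷ d (lo (3 + t)) (end t 2) ∷ [] ↭ c (3 + (double t + δ)) ∷ c (5 + (double t + δ)) ∷ []
    jointRight t = ↭-reflexive (cong₂ _∷_ (hl t 0 3) (cong₂ _∷_ (lh t 3 2) refl))

    jointLeft : ∀ t → d (end t 2) (lo (3 + t)) ∷ d (lo (3 + t)) (end t 0) ∷ [] ↭ c (3 + (double t + δ)) ∷ c (5 + (double t + δ)) ∷ []
    jointLeft t = ↭-trans (↭-reflexive (cong₂ _∷_ (hl t 2 3) (cong₂ _∷_ (lh t 3 0) refl))) (swap _ _ ↭-refl)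

    reversed : ∀ {t φ ls} → (S : State t left φ ls) → let open State S in
      (verts path ++ verts (rev frag) ++ allverts cycles ↭ box (3 + (t + δ)) (3 + t)) ×
      (steps d path ++ steps d (rev frag) ++ allsteps d cycles ↭ c (4 + (double t + δ)) ∷ climb (double t))
    reversed S = ↭-trans (++⁺ˡ (verts path) (++⁺ʳ (allverts cycles) (verts-rev frag))) vs
      , ↭-trans (++⁺ˡ (steps d path) (++⁺ʳ (allsteps d cycles) (steps-rev d d-sym frag))) es
      where open State S

  finishLeftOdd : ∀ {t φ ls} → State t left φ ls → Finished (5 + (t + δ)) (6 + t) (hi (3 + (t + δ))) (7 + double t) ls
  finishLeftOdd {t} S = finishOuterOdd path (rev frag) cycles sizes (proj₁ (reversed S)) (proj₂ (reversed S)) (jointLeft t)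
    where open State S

  finishRightOdd : ∀ {t φ ls} → State t right φ ls → Finished (5 + (t + δ)) (6 + t) (hi (3 + (t + δ))) (7 + double t) ls
  finishRightOdd {t} S = finishOuterOdd path frag cycles sizes vs es (jointRight t)
    where open State S

  finishLeftEven : ∀ {t φ ls} → State t left φ ls → Finished (4 + (t + δ)) (6 + t) (lo (4 + t)) (6 + double t) ls
  finishLeftEven {t} S = finishOuterEven path (rev frag) cycles sizes (proj₁ (reversed S)) (proj₂ (reversed S)) (jointLeft t)
    where open State S

  finishRightEven : ∀ {t φ ls} → State t right φ ls → Finished (4 + (t + δ)) (6 + t) (lo (4 + t)) (6 + double t) ls
  finishRightEven {t} S = finishOuterEven path frag cycles sizes vs es (jointRight t)
    where open State S

  finishMiddleOdd : ∀ {t φ ls} → State t middle φ ls → Finished (5 + (t + δ)) (6 + t) (hi (3 + (t + δ))) (7 + double t) ls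
  finishMiddleOdd {t} (state path frag cycles φ-size sizes vs es) = finished
    (h t 3 ∷ l t 3 ∷ (frag ▸ (l t 5 ∷ h t 4 ∷ l t 4 ∷ path))) cycles sizes
    (↭-trans (insertFrag {vs₂ = h t 3 ∷ l t 3 ∷ []} frag (l t 5 ∷ h t 4 ∷ l t 4 ∷ path) ↭-refl)
      (↭-trans
        (rearrange ((h t 3 ∷ []) ∷ (h t 4 ∷ []) ∷ (l t 3 ∷ []) ∷ (l t 4 ∷ []) ∷ (l t 5 ∷ []) ∷ verts path ∷ verts frag ∷ allverts cycles ∷ [])
          (# 0 ⊕ # 2 ⊕ (# 6 ⊕ # 4 ⊕ # 1 ⊕ # 3 ⊕ # 5) ⊕ # 7) ((# 1 ⊕ # 0 ⊕ # 4 ⊕ # 3 ⊕ # 2) ⊕ # 5 ⊕ # 6 ⊕ # 7) refl)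
        (↭-trans (++⁺ˡ (_ ∷ _ ∷ _ ∷ _ ∷ _ ∷ []) vs) (boxOdd t))))
    (extend (d (h t 3) (l t 3) ∷ d (l t 3) (h t 0) ∷ d (h t 2) (l t 5) ∷ d (l t 5) (h t 4) ∷ d (h t 4) (l t 4) ∷ d (l t 4) (h t 1) ∷ [])
      (wt t 6 ∷ wt t 3 ∷ wt t 7 ∷ wt t 9 ∷ wt t 8 ∷ wt t 5 ∷ [])
      (↭-trans
        (insertSteps {ws₂ = d (h t 3) (l t 3) ∷ d (l t 3) (h t 0) ∷ []} frag (l t 5 ∷ h t 4 ∷ l t 4 ∷ path) ↭-refl)
        (rearrange (steps d path ∷ steps d frag ∷ allsteps d cycles ∷ (d (h t 3) (l t 3) ∷ d (l t 3) (h t 0) ∷ []) ∷ (d (h t 2) (l t 5) ∷ d (l t 5) (h t 4) ∷ d (h t 4) (l t 4) ∷ d (l t 4) (h t 1) ∷ []) ∷ [])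
          (# 3 ⊕ (# 1 ⊕ # 4 ⊕ # 0) ⊕ # 2) ((# 3 ⊕ # 4) ⊕ # 0 ⊕ # 1 ⊕ # 2) refl))
      (cong₂ _∷_ (hl t 3 3) (cong₂ _∷_ (lh t 3 0) (cong₂ _∷_ (hl t 2 5) (cong₂ _∷_ (lh t 5 4) (cong₂ _∷_ (hl t 4 4) (cong₂ _∷_ (lh t 4 1) refl))))))
      es
      (rearrange (oddWeights t)
        ((# 3 ⊕ # 0 ⊕ # 4 ⊕ # 6 ⊕ # 5 ⊕ # 2) ⊕ # 1 ⊕ # 7) (# 6 ⊕ # 5 ⊕ # 4 ⊕ # 3 ⊕ # 2 ⊕ # 1 ⊕ # 0 ⊕ # 7) refl))

  -- A special ending on ten new vertices. Counted from 2t + δ, its eleven weights are 3 and 5 to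
  -- 14, since 4 is already in use.
  finishMiddleEven : ∀ {t φ ls} → State t middle φ ls → Finished (7 + (t + δ)) (9 + t) (lo (7 + t)) (12 + double t) ls
  finishMiddleEven {t} (state path frag cycles φ-size sizes vs es) = finished
    (l t 7 ∷ h t 6 ∷ l t 8 ∷ h t 4 ∷ l t 5 ∷ h t 5 ∷ l t 6 ∷ (rev frag ▸ (l t 3 ∷ h t 3 ∷ l t 4 ∷ path))) cycles sizes
    (↭-trans (insertFrag {vs₂ = l t 7 ∷ h t 6 ∷ l t 8 ∷ h t 4 ∷ l t 5 ∷ h t 5 ∷ l t 6 ∷ []} (rev frag) (l t 3 ∷ h t 3 ∷ l t 4 ∷ path) (verts-rev frag))
      (↭-trans
        (rearrange ((h t 3 ∷ []) ∷ (h t 4 ∷ []) ∷ (h t 5 ∷ []) ∷ (h t 6 ∷ []) ∷ (l t 3 ∷ []) ∷ (l t 4 ∷ []) ∷ (l t 5 ∷ []) ∷ (l t 6 ∷ []) ∷ (l t 7 ∷ []) ∷ (l t 8 ∷ []) ∷ verts path ∷ verts frag ∷ allverts cycles ∷ [])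
          ((# 8 ⊕ # 3 ⊕ # 9 ⊕ # 1 ⊕ # 6 ⊕ # 2 ⊕ # 7) ⊕ (# 11 ⊕ # 4 ⊕ # 0 ⊕ # 5 ⊕ # 10) ⊕ # 12)
          ((# 3 ⊕ # 2 ⊕ # 1 ⊕ # 0 ⊕ # 9 ⊕ # 8 ⊕ # 7 ⊕ # 6 ⊕ # 5 ⊕ # 4) ⊕ # 10 ⊕ # 11 ⊕ # 12) refl)
        (↭-trans (++⁺ˡ (_ ∷ _ ∷ _ ∷ _ ∷ _ ∷ _ ∷ _ ∷ _ ∷ _ ∷ _ ∷ []) vs) (boxLong t))))
    (extend (d (l t 7) (h t 6) ∷ d (h t 6) (l t 8) ∷ d (l t 8) (h t 4) ∷ d (h t 4) (l t 5) ∷ d (l t 5) (h t 5) ∷ d (h t 5) (l t 6) ∷ d (l t 6) (h t 2)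
        ∷ d (h t 0) (l t 3) ∷ d (l t 3) (h t 3) ∷ d (h t 3) (l t 4) ∷ d (l t 4) (h t 1) ∷ [])
      (wt t 13 ∷ wt t 14 ∷ wt t 12 ∷ wt t 9 ∷ wt t 10 ∷ wt t 11 ∷ wt t 8 ∷ wt t 3 ∷ wt t 6 ∷ wt t 7 ∷ wt t 5 ∷ [])
      (↭-trans
        (insertSteps {ws₂ = d (l t 7) (h t 6) ∷ d (h t 6) (l t 8) ∷ d (l t 8) (h t 4) ∷ d (h t 4) (l t 5) ∷ d (l t 5) (h t 5) ∷ d (h t 5) (l t 6) ∷ d (l t 6) (h t 2) ∷ []}
          (rev frag) (l t 3 ∷ h t 3 ∷ l t 4 ∷ path) (steps-rev d d-sym frag))
        (rearrange (steps d path ∷ steps d frag ∷ allsteps d cycles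
            ∷ (d (l t 7) (h t 6) ∷ d (h t 6) (l t 8) ∷ d (l t 8) (h t 4) ∷ d (h t 4) (l t 5) ∷ d (l t 5) (h t 5) ∷ d (h t 5) (l t 6) ∷ d (l t 6) (h t 2) ∷ [])
            ∷ (d (h t 0) (l t 3) ∷ d (l t 3) (h t 3) ∷ d (h t 3) (l t 4) ∷ d (l t 4) (h t 1) ∷ []) ∷ [])
          (# 3 ⊕ (# 1 ⊕ # 4 ⊕ # 0) ⊕ # 2) ((# 3 ⊕ # 4) ⊕ # 0 ⊕ # 1 ⊕ # 2) refl))
      (cong₂ _∷_ (lh t 7 6) (cong₂ _∷_ (hl t 6 8) (cong₂ _∷_ (lh t 8 4) (cong₂ _∷_ (hl t 4 5) (cong₂ _∷_ (lh t 5 5) (cong₂ _∷_ (hl t 5 6)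
        (cong₂ _∷_ (lh t 6 2) (cong₂ _∷_ (hl t 0 3) (cong₂ _∷_ (lh t 3 3) (cong₂ _∷_ (hl t 3 4) (cong₂ _∷_ (lh t 4 1) refl)))))))))))
      es
      (rearrange ((wt t 3 ∷ []) ∷ (wt t 4 ∷ []) ∷ (wt t 5 ∷ []) ∷ (wt t 6 ∷ []) ∷ (wt t 7 ∷ []) ∷ (wt t 8 ∷ []) ∷ (wt t 9 ∷ [])
          ∷ (wt t 10 ∷ []) ∷ (wt t 11 ∷ []) ∷ (wt t 12 ∷ []) ∷ (wt t 13 ∷ []) ∷ (wt t 14 ∷ []) ∷ climb (double t) ∷ [])
        ((# 10 ⊕ # 11 ⊕ # 9 ⊕ # 6 ⊕ # 7 ⊕ # 8 ⊕ # 5 ⊕ # 0 ⊕ # 3 ⊕ # 4 ⊕ # 2) ⊕ # 1 ⊕ # 12)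
        (# 11 ⊕ # 10 ⊕ # 9 ⊕ # 8 ⊕ # 7 ⊕ # 6 ⊕ # 5 ⊕ # 4 ⊕ # 3 ⊕ # 2 ⊕ # 1 ⊕ # 0 ⊕ # 12) refl))

-- Even cycles

-- Here u is the number of full rounds of the strands: the fragment then has 4u + 3 vertices, or two
-- more after one further advance, and the closing vertex makes the cycle.
data EvenLength : ℕ → Set where
  0-mod-4 : ∀ u → EvenLength (suc (u * 4 + 3))
  2-mod-4 : ∀ u → EvenLength (suc (2 + (u * 4 + 3)))

module EvenCycles where
  -- The offset 2 makes the finished boxes square, or with a single additional high vertex. The
  -- fixed end `hi 1` becomes `hi E` when a box with E + 2 high vertices is mirrored.
  open Strands (Maybe ℕ) weight just weight-sym (λ _ _ → refl) 2 (weights 5) (hi 1)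

  start : State 0 middle 3 []
  start = state (hi 3 ∷ lo 0 ∷ hi 0 ∷ lo 1 ∷ [ hi 1 ]) (hi 2 ∷ lo 2 ∷ [ hi 4 ]) [] refl refl
    (rearrange ((hi 0 ∷ []) ∷ (hi 1 ∷ []) ∷ (hi 2 ∷ []) ∷ (hi 3 ∷ []) ∷ (hi 4 ∷ []) ∷ (lo 0 ∷ []) ∷ (lo 1 ∷ []) ∷ (lo 2 ∷ []) ∷ [] ∷ [])
      ((# 3 ⊕ # 5 ⊕ # 0 ⊕ # 6 ⊕ # 1) ⊕ (# 2 ⊕ # 7 ⊕ # 4) ⊕ # 8) ((# 4 ⊕ # 3 ⊕ # 2 ⊕ # 1 ⊕ # 0 ⊕ # 8) ⊕ (# 7 ⊕ # 6 ⊕ # 5)) refl)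
    (rearrange ((just 0 ∷ []) ∷ (just 1 ∷ []) ∷ (just 2 ∷ []) ∷ (just 3 ∷ []) ∷ (just 4 ∷ []) ∷ (just 6 ∷ []) ∷ [])
      ((# 3 ⊕ # 0 ⊕ # 1 ⊕ # 2) ⊕ (# 4 ⊕ # 5)) (# 5 ⊕ # 4 ⊕ # 3 ⊕ # 2 ⊕ # 1 ⊕ # 0) refl)

  -- κ counts the levels climbed. Of its two estimates, the one with factor 3/2 serves when there
  -- are no odd cycles, the one with summand 2 serves in the mixed case.
  addCycle : ∀ {ℓ t ls} → EvenLength ℓ → State t middle 3 ls →
    ∃ λ κ → State (κ + t) middle 3 (ℓ ∷ ls) × 2 * κ ≤ 3 * ℓ × κ ≤ ℓ + 2
  addCycle {t = t} {ls} (0-mod-4 u) S = 6 + u * 3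
    , absorbRight (closeMiddle (advances u S))
    , ≤-trans (m≤m+n _ (u * 6)) (≤-reflexive (eq₁ u)) , ≤-trans (m≤m+n _ u) (≤-reflexive (eq₂ u))
    where
    eq₁ : ∀ u → 2 * (6 + u * 3) + u * 6 ≡ 3 * suc (u * 4 + 3)
    eq₁ = solve-∀
    eq₂ : ∀ u → 6 + u * 3 + u ≡ suc (u * 4 + 3) + 2
    eq₂ = solve-∀
  addCycle {t = t} {ls} (2-mod-4 u) S = 4 + u * 3
    , closeLeft (advanceMiddle (advances u S))
    , ≤-trans (m≤m+n _ (u * 6 + 10)) (≤-reflexive (eq₁ u)) , ≤-trans (m≤m+n _ (u + 4)) (≤-reflexive (eq₂ u))
    where
    eq₁ : ∀ u → 2 * (4 + u * 3) + (u * 6 + 10) ≡ 3 * suc (2 + (u * 4 + 3))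
    eq₁ = solve-∀
    eq₂ : ∀ u → 4 + u * 3 + (u + 4) ≡ suc (2 + (u * 4 + 3)) + 2
    eq₂ = solve-∀

  addCycles : ∀ {ls} → All EvenLength ls →
    ∃ λ t → State t middle 3 ls × 2 * t ≤ 3 * sum ls × t ≤ sum ls + 2 * length ls
  addCycles []         = 0 , start , z≤n , z≤n
  addCycles {ℓ ∷ ls} (e ∷ es) with addCycles es
  ... | t , S , b₁ , b₂ with addCycle e S
  ... | κ , S′ , c₁ , c₂ = κ + t , S′
    , ≤-trans (≤-reflexive (*-distribˡ-+ 2 κ t)) (≤-trans (+-mono-≤ c₁ b₁) (≤-reflexive (sym (*-distribˡ-+ 3 ℓ (sum ls)))))
    , ≤-trans (+-mono-≤ c₂ b₂) (≤-reflexive (eq ℓ (sum ls) (length ls)))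
    where
    eq : ∀ ℓ σ r → ℓ + 2 + (σ + 2 * r) ≡ ℓ + σ + 2 * suc r
    eq = solve-∀

  climb-weights : ∀ m → climb m ≡ weights (m + 5)
  climb-weights zero    = refl
  climb-weights (suc m) = cong₂ _∷_ (cong just (eq m)) (climb-weights m)
    where
    eq : ∀ m → 3 + (m + 2) ≡ m + 5
    eq = solve-∀

  toFill : ∀ {b a t m ls} → suc (m + 5) ≡ b + a → Finished b a t m ls → Fill b a (hi 1) t ls [] []
  toFill {m = m} total (finished path cycles sizes vs es) = fill (rev path) cycles sizes (m + 5) total
    (↭-trans (++⁺ʳ _ (verts-rev path)) vs)
    (↭-trans (++⁺ʳ _ (steps-rev weight weight-sym path)) (↭-trans es (↭-reflexive (climb-weights m))))

  Square : ℕ → List ℕ → Set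
  Square a ls = (∃ λ t → Fill a a (hi 1) t ls [] []) × (∃ λ t → Fill (suc a) a (hi 1) t ls [] [])

  private
    resize : ∀ {b a b′ t ls} → b ≡ b′ → Fill b a (hi 1) t ls [] [] → Fill b′ a (hi 1) t ls [] []
    resize refl F = F

    even-total : ∀ t → suc (6 + double t + 5) ≡ 4 + (t + 2) + (6 + t)
    even-total t rewrite double-+ t = eq t
      where
      eq : ∀ t → suc (6 + (t + t) + 5) ≡ 4 + (t + 2) + (6 + t)
      eq = solve-∀

    odd-total : ∀ t → suc (7 + double t + 5) ≡ 5 + (t + 2) + (6 + t)
    odd-total t rewrite double-+ t = eq t
      where
      eq : ∀ t → suc (7 + (t + t) + 5) ≡ 5 + (t + 2) + (6 + t)
      eq = solve-∀

    long-total : ∀ t → suc (12 + double t + 5) ≡ 7 + (t + 2) + (9 + t)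
    long-total t rewrite double-+ t = eq t
      where
      eq : ∀ t → suc (12 + (t + t) + 5) ≡ 7 + (t + 2) + (9 + t)
      eq = solve-∀

    plus-two : ∀ k t → k + (t + 2) ≡ 2 + k + t
    plus-two k t = trans (sym (+-assoc k t 2)) (+-comm (k + t) 2)

  -- A round of three advances returns to `middle`, so the size modulo 3 decides in which position
  -- the construction is finished.
  square : ∀ {t ls} i n → i < 3 → State t middle 3 ls → Square (7 + i + (n * 3 + t)) ls
  square {t} 0 n _ S = (_ , resize (plus-two 4 _) (toFill (even-total τ) (finishLeftEven S′)))
                     , (_ , resize (plus-two 5 _) (toFill (odd-total τ) (finishLeftOdd S′)))
    where
    τ  = 1 + (n * 3 + t)
    S′ = advanceMiddle (advances n S)
  square {t} 1 n _ S = (_ , resize (plus-two 4 _) (toFill (even-total τ) (finishRightEven S′)))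
                     , (_ , resize (plus-two 5 _) (toFill (odd-total τ) (finishRightOdd S′)))
    where
    τ  = 2 + (n * 3 + t)
    S′ = advanceLeft (advanceMiddle (advances n S))
  -- The long ending reaches three levels further, so the square takes one round less than the
  -- rectangle.
  square {t} 2 n _ S = (_ , resize (plus-two 7 _) (toFill (long-total τ) (finishMiddleEven (advances n S))))
                     , (_ , resize (plus-two 5 _) (toFill (odd-total (3 + τ)) (finishMiddleOdd (advances (suc n) S))))
    where
    τ = n * 3 + t
  square (suc (suc (suc _))) n (s≤s (s≤s (s≤s ()))) S

  squares : ∀ {t ls} a → t + 7 ≤ a → State t middle 3 ls → Square a ls
  squares {t} {ls} a t+7≤a S = subst (λ a → Square a ls) size-a (square (r % 3) (r / 3) (m%n<n r 3) S)
    where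
    r = a ∸ (t + 7)
    eq : ∀ i q t → 7 + i + (q + t) ≡ i + q + (t + 7)
    eq = solve-∀
    size-a : 7 + r % 3 + (r / 3 * 3 + t) ≡ a
    size-a = trans (eq (r % 3) (r / 3 * 3) t) (trans (cong (_+ (t + 7)) (sym (m≡m%n+[m/n]*n r 3))) (m∸n+n≡m t+7≤a))

-- Graceful labellings

-- e is the end of the path at which new vertices are attached.
record Graceful (n e : ℕ) (ls : List ℕ) : Set where
  constructor graceful
  field
    {other} : ℕ
    path    : Walk e other
    cycles  : List (Cycle ℕ)
    sizes   : map size cycles ≡ ls
    m       : ℕ
    suc-m   : suc m ≡ n
    vs      : verts path ++ allverts cycles ↭ downFrom n
    es      : steps ∣_-_∣ path ++ allsteps ∣_-_∣ cycles ↭ map suc (downFrom m)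

∣+-+∣ : ∀ a x y → ∣ x + a - y + a ∣ ≡ ∣ x - y ∣
∣+-+∣ a x y = trans (cong₂ ∣_-_∣ (+-comm x a) (+-comm y a)) (∣m+n-m+o∣≡∣n-o∣ a x y)

-- The old labels move up by a; the new ones fill both sides and use the differences n, n + 1, …
glue : ∀ {n e ls y t} a b → Graceful n e ls → (p : Walk y t) (cs : List (Cycle ℕ)) →
  verts p ++ allverts cs ↭ map (_+ (n + a)) (downFrom b) ++ downFrom a →
  ∣ y - e + a ∣ ∷ steps ∣_-_∣ p ++ allsteps ∣_-_∣ cs ↭ map (_+ n) (downFrom (b + a)) →
  Graceful (b + (n + a)) t (map size cs ++ ls)
glue {n} {e} {ls} {y} {t} a b g p cs p-vs p-es = record
  { path   = rev p ▸ mapW (_+ a) path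
  ; cycles = cs ++ map (mapC (_+ a)) cycles
  ; sizes  = trans (map-++ size cs _) (cong (map size cs ++_) (trans (sizes-map (_+ a) cycles) sizes))
  ; m      = b + a + m
  ; suc-m  = trans (sym (+-suc (b + a) m)) (trans (cong (b + a +_) suc-m) (trans (+-assoc b a n) (cong (b +_) (+-comm a n))))
  ; vs     = begin
      verts (rev p ▸ mapW (_+ a) path) ++ allverts (cs ++ map (mapC (_+ a)) cycles)
        ≡⟨ cong₂ _++_ (trans (verts-▸ (rev p) _) (cong (verts (rev p) ++_) (verts-map (_+ a) path)))
             (trans (concatMap-++ cverts cs _) (cong (allverts cs ++_) (allverts-map (_+ a) cycles))) ⟩
      (verts (rev p) ++ map (_+ a) (verts path)) ++ allverts cs ++ map (_+ a) (allverts cycles)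
        ↭⟨ ++⁺ʳ _ (++⁺ʳ _ (verts-rev p)) ⟩
      (verts p ++ map (_+ a) (verts path)) ++ allverts cs ++ map (_+ a) (allverts cycles)
        ↭⟨ rearrange (verts p ∷ map (_+ a) (verts path) ∷ allverts cs ∷ map (_+ a) (allverts cycles) ∷ [])
             ((# 0 ⊕ # 1) ⊕ # 2 ⊕ # 3) ((# 0 ⊕ # 2) ⊕ # 1 ⊕ # 3) refl ⟩
      (verts p ++ allverts cs) ++ map (_+ a) (verts path) ++ map (_+ a) (allverts cycles)
        ↭⟨ ++⁺ p-vs (↭-trans (↭-reflexive (sym (map-++ (_+ a) (verts path) (allverts cycles)))) (map⁺ (_+ a) vs)) ⟩
      (map (_+ (n + a)) (downFrom b) ++ downFrom a) ++ map (_+ a) (downFrom n)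
        ↭⟨ rearrange (map (_+ (n + a)) (downFrom b) ∷ downFrom a ∷ map (_+ a) (downFrom n) ∷ [])
             ((# 0 ⊕ # 1) ⊕ # 2) (# 0 ⊕ # 2 ⊕ # 1) refl ⟩
      map (_+ (n + a)) (downFrom b) ++ map (_+ a) (downFrom n) ++ downFrom a
        ≡⟨ trans (downFrom-+ b (n + a)) (cong (map (_+ (n + a)) (downFrom b) ++_) (downFrom-+ n a)) ⟨
      downFrom (b + (n + a)) ∎
  ; es     = begin
      steps ∣_-_∣ (rev p ▸ mapW (_+ a) path) ++ allsteps ∣_-_∣ (cs ++ map (mapC (_+ a)) cycles)
        ≡⟨ cong₂ _++_ (trans (steps-▸ ∣_-_∣ (rev p) _) (cong (λ xs → steps ∣_-_∣ (rev p) ++ ∣ y - e + a ∣ ∷ xs) path-steps))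
             (trans (concatMap-++ (csteps ∣_-_∣) cs _) (cong (allsteps ∣_-_∣ cs ++_) cycles-steps)) ⟩
      (steps ∣_-_∣ (rev p) ++ ∣ y - e + a ∣ ∷ steps ∣_-_∣ path) ++ allsteps ∣_-_∣ cs ++ allsteps ∣_-_∣ cycles
        ↭⟨ ++⁺ʳ _ (++⁺ʳ _ (steps-rev ∣_-_∣ ∣-∣-comm p)) ⟩
      (steps ∣_-_∣ p ++ ∣ y - e + a ∣ ∷ steps ∣_-_∣ path) ++ allsteps ∣_-_∣ cs ++ allsteps ∣_-_∣ cycles
        ↭⟨ rearrange (steps ∣_-_∣ p ∷ (∣ y - e + a ∣ ∷ []) ∷ steps ∣_-_∣ path ∷ allsteps ∣_-_∣ cs ∷ allsteps ∣_-_∣ cycles ∷ [])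
             ((# 0 ⊕ # 1 ⊕ # 2) ⊕ # 3 ⊕ # 4) ((# 1 ⊕ # 0 ⊕ # 3) ⊕ # 2 ⊕ # 4) refl ⟩
      (∣ y - e + a ∣ ∷ steps ∣_-_∣ p ++ allsteps ∣_-_∣ cs) ++ steps ∣_-_∣ path ++ allsteps ∣_-_∣ cycles
        ↭⟨ ++⁺ p-es es ⟩
      map (_+ n) (downFrom (b + a)) ++ map suc (downFrom m)
        ≡⟨ cong (_++ map suc (downFrom m)) (trans (map-cong (λ k → trans (cong (k +_) (sym suc-m)) (+-suc k m)) (downFrom (b + a))) (map-∘ (downFrom (b + a)))) ⟩
      map suc (map (_+ m) (downFrom (b + a))) ++ map suc (downFrom m)
        ≡⟨ trans (cong (map suc) (downFrom-+ (b + a) m)) (map-++ suc (map (_+ m) (downFrom (b + a))) (downFrom m)) ⟨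
      map suc (downFrom (b + a + m)) ∎
  }
  where
  open Graceful g
  open PermutationReasoning
  path-steps : steps ∣_-_∣ (mapW (_+ a) path) ≡ steps ∣_-_∣ path
  path-steps = trans (steps-map ∣_-_∣ ∣_-_∣ (_+ a) id {P = λ _ → ⊤} (λ x y _ _ → ∣+-+∣ a x y) path (All.universal _ _)) (map-id _)
  cycles-steps : allsteps ∣_-_∣ (map (mapC (_+ a)) cycles) ≡ allsteps ∣_-_∣ cycles
  cycles-steps = trans (allsteps-map ∣_-_∣ ∣_-_∣ (_+ a) id {P = λ _ → ⊤} (λ x y _ _ → ∣+-+∣ a x y) cycles (All.universal _ _)) (map-id _)

embed : ℕ → ℕ → V → ℕ
embed n a (lo i) = a ∸ suc i
embed n a (hi j) = j + (n + a)

difference : ℕ → Maybe ℕ → ℕ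
difference n (just k) = suc k + n
difference n nothing  = 0

embed-weight : ∀ {n b a k} x y → InBox b a x → InBox b a y → weight x y ≡ just k →
  ∣ embed n a x - embed n a y ∣ ≡ suc k + n
embed-weight {n} {b} {a} (lo i) (hi j) i<a _ refl = begin
  ∣ p - j + (n + a) ∣                       ≡⟨ cong (λ a → ∣ p - j + (n + a) ∣) (m+[n∸m]≡n i<a) ⟨
  ∣ p - j + (n + (suc i + p)) ∣             ≡⟨ cong (∣ p -_∣) (eq p i j n) ⟩
  ∣ p - p + (suc (i + j) + n) ∣             ≡⟨ ∣m-m+n∣≡n p (suc (i + j) + n) ⟩
  suc (i + j) + n                           ∎
  where
  open ≡-Reasoning
  p = a ∸ suc i
  eq : ∀ p i j n → j + (n + (suc i + p)) ≡ p + (suc (i + j) + n)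
  eq = solve-∀
embed-weight {n} {b} {a} (hi j) (lo i) p q refl =
  trans (∣-∣-comm (embed n a (hi j)) (embed n a (lo i))) (embed-weight {n} {b} {a} (lo i) (hi j) q p refl)

-- That no edge runs inside a side is never checked edge by edge: the weights of the edges rearrange
-- `weights m`, in which `nothing` does not occur. Hence the value 0 in `difference` is never met.
data IsJust {A : Set} : Maybe A → Set where
  is-just : ∀ {a} → IsJust (just a)

weights-just : ∀ m → All IsJust (weights m)
weights-just m = All.map⁺ (All.universal (λ _ → is-just) (downFrom m))

embed-step : ∀ {n b a} x y → InBox b a x → InBox b a y → IsJust (weight x y) →
  ∣ embed n a x - embed n a y ∣ ≡ difference n (weight x y)
embed-step {n} {b} {a} x y p q j with weight x y in eq | j
... | just k | _ = embed-weight {n} {b} {a} x y p q eq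

embed-steps : ∀ {n b a x y} (p : Walk x y) → All (InBox b a) (verts p) → All IsJust (steps weight p) →
  steps ∣_-_∣ (mapW (embed n a) p) ≡ map (difference n) (steps weight p)
embed-steps [ x ]                         _        _        = refl
embed-steps {n} {b} {a} (_∷_ x {y} p) (i ∷ is) (j ∷ js) =
  cong₂ _∷_ (embed-step {n} {b} {a} x y i (head-verts p is) j) (embed-steps {n} {b} {a} p is js)

embed-allsteps : ∀ {n b a} (cs : List (Cycle V)) → All (InBox b a) (allverts cs) → All IsJust (allsteps weight cs) →
  allsteps ∣_-_∣ (map (mapC (embed n a)) cs) ≡ map (difference n) (allsteps weight cs)
embed-allsteps []       _  _  = refl
embed-allsteps {n} {b} {a} (c ∷ cs) is js = trans
  (cong₂ _++_
    (cong₂ _∷_ (embed-step {n} {b} {a} _ _ (last-verts (walk c) i₁) (head-verts (walk c) i₁) (All.head j₁)) (embed-steps {n} {b} {a} (walk c) i₁ (All.tail j₁)))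
    (embed-allsteps {n} {b} {a} cs (All.++⁻ʳ (cverts c) is) (All.++⁻ʳ (csteps weight c) js)))
  (sym (map-++ (difference n) (csteps weight c) (allsteps weight cs)))
  where
  i₁ = All.++⁻ˡ (cverts c) is
  j₁ = All.++⁻ˡ (csteps weight c) js

embed-box : ∀ n b a → map (embed n a) (box b a) ↭ map (_+ (n + a)) (downFrom b) ++ downFrom a
embed-box n b a = ↭-trans
  (↭-reflexive (trans (map-++ (embed n a) (map hi (downFrom b)) (map lo (downFrom a)))
    (cong₂ _++_ (sym (map-∘ (downFrom b))) (sym (map-∘ (downFrom a))))))
  (++⁺ˡ (map (_+ (n + a)) (downFrom b)) (reverse-downFrom a))

differences-weights : ∀ n m → map (difference n) (weights m) ≡ map (λ k → suc k + n) (downFrom m)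
differences-weights n m = sym (map-∘ (downFrom m))

differences-suc : ∀ n m → n ∷ map (λ k → suc k + n) (downFrom m) ↭ map (_+ n) (downFrom (suc m))
differences-suc n m = begin
  n ∷ map (λ k → suc k + n) (downFrom m)
    ↭⟨ ++-comm (n ∷ []) (map (λ k → suc k + n) (downFrom m)) ⟩
  map (λ k → suc k + n) (downFrom m) ++ n ∷ []
    ≡⟨ trans (map-++ (_+ n) (map suc (downFrom m)) (0 ∷ [])) (cong (_++ n ∷ []) (sym (map-∘ (downFrom m)))) ⟨
  map (_+ n) (map suc (downFrom m) ++ 0 ∷ [])
    ↭⟨ map⁺ (_+ n) (downFrom-suc m) ⟨
  map (_+ n) (downFrom (suc m)) ∎
  where open PermutationReasoning

-- The vertex `hi e` gets the label e + n + a and the old end moves to e + a, so the link has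
-- difference n, the only new difference that no weight provides.
attach : ∀ {n e b a t ls ls′} → Graceful n e ls → Fill b a (hi e) t ls′ [] [] →
  Graceful (b + (n + a)) (embed n a t) (ls′ ++ ls)
attach {n} {e} {b} {a} {t} {ls} {ls′} g F = subst (λ ks → Graceful (b + (n + a)) (embed n a t) (ks ++ ls))
  (trans (sizes-map f cycles) sizes)
  (glue a b g (mapW f path) (map (mapC f) cycles)
    (begin
      verts (mapW f path) ++ allverts (map (mapC f) cycles)
        ≡⟨ trans (cong₂ _++_ (verts-map f path) (allverts-map f cycles)) (sym (map-++ f (verts path) (allverts cycles))) ⟩
      map f (verts path ++ allverts cycles)
        ↭⟨ map⁺ f vs ⟩
      map f (box b a)
        ↭⟨ embed-box n b a ⟩
      map (_+ (n + a)) (downFrom b) ++ downFrom a ∎)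
    (begin
      ∣ f (hi e) - e + a ∣ ∷ steps ∣_-_∣ (mapW f path) ++ allsteps ∣_-_∣ (map (mapC f) cycles)
        ≡⟨ cong₂ _∷_ link (trans (cong₂ _++_ (embed-steps {n} {b} {a} path (All.++⁻ˡ _ inBox) (All.++⁻ˡ _ isJust))
             (embed-allsteps {n} {b} {a} cycles (All.++⁻ʳ (verts path) inBox) (All.++⁻ʳ (steps weight path) isJust)))
             (sym (map-++ (difference n) (steps weight path) (allsteps weight cycles)))) ⟩
      n ∷ map (difference n) (steps weight path ++ allsteps weight cycles)
        ↭⟨ prep n (map⁺ (difference n) es) ⟩
      n ∷ map (difference n) (weights m)
        ≡⟨ cong (n ∷_) (differences-weights n m) ⟩
      n ∷ map (λ k → suc k + n) (downFrom m)
        ↭⟨ differences-suc n m ⟩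
      map (_+ n) (downFrom (suc m))
        ≡⟨ cong (map (_+ n) ∘ downFrom) suc-m ⟩
      map (_+ n) (downFrom (b + a)) ∎))
  where
  open Fill F
  open PermutationReasoning
  f = embed n a
  inBox : All (InBox b a) (verts path ++ allverts cycles)
  inBox = All-resp-↭ (↭-sym vs) (box-InBox b a)
  isJust : All IsJust (steps weight path ++ allsteps weight cycles)
  isJust = All-resp-↭ (↭-sym es) (weights-just m)
  eq : ∀ n e a → e + (n + a) ≡ e + a + n
  eq = solve-∀
  link : ∣ e + (n + a) - e + a ∣ ≡ n
  link = trans (cong (∣_- e + a ∣) (eq n e a)) (trans (∣-∣-comm (e + a + n) (e + a)) (∣m-m+n∣≡n (e + a) n))

∣∸-∸∣-≤ : ∀ {n x y} → x ≤ y → y < n → ∣ n ∸ suc x - n ∸ suc y ∣ ≡ ∣ x - y ∣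
∣∸-∸∣-≤ {n} {x} {y} x≤y y<n = begin
  ∣ n ∸ suc x - q ∣          ≡⟨ cong (∣_- q ∣) shape ⟩
  ∣ q + δ - q ∣              ≡⟨ trans (∣-∣-comm (q + δ) q) (∣m-m+n∣≡n q δ) ⟩
  δ                          ≡⟨ m≤n⇒∣m-n∣≡n∸m x≤y ⟨
  ∣ x - y ∣                  ∎
  where
  open ≡-Reasoning
  δ = y ∸ x
  q = n ∸ suc y
  eq : ∀ x δ q → suc (x + δ) + q ≡ q + δ + suc x
  eq = solve-∀
  shape : n ∸ suc x ≡ q + δ
  shape = trans (cong (_∸ suc x) (trans (sym (m+[n∸m]≡n y<n)) (trans (cong (λ y → suc y + q) (sym (m+[n∸m]≡n x≤y))) (eq x δ q)))) (m+n∸n≡m (q + δ) (suc x))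

∣∸-∸∣ : ∀ {n} x y → x < n → y < n → ∣ n ∸ suc x - n ∸ suc y ∣ ≡ ∣ x - y ∣
∣∸-∸∣ {n} x y x<n y<n with ≤-total x y
... | inj₁ x≤y = ∣∸-∸∣-≤ x≤y y<n
... | inj₂ y≤x = trans (∣-∣-comm (n ∸ suc x) (n ∸ suc y)) (trans (∣∸-∸∣-≤ y≤x x<n) (∣-∣-comm y x))

-- It restores the end label after an odd lengthening, which stops at a high vertex, and in the
-- mixed case it moves a small end label far out, where a large square fits.
complement : ∀ {n e ls} → Graceful n e ls → Graceful n (n ∸ suc e) ls
complement {n} {e} {ls} (graceful path cycles sizes m suc-m vs es) = graceful
  (mapW f path) (map (mapC f) cycles) (trans (sizes-map f cycles) sizes) m suc-m
  (begin
    verts (mapW f path) ++ allverts (map (mapC f) cycles)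
      ≡⟨ trans (cong₂ _++_ (verts-map f path) (allverts-map f cycles)) (sym (map-++ f (verts path) (allverts cycles))) ⟩
    map f (verts path ++ allverts cycles)
      ↭⟨ map⁺ f vs ⟩
    map f (downFrom n)
      ↭⟨ reverse-downFrom n ⟩
    downFrom n ∎)
  (↭-trans (↭-reflexive (cong₂ _++_
    (trans (steps-map ∣_-_∣ ∣_-_∣ f id ∣∸-∸∣ path (All.++⁻ˡ _ small)) (map-id _))
    (trans (allsteps-map ∣_-_∣ ∣_-_∣ f id ∣∸-∸∣ cycles (All.++⁻ʳ (verts path) small)) (map-id _)))) es)
  where
  open PermutationReasoning
  f = λ x → n ∸ suc x
  small : All (_< n) (verts path ++ allverts cycles)
  small = All-resp-↭ (↭-sym vs) (<-downFrom n)

-- The path stops at `lo x`, and its label a - 1 - x is again e by the relation between the two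
-- ends.
lengthenEven : ∀ {n e ls} x → Graceful n e ls → Graceful ((x + suc e) + (x + suc e) + n) e ls
lengthenEven {n} {e} {ls} x g = subst₂ (λ N e → Graceful N e ls)
  (trans (sym (+-assoc a n a)) (trans (+-comm (a + n) a) (sym (+-assoc a a n)))) (trans (cong (_∸ suc x) (+-suc x e)) (m+n∸m≡n x e))
  (attach g (evenPath (x + e) x e ≤-refl))
  where a = x + suc e

lengthenOdd : ∀ {n e ls} x → (x ≡ e → e ≡ 0) → Graceful n e ls → Graceful (suc (x + e + (x + e)) + n) e ls
lengthenOdd {n} {e} {ls} x x≢e g = subst₂ (λ N e → Graceful N e ls) (eq₁ n a) (trans (cong (_∸ suc (x + (n + a))) (eq₂ n x e)) (m+n∸m≡n (suc (x + (n + a))) e))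
  (complement (attach g (oddPath a x e ≤-refl x≢e)))
  where
  a = x + e
  eq₁ : ∀ n a → suc a + (n + a) ≡ suc (a + a) + n
  eq₁ = solve-∀
  eq₂ : ∀ n x e → suc (x + e) + (n + (x + e)) ≡ suc (x + (n + (x + e))) + e
  eq₂ = solve-∀

data Parity : ℕ → Set where
  even : ∀ k → Parity (k + k)
  odd  : ∀ k → Parity (suc (k + k))

parity : ∀ n → Parity n
parity zero = even 0
parity (suc n) with parity n
... | even k = odd k
... | odd k  = subst Parity (cong suc (+-suc k k)) (even (suc k))

half-≤ : ∀ {j k} → j + j ≤ suc (k + k) → j ≤ k
half-≤ {j} {k} h with j ≤? k
... | yes j≤k = j≤k
... | no  j≰k = contradiction (≤-trans (≤-trans (≤-reflexive (cong suc (sym (+-suc k k)))) (+-mono-≤ (≰⇒> j≰k) (≰⇒> j≰k))) h) 1+n≰n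

-- The lower bound lets `hi e` fit into the box with x ≥ 0; the excluded m = 4e + 1 is the number of
-- vertices of an odd path with x = e.
lengthen : ∀ {n e ls} m → suc (e + e) ≤ m → m ≢ suc (e + e + (e + e)) → Graceful n e ls → Graceful (m + n) e ls
lengthen {n} {e} {ls} m long m≢ g with parity m
... | even k = subst (λ k → Graceful (k + k + n) e ls) (m∸n+n≡m e<k) (lengthenEven (k ∸ suc e) g)
  where
  e<k : suc e ≤ k
  e<k = half-≤ (≤-trans (≤-reflexive (cong suc (+-suc e e))) (s≤s long))
... | odd k = subst (λ k → Graceful (suc (k + k) + n) e ls) (m∸n+n≡m e≤k)
  (lengthenOdd (k ∸ e) (λ eq → contradiction (cong (λ k → suc (k + k)) (trans (sym (m∸n+n≡m e≤k)) (cong (_+ e) eq))) m≢) g)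
  where
  e≤k : e ≤ k
  e≤k = half-≤ (≤-trans (≤-pred long) (n≤1+n (k + k)))

-- Attaching boxes with even cycles

open EvenCycles using (Square)

-- The end label dictates the size of the box: mirroring sends `hi 1` to `hi E` just when there are
-- E + 2 high vertices.
insertSquare : ∀ {n E ls ls′} → Graceful n E ls → Square (2 + E) ls′ → ∃ λ t → Graceful ((2 + E) + (n + (2 + E))) t (ls′ ++ ls)
insertSquare g ((_ , F) , _) = _ , attach g (reflect F)

insertRectangle : ∀ {n E ls ls′} → Graceful n E ls → Square (1 + E) ls′ → ∃ λ t → Graceful ((2 + E) + (n + (1 + E))) t (ls′ ++ ls)
insertRectangle g (_ , (_ , F)) = _ , attach g (reflect F)

fromFill : ∀ {b a s t ls} → Fill b a s t ls [] [] → ∃ λ e → Graceful (b + a) e ls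
fromFill {b} {a} {s} {t} {ls} F = embed 0 a s , record
  { path   = mapW f path
  ; cycles = map (mapC f) cycles
  ; sizes  = trans (sizes-map f cycles) sizes
  ; m      = m
  ; suc-m  = suc-m
  ; vs     = begin
      verts (mapW f path) ++ allverts (map (mapC f) cycles)
        ≡⟨ trans (cong₂ _++_ (verts-map f path) (allverts-map f cycles)) (sym (map-++ f (verts path) (allverts cycles))) ⟩
      map f (verts path ++ allverts cycles)
        ↭⟨ map⁺ f vs ⟩
      map f (box b a)
        ↭⟨ embed-box 0 b a ⟩
      map (_+ a) (downFrom b) ++ downFrom a
        ≡⟨ downFrom-+ b a ⟨
      downFrom (b + a) ∎
  ; es     = begin
      steps ∣_-_∣ (mapW f path) ++ allsteps ∣_-_∣ (map (mapC f) cycles)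
        ≡⟨ trans (cong₂ _++_ (embed-steps {0} {b} {a} path (All.++⁻ˡ _ inBox) (All.++⁻ˡ _ isJust))
             (embed-allsteps {0} {b} {a} cycles (All.++⁻ʳ (verts path) inBox) (All.++⁻ʳ (steps weight path) isJust)))
             (sym (map-++ (difference 0) (steps weight path) (allsteps weight cycles))) ⟩
      map (difference 0) (steps weight path ++ allsteps weight cycles)
        ↭⟨ map⁺ (difference 0) es ⟩
      map (difference 0) (weights m)
        ≡⟨ trans (differences-weights 0 m) (map-cong (λ k → +-identityʳ (suc k)) (downFrom m)) ⟩
      map suc (downFrom m) ∎
  }
  where
  open Fill F
  open PermutationReasoning
  f = embed 0 a
  inBox : All (InBox b a) (verts path ++ allverts cycles)
  inBox = All-resp-↭ (↭-sym vs) (box-InBox b a)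
  isJust : All IsJust (steps weight path ++ allsteps weight cycles)
  isJust = All-resp-↭ (↭-sym es) (weights-just m)

-- Odd cycles

-- A zigzag with one jump: going from `hi (2 + l)` by `lo l` to `hi l`, it passes over `hi (suc l)`
-- and from weight 2l + 2 directly to 2l.
descent : ∀ l g → Walk (hi (2 + (g + l))) (hi 0)
descent l zero    = hi (2 + l) ∷ lo l ∷ zigzag l
descent l (suc g) = hi (3 + (g + l)) ∷ lo (suc (g + l)) ∷ descent l g

descent-verts : ∀ l g → hi (suc l) ∷ verts (descent l g) ↭ box (3 + (g + l)) (suc (g + l))
descent-verts l zero = ↭-trans (prep _ (prep _ (prep _ (zigzag-verts l))))
  (rearrange ((hi (suc l) ∷ []) ∷ (hi (2 + l) ∷ []) ∷ (lo l ∷ []) ∷ map hi (downFrom (suc l)) ∷ map lo (downFrom l) ∷ [])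
    (# 0 ⊕ # 1 ⊕ # 2 ⊕ # 3 ⊕ # 4) ((# 1 ⊕ # 0 ⊕ # 3) ⊕ # 2 ⊕ # 4) refl)
descent-verts l (suc g) = ↭-trans
  (rearrange ((hi (suc l) ∷ []) ∷ (hi (3 + (g + l)) ∷ []) ∷ (lo (suc (g + l)) ∷ []) ∷ verts (descent l g) ∷ [])
    (# 0 ⊕ # 1 ⊕ # 2 ⊕ # 3) (# 1 ⊕ # 2 ⊕ # 0 ⊕ # 3) refl)
  (↭-trans (prep _ (prep _ (descent-verts l g)))
    (rearrange ((hi (3 + (g + l)) ∷ []) ∷ (lo (suc (g + l)) ∷ []) ∷ map hi (downFrom (3 + (g + l))) ∷ map lo (downFrom (suc (g + l))) ∷ [])
      (# 0 ⊕ # 1 ⊕ # 2 ⊕ # 3) ((# 0 ⊕ # 2) ⊕ # 1 ⊕ # 3) refl))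

descent-steps : ∀ l g → just (suc (l + l)) ∷ steps weight (descent l g) ↭ weights (3 + (g + l + (g + l)))
descent-steps l zero = begin
  just (suc (l + l)) ∷ just (l + (2 + l)) ∷ just (l + l) ∷ steps weight (zigzag l)
    ≡⟨ cong₂ (λ k ws → just (suc (l + l)) ∷ just k ∷ just (l + l) ∷ ws) (trans (+-suc l (suc l)) (cong suc (+-suc l l))) (zigzag-steps l) ⟩
  just (suc (l + l)) ∷ just (2 + (l + l)) ∷ weights (suc (l + l))
    ↭⟨ swap _ _ ↭-refl ⟩
  weights (3 + (l + l)) ∎
  where open PermutationReasoning
descent-steps l (suc g) = begin
  just (suc (l + l)) ∷ just (suc (g + l) + (3 + (g + l))) ∷ just (suc (g + l) + (2 + (g + l))) ∷ steps weight (descent l g)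
    ↭⟨ rearrange ((just (suc (l + l)) ∷ []) ∷ (just (suc (g + l) + (3 + (g + l))) ∷ just (suc (g + l) + (2 + (g + l))) ∷ []) ∷ steps weight (descent l g) ∷ [])
         (# 0 ⊕ # 1 ⊕ # 2) (# 1 ⊕ # 0 ⊕ # 2) refl ⟩
  just (suc (g + l) + (3 + (g + l))) ∷ just (suc (g + l) + (2 + (g + l))) ∷ just (suc (l + l)) ∷ steps weight (descent l g)
    ≡⟨ cong₂ (λ i j → just i ∷ just j ∷ just (suc (l + l)) ∷ steps weight (descent l g)) (eq₁ (g + l)) (eq₂ (g + l)) ⟩
  just (4 + (g + l + (g + l))) ∷ just (3 + (g + l + (g + l))) ∷ just (suc (l + l)) ∷ steps weight (descent l g)
    ↭⟨ prep _ (prep _ (descent-steps l g)) ⟩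
  weights (5 + (g + l + (g + l)))
    ≡⟨ cong weights (eq₃ (g + l)) ⟨
  weights (3 + (suc g + l + (suc g + l))) ∎
  where
  open PermutationReasoning
  eq₁ : ∀ q → suc q + (3 + q) ≡ 4 + (q + q)
  eq₁ = solve-∀
  eq₂ : ∀ q → suc q + (2 + q) ≡ 3 + (q + q)
  eq₂ = solve-∀
  eq₃ : ∀ q → 3 + (suc q + suc q) ≡ 5 + (q + q)
  eq₃ = solve-∀

descentFill : ∀ l g → Fill (3 + (g + l)) (suc (g + l)) (hi (2 + (g + l))) (hi 0) [] (hi (suc l) ∷ []) (just (suc (l + l)) ∷ [])
descentFill l g = fill (descent l g) [] refl (3 + (g + l + (g + l))) (eq (g + l))
  (↭-trans (prep _ (↭-reflexive (++-identityʳ _))) (descent-verts l g))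
  (↭-trans (prep _ (↭-reflexive (++-identityʳ _))) (descent-steps l g))
  where
  eq : ∀ q → suc (3 + (q + q)) ≡ 3 + q + suc q
  eq = solve-∀

-- A path from hi E avoiding the low vertex x and the weight y; it ends f places before the outermost low vertex.
record Avoiding (E f x y total : ℕ) : Set where
  constructor avoiding
  field
    {b a w} : ℕ
    config  : Fill b a (hi E) (lo w) [] (lo x ∷ []) (just y ∷ [])
    a≡      : a ≡ suc w + f
    b+a≡    : b + a ≡ total

-- The jump out of this block uses the weight that the descent avoids, and leaves its own weight E + E unused.
avoid₀ : ∀ l E → Avoiding E (2 + (l + E + l)) (suc l + E) (E + E) (4 + (l + E + l + (l + E + l)) + suc (E + E))
avoid₀ l E = avoiding {b = suc (l + E + l) + suc E} {a = 3 + (l + E + l) + E} {w = E}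
  (prefix (E + E) (swapShift E) (zigzag E) (swapShift-weight E) (zigzag-verts E) (zigzag-steps E)
    (↭-trans (swap _ _ ↭-refl) (↭-reflexive (cong (λ k → just (E + E) ∷ just k ∷ []) (eq₁ l E))))
    (swapShift-box E (3 + (l + E + l)) (suc (l + E + l))) (eq₂ (l + E + l) E) (descentFill l (l + E)))
  (eq₃ (l + E + l) E) (eq₄ (l + E + l) E)
  where
  eq₁ : ∀ l E → 2 + (l + E + l) + E + 0 ≡ suc (l + l) + suc (E + E)
  eq₁ = solve-∀
  eq₂ : ∀ q E → suc q + suc E + (3 + q + E) ≡ 3 + q + suc q + suc (E + E)
  eq₂ = solve-∀
  eq₃ : ∀ q E → 3 + q + E ≡ suc E + (2 + q)
  eq₃ = solve-∀
  eq₄ : ∀ q E → suc q + suc E + (3 + q + E) ≡ 4 + (q + q) + suc (E + E)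
  eq₄ = solve-∀

-- One half block exchanges the sides, so a pair keeps the avoided vertex low. The index of the end
-- and the number of low vertices rise equally, which preserves f.
avoidTwice : ∀ {E f x y m} → Avoiding E f x y m → Avoiding E f (x + suc E + E) (y + suc (E + E) + suc (E + E)) (m + (suc E + E + (suc E + E)))
avoidTwice {E} {f} {x} {y} (avoiding {b} {a} {u} F refl refl) = avoiding (halfBlock E (halfBlock E F)) (eq₁ u f E) (eq₂ b (suc u + f) E)
  where
  eq₁ : ∀ u f E → suc u + f + suc E + E ≡ suc (u + suc E + E) + f
  eq₁ = solve-∀
  eq₂ : ∀ b a E → b + E + suc E + (a + suc E + E) ≡ b + a + (suc E + E + (suc E + E))
  eq₂ = solve-∀

avoids : ∀ {E f x y m} j → Avoiding E f x y m →
  Avoiding E f (x + j * (suc E + E)) (y + j * (2 * suc (E + E))) (m + j * (2 * suc (E + E)))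
avoids {E} {f} {x} {y} {m} zero    A = subst₂ (λ x y → Avoiding E f x y (m + 0)) (sym (+-identityʳ x)) (sym (+-identityʳ y)) (subst (Avoiding E f x y) (sym (+-identityʳ m)) A)
avoids {E} {f} {x} {y} {m} (suc j) A = subst₂ (λ x y → Avoiding E f x y (m + suc j * (2 * suc (E + E)))) (eq₁ x j E) (eq₂ y j E)
  (subst (Avoiding E f _ _) (eq₃ m j E) (avoidTwice (avoids j A)))
  where
  eq₁ : ∀ x j E → x + j * (suc E + E) + suc E + E ≡ x + suc j * (suc E + E)
  eq₁ = solve-∀
  eq₂ : ∀ y j E → y + j * (2 * suc (E + E)) + suc (E + E) + suc (E + E) ≡ y + suc j * (2 * suc (E + E))
  eq₂ = solve-∀
  eq₃ : ∀ m j E → m + j * (2 * suc (E + E)) + (suc E + E + (suc E + E)) ≡ m + suc j * (2 * suc (E + E))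
  eq₃ = solve-∀

-- The new cycle is the corner zigzag on 2k vertices, closed up through the low vertex that the path avoids:
-- one edge at that vertex has the difference n, the other one the weight that the path avoids.
insertOdd : ∀ {y e f m ls} κ → Graceful (suc y + suc κ) e ls → Avoiding (e + suc κ) f (suc y) y m →
  Graceful (m + (suc κ + suc κ) + (suc y + suc κ)) f (suc (suc κ + suc κ) ∷ ls)
insertOdd {y} {e} {f} {_} {ls} κ g (avoiding {b₀} {a₀} {u} F a≡ refl) = subst₂ (λ N e → Graceful N e (suc (suc κ + suc κ) ∷ ls)) size-eq end-eq
  (subst (λ ℓ → Graceful (b + (n + a)) (ψ (lo u)) (ℓ ∷ ls)) cycle-size
    (glue a b g (mapW ψ path) (⟲ mapW φ (lo n ∷ zigzag⁺ κ) ∷ []) new-verts new-steps))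
  where
  open Fill F
  open PermutationReasoning
  k = suc κ
  n = suc y + k
  a = a₀ + k
  b = b₀ + k
  φ = embed n a
  ψ = φ ∘ shiftBoth k

  size-eq : b + (n + a) ≡ b₀ + a₀ + (k + k) + n
  size-eq = eq b₀ a₀ k n
    where
    eq : ∀ b₀ a₀ k n → b₀ + k + (n + (a₀ + k)) ≡ b₀ + a₀ + (k + k) + n
    eq = solve-∀

  end-eq : ψ (lo u) ≡ f
  end-eq = trans (cong (λ a₀ → a₀ + k ∸ suc (u + k)) a≡) (trans (cong (_∸ suc (u + k)) (eq u f k)) (m+n∸m≡n (suc (u + k)) f))
    where
    eq : ∀ u f k → suc u + f + k ≡ suc (u + k) + f
    eq = solve-∀

  no-cycles : ∀ {cs : List (Cycle V)} → map size cs ≡ [] → cs ≡ []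
  no-cycles {[]} _ = refl

  vs′ : lo (suc y) ∷ verts path ↭ box b₀ a₀
  vs′ = ↭-trans (prep _ (↭-reflexive (sym (trans (cong (λ cs → verts path ++ allverts cs) (no-cycles sizes)) (++-identityʳ _))))) vs

  es′ : just y ∷ steps weight path ↭ weights m
  es′ = ↭-trans (prep _ (↭-reflexive (sym (trans (cong (λ cs → steps weight path ++ allsteps weight cs) (no-cycles sizes)) (++-identityʳ _))))) es

  cycle-size : suc (length (verts (mapW φ (zigzag⁺ κ)))) ≡ suc (k + k)
  cycle-size = cong suc (trans (cong length (verts-map φ (zigzag⁺ κ))) (trans (length-map φ (verts (zigzag⁺ κ)))
    (trans (↭-length (zigzag⁺-verts κ)) (trans (length-++ (map hi (downFrom k))) (cong₂ _+_ (len hi) (len lo))))))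
    where
    len : (c : ℕ → V) → length (map c (downFrom k)) ≡ k
    len c = trans (length-map c (downFrom k)) (length-downFrom k)

  all-verts : (lo n ∷ map (shiftBoth k) (verts path)) ++ verts (zigzag⁺ κ) ↭ box b a
  all-verts = begin
    map (shiftBoth k) (lo (suc y) ∷ verts path) ++ verts (zigzag⁺ κ)
      ↭⟨ ++⁺ (map⁺ (shiftBoth k) vs′) (zigzag⁺-verts κ) ⟩
    map (shiftBoth k) (box b₀ a₀) ++ box k k
      ↭⟨ ++-comm (map (shiftBoth k) (box b₀ a₀)) (box k k) ⟩
    box k k ++ map (shiftBoth k) (box b₀ a₀)
      ↭⟨ shiftBoth-box k b₀ a₀ ⟩
    box b a ∎

  inBox : All (InBox b a) ((lo n ∷ map (shiftBoth k) (verts path)) ++ verts (zigzag⁺ κ))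
  inBox = All-resp-↭ (↭-sym all-verts) (box-InBox b a)

  zigzag-inBox : All (InBox b a) (verts (zigzag⁺ κ))
  zigzag-inBox = All.++⁻ʳ (lo n ∷ map (shiftBoth k) (verts path)) inBox

  path-inBox : All (InBox b a) (verts (mapW (shiftBoth k) path))
  path-inBox = subst (All (InBox b a)) (sym (verts-map (shiftBoth k) path)) (All.tail (All.++⁻ˡ (lo n ∷ map (shiftBoth k) (verts path)) inBox))

  n<a : n < a
  n<a = All.head inBox

  new-verts : verts (mapW ψ path) ++ (φ (lo n) ∷ verts (mapW φ (zigzag⁺ κ))) ++ [] ↭ map (_+ (n + a)) (downFrom b) ++ downFrom a
  new-verts = begin
    verts (mapW ψ path) ++ (φ (lo n) ∷ verts (mapW φ (zigzag⁺ κ))) ++ []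
      ≡⟨ cong₂ (λ xs ys → xs ++ (φ (lo n) ∷ ys) ++ []) (trans (verts-map ψ path) (map-∘ (verts path))) (verts-map φ (zigzag⁺ κ)) ⟩
    map φ (map (shiftBoth k) (verts path)) ++ (φ (lo n) ∷ map φ (verts (zigzag⁺ κ))) ++ []
      ↭⟨ rearrange (map φ (map (shiftBoth k) (verts path)) ∷ (φ (lo n) ∷ []) ∷ map φ (verts (zigzag⁺ κ)) ∷ [] ∷ [])
           (# 0 ⊕ (# 1 ⊕ # 2) ⊕ # 3) ((# 1 ⊕ # 0 ⊕ # 3) ⊕ # 2) refl ⟩
    (φ (lo n) ∷ map φ (map (shiftBoth k) (verts path)) ++ []) ++ map φ (verts (zigzag⁺ κ))
      ≡⟨ cong (λ xs → (φ (lo n) ∷ xs) ++ map φ (verts (zigzag⁺ κ))) (++-identityʳ _) ⟩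
    (φ (lo n) ∷ map φ (map (shiftBoth k) (verts path))) ++ map φ (verts (zigzag⁺ κ))
      ≡⟨ map-++ φ (lo n ∷ map (shiftBoth k) (verts path)) (verts (zigzag⁺ κ)) ⟨
    map φ ((lo n ∷ map (shiftBoth k) (verts path)) ++ verts (zigzag⁺ κ))
      ↭⟨ map⁺ φ all-verts ⟩
    map φ (box b a)
      ↭⟨ embed-box n b a ⟩
    map (_+ (n + a)) (downFrom b) ++ downFrom a ∎

  δ : Maybe ℕ → ℕ
  δ = difference n

  σ : Maybe ℕ → Maybe ℕ
  σ = Maybe.map (_+ (k + k))

  path-weights : steps weight (mapW (shiftBoth k) path) ≡ map σ (steps weight path)
  path-weights = steps-map weight weight (shiftBoth k) σ {P = InBox b₀ a₀} (λ x y _ _ → shiftBoth-weight k x y) path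
    (All.tail (All-resp-↭ (↭-sym vs′) (box-InBox b₀ a₀)))

  path-just : All IsJust (steps weight (mapW (shiftBoth k) path))
  path-just = subst (All IsJust) (sym path-weights) (All.map⁺ (All.map (λ { is-just → is-just }) (All.tail (All-resp-↭ (↭-sym es′) (weights-just m)))))

  mapW-∘ : ∀ {x y} (p : Walk x y) → steps ∣_-_∣ (mapW ψ p) ≡ steps ∣_-_∣ (mapW φ (mapW (shiftBoth k) p))
  mapW-∘ [ x ]         = refl
  mapW-∘ (_∷_ x {y} p) = cong (∣ ψ x - ψ y ∣ ∷_) (mapW-∘ p)

  path-steps : steps ∣_-_∣ (mapW ψ path) ≡ map δ (map σ (steps weight path))
  path-steps = trans (mapW-∘ path) (trans (embed-steps {n} {b} {a} (mapW (shiftBoth k) path) path-inBox path-just) (cong (map δ) path-weights))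

  zigzag⁺-differences : steps ∣_-_∣ (mapW φ (zigzag⁺ κ)) ≡ map δ (weights (suc (κ + κ)))
  zigzag⁺-differences = trans (embed-steps {n} {b} {a} (zigzag⁺ κ) zigzag-inBox (subst (All IsJust) (sym (zigzag⁺-steps κ)) (weights-just (suc (κ + κ)))))
    (cong (map δ) (zigzag⁺-steps κ))

  -- The cycle takes the difference n away from the link. Starting at e + 2k instead of e, the link
  -- takes the weight 2k - 1, which completes the weights of the corner to all those below 2k.
  link : ∣ ψ (hi (e + k)) - e + a ∣ ≡ δ (just (suc (κ + κ)))
  link = trans (cong (∣_- e + a ∣) (eq e κ n a)) (trans (∣-∣-comm (e + a + _) (e + a)) (∣m-m+n∣≡n (e + a) _))
    where
    eq : ∀ e κ n a → e + suc κ + suc κ + (n + a) ≡ e + a + (suc (suc (κ + κ)) + n)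
    eq = solve-∀

  ends : ∣ φ (lo 0) - φ (lo n) ∣ ≡ n
  ends = ∣∸-∸∣ 0 n (≤-trans (s≤s z≤n) n<a) n<a

  close : ∣ φ (lo n) - φ (hi κ) ∣ ≡ δ (σ (just y))
  close = trans (embed-weight {n} {b} {a} (lo n) (hi κ) n<a (head-verts (zigzag⁺ κ) zigzag-inBox) refl) (cong (λ k → suc k + n) (eq y κ))
    where
    eq : ∀ y κ → suc y + suc κ + κ ≡ y + (suc κ + suc κ)
    eq = solve-∀

  new-steps : ∣ ψ (hi (e + k)) - e + a ∣ ∷ steps ∣_-_∣ (mapW ψ path) ++ (∣ φ (lo 0) - φ (lo n) ∣ ∷ ∣ φ (lo n) - φ (hi κ) ∣ ∷ steps ∣_-_∣ (mapW φ (zigzag⁺ κ))) ++ []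
    ↭ map (_+ n) (downFrom (b + a))
  new-steps = begin
    ∣ ψ (hi (e + k)) - e + a ∣ ∷ steps ∣_-_∣ (mapW ψ path) ++ (∣ φ (lo 0) - φ (lo n) ∣ ∷ ∣ φ (lo n) - φ (hi κ) ∣ ∷ steps ∣_-_∣ (mapW φ (zigzag⁺ κ))) ++ []
      ≡⟨ cong₂ _∷_ link (cong₂ _++_ path-steps (cong (_++ []) (cong₂ _∷_ ends (cong₂ _∷_ close zigzag⁺-differences)))) ⟩
    δ (just (suc (κ + κ))) ∷ map δ (map σ (steps weight path)) ++ (n ∷ δ (σ (just y)) ∷ map δ (weights (suc (κ + κ)))) ++ []
      ↭⟨ rearrange ((δ (just (suc (κ + κ))) ∷ []) ∷ map δ (map σ (steps weight path)) ∷ (n ∷ []) ∷ (δ (σ (just y)) ∷ []) ∷ map δ (weights (suc (κ + κ))) ∷ [] ∷ [])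
           (# 0 ⊕ # 1 ⊕ (# 2 ⊕ # 3 ⊕ # 4) ⊕ # 5) ((# 2 ⊕ # 3 ⊕ # 1 ⊕ # 5) ⊕ # 0 ⊕ # 4) refl ⟩
    (n ∷ δ (σ (just y)) ∷ map δ (map σ (steps weight path)) ++ []) ++ δ (just (suc (κ + κ))) ∷ map δ (weights (suc (κ + κ)))
      ≡⟨ cong₂ (λ xs ys → (n ∷ δ (σ (just y)) ∷ xs) ++ ys) (++-identityʳ _) (cong (map δ ∘ weights ∘ suc) (sym (+-suc κ κ))) ⟩
    n ∷ map δ (map σ (just y ∷ steps weight path)) ++ map δ (weights (k + k))
      ↭⟨ prep n (++⁺ʳ _ (map⁺ δ (map⁺ σ es′))) ⟩
    n ∷ map δ (map σ (weights m)) ++ map δ (weights (k + k))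
      ≡⟨ cong (n ∷_) (trans (cong (map δ) (weights-+ m (k + k))) (map-++ δ (map σ (weights m)) (weights (k + k)))) ⟨
    n ∷ map δ (weights (m + (k + k)))
      ≡⟨ cong (n ∷_) (differences-weights n (m + (k + k))) ⟩
    n ∷ map (λ k → suc k + n) (downFrom (m + (k + k)))
      ↭⟨ differences-suc n (m + (k + k)) ⟩
    map (_+ n) (downFrom (suc m + (k + k)))
      ≡⟨ cong (map (_+ n) ∘ downFrom) (trans (cong (_+ (k + k)) suc-m) (eq b₀ a₀ k)) ⟩
    map (_+ n) (downFrom (b + a)) ∎
    where
    eq : ∀ b₀ a₀ k → b₀ + a₀ + (k + k) ≡ b₀ + k + (a₀ + k)
    eq = solve-∀

-- Labellings with a single odd cycle, and two triangles

module OddCycle where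

  -- The differences around an empty interval, this time also within a side, because an odd cycle
  -- cannot be bipartite.
  distance : V → V → ℕ
  distance (lo i) (hi j) = suc (i + j)
  distance (hi j) (lo i) = suc (i + j)
  distance (lo i) (lo j) = ∣ i - j ∣
  distance (hi i) (hi j) = ∣ i - j ∣

  distance-sym : ∀ x y → distance x y ≡ distance y x
  distance-sym (lo i) (hi j) = refl
  distance-sym (hi j) (lo i) = refl
  distance-sym (lo i) (lo j) = ∣-∣-comm i j
  distance-sym (hi i) (hi j) = ∣-∣-comm i j

  -- With offset 0 the free end has the label 1 at every height t, after a complement if it is a
  -- high vertex.
  open Strands ℕ distance suc distance-sym (λ _ _ → refl) 0 (3 ∷ 2 ∷ 1 ∷ []) (lo 1)

  start : State 0 middle 4 []
  -- The edge from `lo 0` to `lo 2` has difference 2 and lies inside a side. It gives the fragment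
  -- an even number of vertices, so the closed cycle is odd.
  start = state (hi 1 ∷ [ lo 1 ]) (hi 0 ∷ lo 0 ∷ lo 2 ∷ [ hi 2 ]) [] refl refl
    (rearrange ((hi 0 ∷ []) ∷ (hi 1 ∷ []) ∷ (hi 2 ∷ []) ∷ (lo 0 ∷ []) ∷ (lo 1 ∷ []) ∷ (lo 2 ∷ []) ∷ [] ∷ [])
      ((# 1 ⊕ # 4) ⊕ (# 0 ⊕ # 3 ⊕ # 5 ⊕ # 2) ⊕ # 6) ((# 2 ⊕ # 1 ⊕ # 0 ⊕ # 6) ⊕ (# 5 ⊕ # 4 ⊕ # 3)) refl)
    (rearrange ((1 ∷ []) ∷ (2 ∷ []) ∷ (3 ∷ []) ∷ (5 ∷ []) ∷ [])
      (# 2 ⊕ # 0 ⊕ # 1 ⊕ # 3) (# 3 ⊕ # 2 ⊕ # 1 ⊕ # 0) refl)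

  embed-distance : ∀ {b a} x y → InBox b a x → InBox b a y → ∣ embed 0 a x - embed 0 a y ∣ ≡ distance x y
  embed-distance {b} {a} (lo i) (hi j) p q = trans (embed-weight {0} {b} {a} (lo i) (hi j) p q refl) (+-identityʳ _)
  embed-distance {b} {a} (hi j) (lo i) p q = trans (embed-weight {0} {b} {a} (hi j) (lo i) p q refl) (+-identityʳ _)
  embed-distance {b} {a} (lo i) (lo j) p q = ∣∸-∸∣ i j p q
  embed-distance {b} {a} (hi i) (hi j) p q = ∣+-+∣ a i j

  climb-range : ∀ m → climb m ≡ map suc (downFrom (m + 3))
  climb-range zero    = refl
  climb-range (suc m) = cong₂ _∷_ (eq m) (climb-range m)
    where
    eq : ∀ m → suc (3 + (m + 0)) ≡ suc (m + 3)
    eq = solve-∀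

  toGraceful : ∀ {b a t m ls} → suc (m + 3) ≡ b + a → Finished b a t m ls → Graceful (b + a) (embed 0 a t) ls
  toGraceful {b} {a} {t} {m} total (finished path cycles sizes vs es) = graceful
    (mapW f path) (map (mapC f) cycles) (trans (sizes-map f cycles) sizes) (m + 3) total
    (begin
      verts (mapW f path) ++ allverts (map (mapC f) cycles)
        ≡⟨ trans (cong₂ _++_ (verts-map f path) (allverts-map f cycles)) (sym (map-++ f (verts path) (allverts cycles))) ⟩
      map f (verts path ++ allverts cycles)
        ↭⟨ map⁺ f vs ⟩
      map f (box b a)
        ↭⟨ embed-box 0 b a ⟩
      map (_+ a) (downFrom b) ++ downFrom a
        ≡⟨ downFrom-+ b a ⟨
      downFrom (b + a) ∎)
    (begin
      steps ∣_-_∣ (mapW f path) ++ allsteps ∣_-_∣ (map (mapC f) cycles)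
        ≡⟨ cong₂ _++_ (trans (steps-map distance ∣_-_∣ f id embed-distance path (All.++⁻ˡ _ inBox)) (map-id _))
             (trans (allsteps-map distance ∣_-_∣ f id embed-distance cycles (All.++⁻ʳ (verts path) inBox)) (map-id _)) ⟩
      steps distance path ++ allsteps distance cycles
        ↭⟨ es ⟩
      climb m
        ≡⟨ climb-range m ⟩
      map suc (downFrom (m + 3)) ∎)
    where
    open PermutationReasoning
    f = embed 0 a
    inBox : All (InBox b a) (verts path ++ allverts cycles)
    inBox = All-resp-↭ (↭-sym vs) (box-InBox b a)

  fromRight : ∀ {t φ ls} → State t right φ ls → Graceful (10 + 2 * t) 1 ls
  fromRight {t} {ls = ls} S = subst₂ (λ n e → Graceful n e ls) (eq₂ t) (m+n∸n≡m 1 t) (toGraceful total (finishRightEven S))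
    where
    eq₁ : ∀ t → suc (6 + (t + t) + 3) ≡ 4 + (t + 0) + (6 + t)
    eq₁ = solve-∀
    eq₂ : ∀ t → 4 + (t + 0) + (6 + t) ≡ 10 + 2 * t
    eq₂ = solve-∀
    total : suc (6 + double t + 3) ≡ 4 + (t + 0) + (6 + t)
    total = trans (cong (λ d → suc (6 + d + 3)) (double-+ t)) (eq₁ t)

  fromMiddle : ∀ {t φ ls} → State t middle φ ls → Graceful (11 + 2 * t) 1 ls
  fromMiddle {t} {ls = ls} S = subst₂ (λ n e → Graceful n e ls) (eq₂ t)
    (trans (cong (_∸ suc (3 + (t + 0) + (6 + t))) (eq₃ t)) (m+n∸m≡n (suc (3 + (t + 0) + (6 + t))) 1))
    (complement (toGraceful total (finishMiddleOdd S)))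
    where
    eq₁ : ∀ t → suc (7 + (t + t) + 3) ≡ 5 + (t + 0) + (6 + t)
    eq₁ = solve-∀
    eq₂ : ∀ t → 5 + (t + 0) + (6 + t) ≡ 11 + 2 * t
    eq₂ = solve-∀
    eq₃ : ∀ t → 5 + (t + 0) + (6 + t) ≡ suc (3 + (t + 0) + (6 + t)) + 1
    eq₃ = solve-∀
    total : suc (7 + double t + 3) ≡ 5 + (t + 0) + (6 + t)
    total = trans (cong (λ d → suc (7 + d + 3)) (double-+ t)) (eq₁ t)

  oneOdd : ∀ k → 2 ≤ k → Graceful (3 * k + 10) 1 (suc (k + k) ∷ [])
  oneOdd k 2≤k = subst (λ k → Graceful (3 * k + 10) 1 (suc (k + k) ∷ [])) (m+[n∸m]≡n 2≤k) (go (k ∸ 2))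
    where
    size₁ : ∀ v → 10 + 2 * (3 + (v * 3 + 0)) ≡ 3 * (2 + (v + v)) + 10
    size₁ = solve-∀
    length₁ : ∀ v → suc (v * 4 + 4) ≡ suc (2 + (v + v) + (2 + (v + v)))
    length₁ = solve-∀
    size₂ : ∀ v → 11 + 2 * (3 + suc (v * 3 + 0)) ≡ 3 * (2 + suc (v + v)) + 10
    size₂ = solve-∀
    length₂ : ∀ v → suc (2 + (v * 4 + 4)) ≡ suc (2 + suc (v + v) + (2 + suc (v + v)))
    length₂ = solve-∀
    go : ∀ j → Graceful (3 * (2 + j) + 10) 1 (suc (2 + j + (2 + j)) ∷ [])
    go j with parity j
    ... | even v = subst₂ (λ n ℓ → Graceful n 1 (ℓ ∷ [])) (size₁ v) (length₁ v) (fromRight (closeMiddle (advances v start)))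
    ... | odd v  = subst₂ (λ n ℓ → Graceful n 1 (ℓ ∷ [])) (size₂ v) (length₂ v) (fromMiddle (closeLeft (advanceMiddle (advances v start))))

  triangle : Graceful 4 1 (3 ∷ [])
  triangle = graceful [ 1 ] (⟲ (0 ∷ 2 ∷ [ 3 ]) ∷ []) refl 3 refl
    (rearrange ((0 ∷ []) ∷ (1 ∷ []) ∷ (2 ∷ []) ∷ (3 ∷ []) ∷ []) (# 1 ⊕ # 0 ⊕ # 2 ⊕ # 3) (# 3 ⊕ # 2 ⊕ # 1 ⊕ # 0) refl)
    ↭-refl′
    where
    ↭-refl′ : 3 ∷ 2 ∷ 1 ∷ [] ↭ 3 ∷ 2 ∷ 1 ∷ []
    ↭-refl′ = ↭-refl

  -- Given explicitly because the induction cannot start here: after one triangle the estimate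
  -- `growth` fails for j = 1, where 17 would have to be at most 15.
  twoTriangles : Graceful 14 4 (3 ∷ 3 ∷ [])
  twoTriangles = graceful (4 ∷ 10 ∷ 3 ∷ 13 ∷ 0 ∷ 12 ∷ 1 ∷ [ 9 ]) (⟲ (2 ∷ 11 ∷ [ 7 ]) ∷ ⟲ (5 ∷ 8 ∷ [ 6 ]) ∷ []) refl 13 refl
    (rearrange labels
      (# 4 ⊕ # 10 ⊕ # 3 ⊕ # 13 ⊕ # 0 ⊕ # 12 ⊕ # 1 ⊕ # 9 ⊕ # 2 ⊕ # 11 ⊕ # 7 ⊕ # 5 ⊕ # 8 ⊕ # 6)
      (# 13 ⊕ # 12 ⊕ # 11 ⊕ # 10 ⊕ # 9 ⊕ # 8 ⊕ # 7 ⊕ # 6 ⊕ # 5 ⊕ # 4 ⊕ # 3 ⊕ # 2 ⊕ # 1 ⊕ # 0) refl)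
    (rearrange labels
      (# 6 ⊕ # 7 ⊕ # 10 ⊕ # 13 ⊕ # 12 ⊕ # 11 ⊕ # 8 ⊕ # 5 ⊕ # 9 ⊕ # 4 ⊕ # 1 ⊕ # 3 ⊕ # 2)
      (# 13 ⊕ # 12 ⊕ # 11 ⊕ # 10 ⊕ # 9 ⊕ # 8 ⊕ # 7 ⊕ # 6 ⊕ # 5 ⊕ # 4 ⊕ # 3 ⊕ # 2 ⊕ # 1) refl)
    where
    labels : List (List ℕ)
    labels = map (λ i → i ∷ []) (0 ∷ 1 ∷ 2 ∷ 3 ∷ 4 ∷ 5 ∷ 6 ∷ 7 ∷ 8 ∷ 9 ∷ 10 ∷ 11 ∷ 12 ∷ 13 ∷ [])

open OddCycle using (oneOdd; triangle; twoTriangles)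

oddLength : ℕ → ℕ
oddLength k = suc (k + k)

-- The number 2j + 1 of half blocks is 3, or 5 where Rosa's exception forbids the shorter length.
insertOddBlocks : ∀ {e ls} j κ → let k = suc κ; E = e + k in
  Graceful (suc (2 * E + j * (2 * (2 * E + 1))) + k) e ls →
  Graceful (suc (2 * E + j * (2 * (2 * E + 1))) + 3 * k + 2 * (2 + 2 * ((2 * j + 1) * E + j) + E) + suc (2 * E) + j * (2 * (2 * E + 1)))
    (2 + 2 * ((2 * j + 1) * E + j) + E) (oddLength k ∷ ls)
insertOddBlocks {e} {ls} j κ g = subst₂ (λ n f → Graceful n f (oddLength (suc κ) ∷ ls)) (size-eq E κ j) (f-eq E l)
  (insertOdd κ g (subst₂ (λ x y → Avoiding E f₀ x y m₀) (x-eq E j) (y-eq E j) (avoids j (avoid₀ l E))))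
  where
  E  = e + suc κ
  -- The solution of x = y + 1 for the avoided vertex `lo x` and the avoided weight y, the relation
  -- that `insertOdd` demands.
  l  = (2 * j + 1) * E + j
  f₀ = 2 + (l + E + l)
  m₀ = 4 + (l + E + l + (l + E + l)) + suc (E + E) + j * (2 * suc (E + E))
  x-eq : ∀ E j → suc ((2 * j + 1) * E + j) + E + j * (suc E + E) ≡ suc (2 * E + j * (2 * (2 * E + 1)))
  x-eq = solve-∀
  y-eq : ∀ E j → E + E + j * (2 * suc (E + E)) ≡ 2 * E + j * (2 * (2 * E + 1))
  y-eq = solve-∀
  f-eq : ∀ E l → 2 + (l + E + l) ≡ 2 + 2 * l + E
  f-eq = solve-∀
  size-eq : ∀ E κ j → let l = (2 * j + 1) * E + j in
    4 + (l + E + l + (l + E + l)) + suc (E + E) + j * (2 * suc (E + E)) + (suc κ + suc κ) + (suc (2 * E + j * (2 * (2 * E + 1))) + suc κ)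
    ≡ suc (2 * E + j * (2 * (2 * E + 1))) + 3 * suc κ + 2 * (2 + 2 * l + E) + suc (2 * E) + j * (2 * (2 * E + 1))
  size-eq = solve-∀

insertOdd₃ : ∀ {e ls} κ → let k = suc κ; E = e + k in
  Graceful (6 * e + 7 * k + 3) e ls → Graceful (26 * E + 14 + 3 * k) (7 * E + 4) (oddLength k ∷ ls)
insertOdd₃ {e} {ls} κ g = subst₂ (λ n f → Graceful n f (oddLength (suc κ) ∷ ls)) (size-eq (e + suc κ) κ) (f-eq (e + suc κ))
  (insertOddBlocks 1 κ (subst (λ n → Graceful n e ls) (n-eq e κ) g))
  where
  n-eq : ∀ e κ → 6 * e + 7 * suc κ + 3 ≡ suc (2 * (e + suc κ) + 1 * (2 * (2 * (e + suc κ) + 1))) + suc κ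
  n-eq = solve-∀
  f-eq : ∀ E → 2 + 2 * (3 * E + 1) + E ≡ 7 * E + 4
  f-eq = solve-∀
  size-eq : ∀ E κ → suc (2 * E + 1 * (2 * (2 * E + 1))) + 3 * suc κ + 2 * (2 + 2 * (3 * E + 1) + E) + suc (2 * E) + 1 * (2 * (2 * E + 1))
    ≡ 26 * E + 14 + 3 * suc κ
  size-eq = solve-∀

insertOdd₅ : ∀ {e ls} κ → let k = suc κ; E = e + k in
  Graceful (10 * e + 11 * k + 5) e ls → Graceful (42 * E + 22 + 3 * k) (11 * E + 6) (oddLength k ∷ ls)
insertOdd₅ {e} {ls} κ g = subst₂ (λ n f → Graceful n f (oddLength (suc κ) ∷ ls)) (size-eq (e + suc κ) κ) (f-eq (e + suc κ))
  (insertOddBlocks 2 κ (subst (λ n → Graceful n e ls) (n-eq e κ) g))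
  where
  n-eq : ∀ e κ → 10 * e + 11 * suc κ + 5 ≡ suc (2 * (e + suc κ) + 2 * (2 * (2 * (e + suc κ) + 1))) + suc κ
  n-eq = solve-∀
  f-eq : ∀ E → 2 + 2 * (5 * E + 2) + E ≡ 11 * E + 6
  f-eq = solve-∀
  size-eq : ∀ E κ → suc (2 * E + 2 * (2 * (2 * E + 1))) + 3 * suc κ + 2 * (2 + 2 * (5 * E + 2) + E) + suc (2 * E) + 2 * (2 * (2 * E + 1))
    ≡ 42 * E + 22 + 3 * suc κ
  size-eq = solve-∀

-- Linear inequalities by certificate: the hypotheses, added up with multipliers to L ≤ R, and a slack σ.
farkas : ∀ c {a b L R} σ → L ≤ R → suc c * a + R + σ ≡ suc c * b + L → a ≤ b
farkas c {a} {b} {L} {R} σ L≤R eq = *-cancelˡ-≤ (suc c) (+-cancelʳ-≤ R (suc c * a) (suc c * b) (begin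
  suc c * a + R      ≤⟨ m≤m+n _ σ ⟩
  suc c * a + R + σ  ≡⟨ eq ⟩
  suc c * b + L      ≤⟨ +-monoʳ-≤ (suc c * b) L≤R ⟩
  suc c * b + R      ∎))
  where open ≤-Reasoning

infixr 6 _⊹_
_⊹_ : ∀ {a b c d} → a ≤ b → c ≤ d → a + c ≤ b + d
_⊹_ = +-mono-≤

infixr 7 _⋆_
_⋆_ : ∀ c {a b} → a ≤ b → c * a ≤ c * b
c ⋆ h = *-monoʳ-≤ c h

lengthenTo : ∀ {n e ls} N → suc (e + e) + n ≤ N → suc (e + e + (e + e)) + n ≢ N → Graceful n e ls → Graceful N e ls
lengthenTo {n} {e} {ls} N long N≢ g = subst (λ N → Graceful N e ls) (m∸n+n≡m n≤N)
  (lengthen (N ∸ n) (m+n≤o⇒m≤o∸n (suc (e + e)) long) (λ eq → N≢ (trans (cong (_+ n) (sym eq)) (m∸n+n≡m n≤N))) g)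
  where
  n≤N : n ≤ N
  n≤N = ≤-trans (m≤n+m n (suc (e + e))) long

-- Induction over the odd cycles: sizes and end labels

record Odds (k : ℕ) (ks : List ℕ) : Set where
  constructor mkOdds
  field
    n f      : ℕ
    labelled : Graceful n f (map oddLength (k ∷ ks))
  p = 7 ^ length ks
  field
    -- Here j stands for any cycle still to come. Replacing f by 7(f + k) + 4 with k ≤ j multiplies
    -- the left side by at most 7, as the right side is. The disjunction excludes the second
    -- triangle.
    growth    : ∀ j → k ≤ j → 2 ≤ j ⊎ 1 ≤ length ks → 6 * f + 7 * j + 4 ≤ p * (9 * j + 6)
    -- It leaves at least 2f + 1 new vertices on the way to the prescribed size 6f + 7k′ + 3 for the
    -- next k′.
    room      : n ≤ 4 * f + 7 * k + 2
    -- Rosa's exceptional length, should the next cycle have length 2j + 1.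
    collision : ∀ j → k ≤ j → n ≡ 2 * f + 7 * j + 2 → 12 * f ≤ 49 * j × 1 ≤ length ks
    -- The last lengthening must not stop at the forbidden size n + 4f + 1, and 4k + 3 is twice the
    -- length 2k + 1, plus 1.
    bound₁    : n + 4 * f + 2 ≤ 3 * (p * (4 * k + 3))
    -- For a square at the complementary end E = n - 1 - f the room needed is n + 4E + 6 = 5n - 4f +
    -- 2. The constant 78 is 12 · 7 - 6, provided by 12R with R ≥ 7.
    bound₂    : 5 * n + 2 ≤ 4 * f + 7 * (p * (4 * k + 3)) + 78
    3f≤n      : 3 * f ≤ n

none : 0 ≤ 0
none = z≤n

oneTriangle : Odds 1 []
oneTriangle = mkOdds 4 1 triangle
  (λ { j _ (inj₁ 2≤j) → farkas 0 0 (2 ⋆ 2≤j) (eq j) })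
  (≤ᵇ⇒≤ _ _ _)
  (λ { j 1≤j 4≡ → contradiction (farkas 0 2 (7 ⋆ 1≤j) (eq′ j)) (<⇒≢′ 4≡) })
  (≤ᵇ⇒≤ _ _ _) (≤ᵇ⇒≤ _ _ _) (≤ᵇ⇒≤ _ _ _)
  where
  eq : ∀ j → 1 * (6 * 1 + 7 * j + 4) + 2 * j + 0 ≡ 1 * (1 * (9 * j + 6)) + 2 * 2
  eq = solve-∀
  eq′ : ∀ j → 1 * 9 + 7 * j + 2 ≡ 1 * (2 * 1 + 7 * j + 2) + 7 * 1
  eq′ = solve-∀
  <⇒≢′ : ∀ {x} → 4 ≡ x → 9 ≤ x → ⊥
  <⇒≢′ refl (s≤s (s≤s (s≤s (s≤s ()))))

twoSmall : Odds 1 (1 ∷ [])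
twoSmall = mkOdds 14 4 twoTriangles
  (λ j _ _ → farkas 0 (56 * j + 14) none (eq j))
  (≤ᵇ⇒≤ _ _ _)
  (λ j 1≤j 14≡ → contradiction (farkas 0 0 (7 ⋆ 1≤j) (eq′ j)) (small 14≡))
  (≤ᵇ⇒≤ _ _ _) (≤ᵇ⇒≤ _ _ _) (≤ᵇ⇒≤ _ _ _)
  where
  eq : ∀ j → 1 * (6 * 4 + 7 * j + 4) + 0 + (56 * j + 14) ≡ 1 * (7 * (9 * j + 6)) + 0
  eq = solve-∀
  eq′ : ∀ j → 1 * 17 + 7 * j + 0 ≡ 1 * (2 * 4 + 7 * j + 2) + 7 * 1
  eq′ = solve-∀
  small : ∀ {x} → 14 ≡ x → 17 ≤ x → ⊥
  small refl h = contradiction (≤⇒≤ᵇ h) λ ()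

oneLarge : ∀ k → 2 ≤ k → Odds k []
oneLarge k 2≤k = mkOdds (3 * k + 10) 1 (oneOdd k 2≤k)
  (λ { j _ (inj₁ 2≤j) → farkas 0 0 (2 ⋆ 2≤j) (eq₁ j) })
  (farkas 0 4 (4 ⋆ 2≤k) (eq₂ k))
  (λ j k≤j n≡ → contradiction (farkas 0 1 (3 ⋆ k≤j ⊹ 4 ⋆ ≤-trans 2≤k k≤j) (eq₃ k j)) (<⇒≱ (≤-reflexive (cong suc (sym n≡)))))
  (farkas 0 11 (9 ⋆ 2≤k) (eq₄ k))
  (farkas 0 (13 * k + 51) none (eq₅ k))
  (farkas 0 (3 * k + 7) none (eq₆ k))
  where
  eq₁ : ∀ j → 1 * (6 * 1 + 7 * j + 4) + 2 * j + 0 ≡ 1 * (1 * (9 * j + 6)) + 2 * 2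
  eq₁ = solve-∀
  eq₂ : ∀ k → 1 * (3 * k + 10) + 4 * k + 4 ≡ 1 * (4 * 1 + 7 * k + 2) + 4 * 2
  eq₂ = solve-∀
  eq₃ : ∀ k j → 1 * suc (3 * k + 10) + (3 * j + 4 * j) + 1 ≡ 1 * (2 * 1 + 7 * j + 2) + (3 * k + 4 * 2)
  eq₃ = solve-∀
  eq₄ : ∀ k → 1 * (3 * k + 10 + 4 * 1 + 2) + 9 * k + 11 ≡ 1 * (3 * (1 * (4 * k + 3))) + 9 * 2
  eq₄ = solve-∀
  eq₅ : ∀ k → 1 * (5 * (3 * k + 10) + 2) + 0 + (13 * k + 51) ≡ 1 * (4 * 1 + 7 * (1 * (4 * k + 3)) + 78) + 0
  eq₅ = solve-∀
  eq₆ : ∀ k → 1 * (3 * 1) + 0 + (3 * k + 7) ≡ 1 * (3 * k + 10) + 0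
  eq₆ = solve-∀

-- Usually three half blocks suffice. If the lengthening to their size hits Rosa's exception,
-- `collision` gives 12f ≤ 49k′ and p ≥ 7, so that the factor 11 of five half blocks stays within
-- the bounds, which grow by 7.
addOdd : ∀ {k ks} κ → k ≤ suc κ → 2 ≤ suc κ ⊎ 1 ≤ length ks → Odds k ks → Odds (suc κ) (k ∷ ks)
addOdd {k} {ks} κ k≤k′ big O with Odds.n O ≟ 2 * Odds.f O + 7 * suc κ + 2
... | no n≢ = mkOdds (26 * E + 14 + 3 * k′) (7 * E + 4)
  (insertOdd₃ κ (lengthenTo (6 * f + 7 * k′ + 3)
    (farkas 0 0 (room ⊹ 7 ⋆ k≤k′) (long f n k k′))
    (λ eq → n≢ (+-cancelˡ-≡ (suc (f + f + (f + f))) _ _ (trans eq (hit f k′))))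
    labelled))
  (λ j k′≤j _ → farkas 0 0 (7 ⋆ growth j (≤-trans k≤k′ k′≤j) (bigger k′≤j) ⊹ 42 ⋆ k′≤j) (eq₁ f k′ j p))
  (farkas 0 (2 * E + 4 * k′ + 4) none (eq₂ E k′))
  (λ j _ eq → farkas 0 (21 * κ + 1) (7 ⋆ ≤-reflexive eq) (eq₃ E κ j) , s≤s z≤n)
  (farkas 0 (3 * (p * k′) + 9 * p + 6 * k′ + 4) (9 ⋆ growth k′ k≤k′ big) (eq₄ f k′ p))
  (farkas 0 (43 * (p * k′) + 45 * p + 2 * k′ + 90) (17 ⋆ growth k′ k≤k′ big) (eq₅ f k′ p))
  (farkas 0 (5 * E + 2 + 3 * k′) none (eq₆ E k′))
  where
  open Odds O
  k′ = suc κ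
  E = f + k′
  bigger : ∀ {j} → k′ ≤ j → 2 ≤ j ⊎ 1 ≤ length ks
  bigger k′≤j = Sum.map₁ (λ 2≤k′ → ≤-trans 2≤k′ k′≤j) big
  long : ∀ f n k k′ → 1 * (suc (f + f) + n) + (4 * f + 7 * k + 2 + 7 * k′) + 0 ≡ 1 * (6 * f + 7 * k′ + 3) + (n + 7 * k)
  long = solve-∀
  hit : ∀ f k′ → 6 * f + 7 * k′ + 3 ≡ suc (f + f + (f + f)) + (2 * f + 7 * k′ + 2)
  hit = solve-∀
  eq₁ : ∀ f k′ j p → 1 * (6 * (7 * (f + k′) + 4) + 7 * j + 4) + (7 * (p * (9 * j + 6)) + 42 * j) + 0
    ≡ 1 * (7 * p * (9 * j + 6)) + (7 * (6 * f + 7 * j + 4) + 42 * k′)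
  eq₁ = solve-∀
  eq₂ : ∀ E k′ → 1 * (26 * E + 14 + 3 * k′) + 0 + (2 * E + 4 * k′ + 4) ≡ 1 * (4 * (7 * E + 4) + 7 * k′ + 2) + 0
  eq₂ = solve-∀
  eq₃ : ∀ E κ j → 1 * (12 * (7 * E + 4)) + 7 * (2 * (7 * E + 4) + 7 * j + 2) + (21 * κ + 1) ≡ 1 * (49 * j) + 7 * (26 * E + 14 + 3 * suc κ)
  eq₃ = solve-∀
  eq₄ : ∀ f k′ p → 1 * (26 * (f + k′) + 14 + 3 * k′ + 4 * (7 * (f + k′) + 4) + 2) + 9 * (p * (9 * k′ + 6)) + (3 * (p * k′) + 9 * p + 6 * k′ + 4)
    ≡ 1 * (3 * (7 * p * (4 * k′ + 3))) + 9 * (6 * f + 7 * k′ + 4)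
  eq₄ = solve-∀
  eq₅ : ∀ f k′ p → 1 * (5 * (26 * (f + k′) + 14 + 3 * k′) + 2) + 17 * (p * (9 * k′ + 6)) + (43 * (p * k′) + 45 * p + 2 * k′ + 90)
    ≡ 1 * (4 * (7 * (f + k′) + 4) + 7 * (7 * p * (4 * k′ + 3)) + 78) + 17 * (6 * f + 7 * k′ + 4)
  eq₅ = solve-∀
  eq₆ : ∀ E k′ → 1 * (3 * (7 * E + 4)) + 0 + (5 * E + 2 + 3 * k′) ≡ 1 * (26 * E + 14 + 3 * k′) + 0
  eq₆ = solve-∀
... | yes n≡ = mkOdds (42 * E + 22 + 3 * k′) (11 * E + 6)
  (insertOdd₅ κ (lengthenTo (10 * f + 11 * k′ + 5)
    (≤-trans (≤-reflexive (cong (suc (f + f) +_) n≡)) (farkas 0 (6 * f + 4 * k′ + 2) none (long f k′)))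
    (λ eq → <⇒≢ (farkas 0 (4 * f + 4 * k′ + 1) none (hit f k′)) (trans (cong (suc (f + f + (f + f)) +_) (sym n≡)) eq))
    labelled))
  (λ j k′≤j _ → farkas 1 (197 * j + 508) (11 ⋆ 12f≤ ⊹ 671 ⋆ k′≤j ⊹ 14 ⋆ *-monoˡ-≤ (9 * j + 6) 7≤p) (eq₁ f k′ j p))
  (farkas 0 (2 * E + 4 * k′ + 4) none (eq₂ E k′))
  (λ j _ eq → farkas 0 (8 * E + 21 * κ + 5) (7 ⋆ ≤-reflexive eq) (eq₃ E κ j) , s≤s z≤n)
  (farkas 5 (887 * k′ + 2358) (43 ⋆ 12f≤ ⊹ 126 ⋆ *-monoˡ-≤ (4 * k′ + 3) 7≤p) (eq₄ f k′ p))
  (farkas 5 (3079 * k′ + 6114) (83 ⋆ 12f≤ ⊹ 294 ⋆ *-monoˡ-≤ (4 * k′ + 3) 7≤p) (eq₅ f k′ p))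
  (farkas 0 (9 * E + 4 + 3 * k′) none (eq₆ E k′))
  where
  open Odds O
  k′ = suc κ
  E = f + k′
  12f≤ : 12 * f ≤ 49 * k′
  12f≤ = proj₁ (collision k′ k≤k′ n≡)
  7≤p : 7 ≤ p
  7≤p = ^-monoʳ-≤ 7 (proj₂ (collision k′ k≤k′ n≡))
  long : ∀ f k′ → 1 * (suc (f + f) + (2 * f + 7 * k′ + 2)) + 0 + (6 * f + 4 * k′ + 2) ≡ 1 * (10 * f + 11 * k′ + 5) + 0
  long = solve-∀
  hit : ∀ f k′ → 1 * suc (suc (f + f + (f + f)) + (2 * f + 7 * k′ + 2)) + 0 + (4 * f + 4 * k′ + 1) ≡ 1 * (10 * f + 11 * k′ + 5) + 0
  hit = solve-∀
  eq₁ : ∀ f k′ j p → 2 * (6 * (11 * (f + k′) + 6) + 7 * j + 4) + (11 * (49 * k′) + (671 * j + 14 * (p * (9 * j + 6)))) + (197 * j + 508)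
    ≡ 2 * (7 * p * (9 * j + 6)) + (11 * (12 * f) + (671 * k′ + 14 * (7 * (9 * j + 6))))
  eq₁ = solve-∀
  eq₂ : ∀ E k′ → 1 * (42 * E + 22 + 3 * k′) + 0 + (2 * E + 4 * k′ + 4) ≡ 1 * (4 * (11 * E + 6) + 7 * k′ + 2) + 0
  eq₂ = solve-∀
  eq₃ : ∀ E κ j → 1 * (12 * (11 * E + 6)) + 7 * (2 * (11 * E + 6) + 7 * j + 2) + (8 * E + 21 * κ + 5) ≡ 1 * (49 * j) + 7 * (42 * E + 22 + 3 * suc κ)
  eq₃ = solve-∀
  eq₄ : ∀ f k′ p → 6 * (42 * (f + k′) + 22 + 3 * k′ + 4 * (11 * (f + k′) + 6) + 2) + (43 * (49 * k′) + 126 * (p * (4 * k′ + 3))) + (887 * k′ + 2358)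
    ≡ 6 * (3 * (7 * p * (4 * k′ + 3))) + (43 * (12 * f) + 126 * (7 * (4 * k′ + 3)))
  eq₄ = solve-∀
  eq₅ : ∀ f k′ p → 6 * (5 * (42 * (f + k′) + 22 + 3 * k′) + 2) + (83 * (49 * k′) + 294 * (p * (4 * k′ + 3))) + (3079 * k′ + 6114)
    ≡ 6 * (4 * (11 * (f + k′) + 6) + 7 * (7 * p * (4 * k′ + 3)) + 78) + (83 * (12 * f) + 294 * (7 * (4 * k′ + 3)))
  eq₅ = solve-∀
  eq₆ : ∀ E k′ → 1 * (3 * (11 * E + 6)) + 0 + (9 * E + 4 + 3 * k′) ≡ 1 * (42 * E + 22 + 3 * k′) + 0
  eq₆ = solve-∀

-- Recursion on a decreasing list inserts the longest cycle last, as the estimates for all later j ≥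
-- k require.
buildOdds : ∀ k ks → Linked (λ x y → y ≤ x) (k ∷ ks) → All (1 ≤_) (k ∷ ks) → Odds k ks
buildOdds zero          _             _           (() ∷ _)
buildOdds (suc zero)    []            _           _           = oneTriangle
buildOdds (suc (suc κ)) []            _           _           = oneLarge (suc (suc κ)) (s≤s (s≤s z≤n))
buildOdds (suc zero)    (k₁ ∷ [])     (k₁≤1 ∷ _)  (_ ∷ 1≤k₁ ∷ _) = subst (λ k → Odds 1 (k ∷ [])) (≤-antisym 1≤k₁ k₁≤1) twoSmall
buildOdds (suc (suc κ)) (k₁ ∷ [])     (k₁≤k ∷ l)  (_ ∷ pos)   = addOdd (suc κ) k₁≤k (inj₁ (s≤s (s≤s z≤n))) (buildOdds k₁ [] l pos)
buildOdds (suc κ)       (k₁ ∷ k₂ ∷ ks) (k₁≤k ∷ l) (_ ∷ pos)   = addOdd κ k₁≤k (inj₂ (s≤s z≤n)) (buildOdds k₁ (k₂ ∷ ks) l pos)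

-- Mixed lengths

Squares : ℕ → List ℕ → Set
Squares t ls = ∀ a → t + 7 ≤ a → EvenCycles.Square a ls

-- A square of side e + 2 takes up 2e + 4 labels, and lengthening has to fill the rest of N exactly.
-- If that length is forbidden, the path gets one more vertex and the rectangle with 2e + 3 labels
-- replaces the square.
addSquare : ∀ {t n e ls ls′} N → Squares t ls′ → t + 6 ≤ e → n + 4 * e + 6 ≤ N → Graceful n e ls →
  ∃ λ f → Graceful N f (ls′ ++ ls)
addSquare {t} {n} {e} {ls} {ls′} N squares t≤e room g = subst (λ N → ∃ λ f → Graceful N f (ls′ ++ ls)) m+rest≡N result
  where
  rest = n + (2 * e + 4)
  m = N ∸ rest
  eq₁ : ∀ n e → 1 * (n + (2 * e + 4) + suc (e + e)) + 0 + 1 ≡ 1 * (n + 4 * e + 6) + 0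
  eq₁ = solve-∀
  eq₂ : ∀ t → t + 7 ≡ suc (t + 6)
  eq₂ = solve-∀
  eq₃ : ∀ e m n → 2 + e + (m + n + (2 + e)) ≡ m + (n + (2 * e + 4))
  eq₃ = solve-∀
  eq₄ : ∀ e m n → 2 + e + (suc m + n + (1 + e)) ≡ m + (n + (2 * e + 4))
  eq₄ = solve-∀
  rest+e≤N : rest + suc (e + e) ≤ N
  rest+e≤N = ≤-trans (farkas 0 1 none (eq₁ n e)) room
  m+rest≡N : m + rest ≡ N
  m+rest≡N = m∸n+n≡m (m+n≤o⇒m≤o rest rest+e≤N)
  long : suc (e + e) ≤ m
  long = m+n≤o⇒n≤o∸m rest rest+e≤N
    where
    m+n≤o⇒n≤o∸m : ∀ m {n o} → m + n ≤ o → n ≤ o ∸ m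
    m+n≤o⇒n≤o∸m m {n} h = m+n≤o⇒m≤o∸n n (≤-trans (≤-reflexive (+-comm n m)) h)
  t≤1+e : t + 7 ≤ 1 + e
  t≤1+e = ≤-trans (≤-reflexive (eq₂ t)) (s≤s t≤e)
  result : ∃ λ f → Graceful (m + rest) f (ls′ ++ ls)
  result with m ≟ suc (e + e + (e + e))
  ... | no m≢  = subst (λ N → ∃ λ f → Graceful N f (ls′ ++ ls)) (eq₃ e m n)
    (insertSquare (lengthen m long m≢ g) (squares (2 + e) (m≤n⇒m≤1+n t≤1+e)))
  ... | yes m≡ = subst (λ N → ∃ λ f → Graceful N f (ls′ ++ ls)) (eq₄ e m n)
    (insertRectangle (lengthen (suc m) (m≤n⇒m≤1+n long) (λ 1+m≡ → 1+n≢n (trans 1+m≡ (sym m≡))) g) (squares (1 + e) t≤1+e))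

-- If the end label f is close to n ∸ 1, the path is first lengthened, so that the complement ends far enough out.
mixed : ∀ {k ks t R ls′} N (O : Odds k ks) → Squares t ls′ → t ≤ R → 7 ≤ R → 12 * R + 7 * (Odds.p O * (4 * k + 3)) ≤ N + 6 →
  ∃ λ e → Graceful N e (ls′ ++ map oddLength (k ∷ ks))
mixed {k} {ks} {t} {R} {ls′} N O squares t≤R 7≤R fits = result
  where
  open Odds O
  P = p * (4 * k + 3)

  ahead : f + t + 7 ≤ n → ∃ λ e → Graceful N e (ls′ ++ map oddLength (k ∷ ks))
  ahead far = addSquare N squares (m+n≤o⇒m≤o∸n (t + 6) (≤-trans (≤-reflexive (eq₂ f t)) far))
    (farkas 0 0 (bound₂ ⊹ 12 ⋆ 7≤R ⊹ fits ⊹ 4 ⋆ f+E<n) (eq₁ n f E P R N)) (complement labelled)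
    where
    E = n ∸ suc f
    eq₁ : ∀ n f E P R N → 1 * (n + 4 * E + 6) + (4 * f + 7 * P + 78 + (12 * R + (N + 6 + 4 * n))) + 0
      ≡ 1 * N + (5 * n + 2 + (12 * 7 + (12 * R + 7 * P + 4 * (suc f + E))))
    eq₁ = solve-∀
    eq₂ : ∀ f t → t + 6 + suc f ≡ f + t + 7
    eq₂ = solve-∀
    eq₃ : ∀ f t → 1 * suc f + 0 + (t + 6) ≡ 1 * (f + t + 7) + 0
    eq₃ = solve-∀
    f+E<n : suc f + E ≤ n
    f+E<n = ≤-reflexive (m+[n∸m]≡n (≤-trans (farkas 0 (t + 6) none (eq₃ f t)) far))

  -- Among E + f + 1 labels the complement of f is E; n + f ≤ E leaves the 2f + 1 new vertices
  -- needed to reach that size.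
  stretch : ∀ E → t + 6 ≤ E → n + f ≤ E → suc (E + f) ≢ suc (f + f + (f + f)) + n → 5 * E + f + 7 ≤ N →
    ∃ λ e → Graceful N e (ls′ ++ map oddLength (k ∷ ks))
  stretch E t≤E n≤E free E≤ = addSquare N squares t≤E (≤-trans (≤-reflexive (eq₁ E f)) E≤)
    (subst (λ e → Graceful (suc (E + f)) e (map oddLength (k ∷ ks))) (m+n∸n≡m E f)
      (complement (lengthenTo (suc (E + f)) (farkas 0 0 n≤E (eq₂ f n E)) (free ∘ sym) labelled)))
    where
    eq₁ : ∀ E f → suc (E + f) + 4 * E + 6 ≡ 5 * E + f + 7
    eq₁ = solve-∀
    eq₂ : ∀ f n E → 1 * (suc (f + f) + n) + E + 0 ≡ 1 * suc (E + f) + (n + f)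
    eq₂ = solve-∀

  stretch′ : ∀ E → t + 6 ≤ E → n + f ≤ E → 5 * E + f + 12 ≤ N → ∃ λ e → Graceful N e (ls′ ++ map oddLength (k ∷ ks))
  stretch′ E t≤E n≤E E≤ with suc (E + f) ≟ suc (f + f + (f + f)) + n
  ... | no  free  = stretch E t≤E n≤E free (≤-trans (farkas 0 5 none (eq₁ E f)) E≤)
    where
    eq₁ : ∀ E f → 1 * (5 * E + f + 7) + 0 + 5 ≡ 1 * (5 * E + f + 12) + 0
    eq₁ = solve-∀
  ... | yes taken = stretch (suc E) (m≤n⇒m≤1+n t≤E) (m≤n⇒m≤1+n n≤E) (λ eq → 1+n≢n (trans eq (sym taken))) (≤-trans (≤-reflexive (eq₁ E f)) E≤)
    where
    eq₁ : ∀ E f → 5 * suc E + f + 7 ≡ 5 * E + f + 12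
    eq₁ = solve-∀

  result : ∃ λ e → Graceful N e (ls′ ++ map oddLength (k ∷ ks))
  result with f + t + 7 ≤? n
  ... | yes far = ahead far
  -- E is taken as the larger of its two lower bounds, which keeps the demand on N smallest.
  ... | no near with ≤-total (n + f) (t + 6)
  ...   | inj₁ n+f≤ = stretch′ (t + 6) ≤-refl n+f≤
    (farkas 0 (3 + n + 3 * f + 4 * P) (5 ⋆ t≤R ⊹ 7 ⋆ 7≤R ⊹ bound₁ ⊹ fits) (eq t f n R P N))
    where
    eq : ∀ t f n R P N → 1 * (5 * (t + 6) + f + 12) + (5 * R + (7 * R + (3 * P + (N + 6)))) + (3 + n + 3 * f + 4 * P)
      ≡ 1 * N + (5 * t + (7 * 7 + (n + 4 * f + 2 + (12 * R + 7 * P))))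
    eq = solve-∀
  ...   | inj₂ ≤n+f = stretch′ (n + f) ≤n+f ≤-refl
    (farkas 2 (4 * t + 2 * n + 2) (3 ⋆ fits ⊹ 18 ⋆ t≤R ⊹ 18 ⋆ ≰⇒> near ⊹ 18 ⋆ 7≤R ⊹ 7 ⋆ bound₁ ⊹ 4 ⋆ ≤n+f ⊹ 4 ⋆ 3f≤n) (eq t f n R P N))
    where
    eq : ∀ t f n R P N → 3 * (5 * (n + f) + f + 12)
      + (3 * (N + 6) + (18 * R + (18 * (f + t + 7) + (18 * R + (7 * (3 * P) + (4 * (n + f) + 4 * n)))))) + (4 * t + 2 * n + 2)
      ≡ 3 * N + (3 * (12 * R + 7 * P) + (18 * t + (18 * suc n + (18 * 7 + (7 * (n + 4 * f + 2) + (4 * (t + 6) + 4 * (3 * f)))))))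
    eq = solve-∀

-- From the numerical hypotheses to a labelling

half-room : ∀ t {a} → 2 * t + 15 ≤ suc (a + a) → t + 7 ≤ a
half-room t room = half-≤ (≤-trans (≤-reflexive (eq t)) (≤-trans (+-monoʳ-≤ (2 * t) (n≤1+n 14)) room))
  where
  eq : ∀ t → t + 7 + (t + 7) ≡ 2 * t + 14
  eq = solve-∀

onlyEven : ∀ {t ls} N → 2 * t + 15 ≤ N → Squares t ls → ∃ λ e → Graceful N e ls
onlyEven {t} N room squares with parity N
... | even a = fromFill (proj₂ (proj₁ (squares a (half-room t (m≤n⇒m≤1+n room)))))
... | odd a  = fromFill (proj₂ (proj₂ (squares a (half-room t room))))

≤-maxL : ∀ ls → All (_≤ maxL ls) ls
≤-maxL []       = []
≤-maxL (l ∷ ls) = m≤m⊔n l (maxL ls) ∷ All.map (λ h → ≤-trans h (m≤n⊔m l (maxL ls))) (≤-maxL ls)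

sum-≤ : ∀ {b ls} → All (_≤ b) ls → sum ls ≤ length ls * b
sum-≤ []       = z≤n
sum-≤ (h ∷ hs) = +-mono-≤ h (sum-≤ hs)

evenLength : ∀ {ℓ} → 3 ≤ ℓ → Even ℓ → EvenLength ℓ
evenLength {ℓ} 3≤ℓ ev = subst EvenLength (sym ℓ≡) (go (ℓ / 2) (subst (3 ≤_) ℓ≡ 3≤ℓ))
  where
  ℓ≡ : ℓ ≡ ℓ / 2 * 2
  ℓ≡ = trans (m≡m%n+[m/n]*n ℓ 2) (cong (_+ ℓ / 2 * 2) ev)
  eq₁ : ∀ u → suc (u * 4 + 3) ≡ (suc u + suc u) * 2
  eq₁ = solve-∀
  eq₂ : ∀ u → suc (2 + (u * 4 + 3)) ≡ suc (suc u + suc u) * 2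
  eq₂ = solve-∀
  go : ∀ q → 3 ≤ q * 2 → EvenLength (q * 2)
  go q 3≤ with parity q
  go _ ()             | even zero
  ... | even (suc u) = subst EvenLength (eq₁ u) (0-mod-4 u)
  go _ (s≤s (s≤s ())) | odd zero
  ... | odd (suc u)  = subst EvenLength (eq₂ u) (2-mod-4 u)

oddLengths : ∀ {ls} → All (3 ≤_) ls → All Odd ls → ∃ λ ks → map oddLength ks ≡ ls × All (1 ≤_) ks
oddLengths []         []         = [] , refl , []
oddLengths {ℓ ∷ _} (3≤ℓ ∷ 3≤) (o ∷ os) with oddLengths 3≤ os
... | ks , refl , 1≤ = ℓ / 2 ∷ ks , cong (_∷ map oddLength ks) (sym ℓ≡) , pos (ℓ / 2) (subst (3 ≤_) ℓ≡ 3≤ℓ) ∷ 1≤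
  where
  eq : ∀ q → 1 + q * 2 ≡ suc (q + q)
  eq = solve-∀
  ℓ≡ : ℓ ≡ oddLength (ℓ / 2)
  ℓ≡ = trans (m≡m%n+[m/n]*n ℓ 2) (trans (cong (_+ ℓ / 2 * 2) o) (eq (ℓ / 2)))
  pos : ∀ q → 3 ≤ oddLength q → 1 ≤ q
  pos zero    (s≤s ())
  pos (suc q) _ = s≤s z≤n

open import Data.List.Sort (Flip.decTotalOrder ≤-decTotalOrder) using (sort; sort-↭; sort-↗)

Labelling : ℕ → List ℕ → Set
Labelling h ls = ∃ λ e → ∃ λ ls′ → Graceful (h + sum ls) e ls′ × ls′ ↭ ls

sortedOdds : ∀ {ls} → 1 ≤ length ls → All (3 ≤_) ls → All Odd ls →
  ∃ λ k → ∃ λ ks → Odds k ks × map oddLength (k ∷ ks) ↭ ls × suc (length ks) ≡ length ls × oddLength k ≤ maxL ls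
sortedOdds {ls} some 3≤ od with oddLengths 3≤ od
... | js , refl , 1≤ with sort js | sort-↭ js | sort-↗ js
... | []     | p | _ = contradiction (≤-trans some (≤-reflexive (trans (length-map oddLength js) (sym (↭-length p))))) λ ()
... | k ∷ ks | p | l = k , ks , buildOdds k ks l (All-resp-↭ (↭-sym p) 1≤) , q
  , trans (↭-length p) (sym (length-map oddLength js)) , All.head (All-resp-↭ (↭-sym q) (≤-maxL (map oddLength js)))
  where
  q : map oddLength (k ∷ ks) ↭ map oddLength js
  q = map⁺ oddLength p

evenSquares : ∀ {ls} → All (3 ≤_) ls → All Even ls → ∃ λ t → Squares t ls × 2 * t ≤ 3 * sum ls × t ≤ sum ls + 2 * length ls
evenSquares 3≤ ev with EvenCycles.addCycles (evenLengths 3≤ ev)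
  where
  evenLengths : ∀ {ls} → All (3 ≤_) ls → All Even ls → All EvenLength ls
  evenLengths []       []       = []
  evenLengths (h ∷ hs) (e ∷ es) = evenLength h e ∷ evenLengths hs es
... | t , S , b₁ , b₂ = t , (λ a t+7≤a → EvenCycles.squares a t+7≤a S) , b₁ , b₂

onlyOdd-room : ∀ h S s {s′} ℓ k → suc s′ ≡ suc s → oddLength k ≤ ℓ → Bound (suc h) 0 (suc s) 0 ℓ → 3 * (7 ^ s′ * (4 * k + 3)) ≤ h + S
onlyOdd-room h S s ℓ k refl top bound = begin
  3 * (7 ^ s * (4 * k + 3))         ≡⟨ *-assoc 3 (7 ^ s) (4 * k + 3) ⟨
  3 * 7 ^ s * (4 * k + 3)           ≡⟨ cong (3 * 7 ^ s *_) (eq k) ⟩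
  3 * 7 ^ s * (2 * oddLength k + 1) ≤⟨ *-monoʳ-≤ (3 * 7 ^ s) (+-monoˡ-≤ 1 (*-monoʳ-≤ 2 top)) ⟩
  3 * 7 ^ s * (2 * ℓ + 1)           ≤⟨ m≤n⇒m≤n+o S (s≤s⁻¹ bound) ⟩
  h + S                             ∎
  where
  open ≤-Reasoning
  eq : ∀ k → 4 * k + 3 ≡ 2 * suc (k + k) + 1
  eq = solve-∀

-- The total size contains S itself, so of 2t ≤ 3S only two copies of S have to be paid for by the
-- bound on the length of the long cycle.
onlyEven-room : ∀ h S r ℓ {t} → 3 ≤ ℓ → S ≤ suc r * ℓ → 2 * t ≤ 3 * S → Bound (suc h) (suc r) 0 ℓ 0 → 2 * t + 15 ≤ h + S
onlyEven-room h S r ℓ {t} 3≤ℓ S≤ t≤ bound = farkas 0 (2 * r) (t≤ ⊹ 2 ⋆ S≤ ⊹ s≤s⁻¹ bound ⊹ 2 ⋆ 3≤ℓ) (eq t h S r ℓ)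
  where
  eq : ∀ t h S r ℓ → 1 * (2 * t + 15) + (3 * S + (2 * (suc r * ℓ) + (h + 2 * ℓ))) + 2 * r
    ≡ 1 * (h + S) + (2 * t + (2 * S + (2 * (suc r + 1) * (ℓ + 1) + 5 + 2 * 3)))
  eq = solve-∀

mixed-room : ∀ h S r s {s′} ℓ ℓ′ k → suc s′ ≡ suc s → oddLength k ≤ ℓ′ → Bound (suc h) (suc r) (suc s) ℓ ℓ′ →
  12 * (suc r * (ℓ + 3)) + 7 * (7 ^ s′ * (4 * k + 3)) ≤ h + S + 6
mixed-room h S r s ℓ ℓ′ k refl top bound = begin
  12 * (suc r * (ℓ + 3)) + 7 * (7 ^ s * (4 * k + 3)) ≡⟨ cong₂ _+_ (sym (*-assoc 12 (suc r) (ℓ + 3))) (trans (sym (*-assoc 7 (7 ^ s) (4 * k + 3))) (cong (7 ^ suc s *_) (eq k))) ⟩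
  X + 7 ^ suc s * (2 * oddLength k + 1)  ≤⟨ +-monoʳ-≤ X (*-monoʳ-≤ (7 ^ suc s) (+-monoˡ-≤ 1 (*-monoʳ-≤ 2 top))) ⟩
  X + Y                                  ≤⟨ m≤n+m∸n (X + Y) 6 ⟩
  6 + (X + Y ∸ 6)                        ≤⟨ +-monoʳ-≤ 6 (m≤n⇒m≤n+o S (s≤s⁻¹ bound)) ⟩
  6 + (h + S)                            ≡⟨ +-comm 6 _ ⟩
  h + S + 6                              ∎
  where
  open ≤-Reasoning
  X = 12 * suc r * (ℓ + 3)
  Y = 7 ^ suc s * (2 * ℓ′ + 1)
  eq : ∀ k → 4 * k + 3 ≡ 2 * suc (k + k) + 1
  eq = solve-∀

labelling : ∀ h evens odds → All (3 ≤_) evens → All (3 ≤_) odds → All Even evens → All Odd odds →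
  Bound (suc h) (length evens) (length odds) (maxL evens) (maxL odds) → Labelling h (evens ++ odds)
labelling h [] os@(_ ∷ os′) _ 3≤ _ od bound = let
    (k , ks , O , perm , len , top) = sortedOdds (s≤s z≤n) 3≤ od
  in extend O perm (onlyOdd-room h (sum os) (length os′) (maxL os) k len top bound)
  where
  extend : ∀ {k ks} (O : Odds k ks) → map oddLength (k ∷ ks) ↭ os → 3 * (Odds.p O * (4 * k + 3)) ≤ h + sum os → Labelling h os
  extend O perm fits = f , _ , lengthenTo (h + sum os)
      (≤-trans (farkas 0 (2 * f + 1) bound₁ (eq₁ f n _)) fits)
      (<⇒≢ (≤-trans (farkas 0 0 bound₁ (eq₂ f n _)) fits))
      labelled , perm
    where
    open Odds O
    eq₁ : ∀ f n B → 1 * (suc (f + f) + n) + B + (2 * f + 1) ≡ 1 * B + (n + 4 * f + 2)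
    eq₁ = solve-∀
    eq₂ : ∀ f n B → 1 * suc (suc (f + f + (f + f)) + n) + B + 0 ≡ 1 * B + (n + 4 * f + 2)
    eq₂ = solve-∀
labelling h es@(_ ∷ es′) [] 3≤@(3≤ℓ ∷ _) _ ev _ bound = let
    (t , squares , t≤ , _) = evenSquares 3≤ ev
    (e , g) = onlyEven {t} (h + sum es)
      (onlyEven-room h (sum es) (length es′) (maxL es) {t} (≤-trans 3≤ℓ (All.head (≤-maxL es))) (sum-≤ (≤-maxL es)) t≤ bound) squares
  in e , es , subst (λ ls → Graceful (h + sum ls) e es) (sym (++-identityʳ es)) g , ↭-reflexive (sym (++-identityʳ es))
labelling h es@(_ ∷ es′) os@(_ ∷ os′) 3≤e@(3≤ℓ ∷ _) 3≤o ev@(ev₁ ∷ _) od bound = let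
    (t , squares , _ , t≤) = evenSquares 3≤e ev
    (k , ks , O , perm , len , top) = sortedOdds (s≤s z≤n) 3≤o od
    (e , g) = mixed (h + sum (es ++ os)) O squares
      (farkas 0 (suc (length es′)) (t≤ ⊹ sum-≤ (≤-maxL es)) (eq₁ t (sum es) (length es′) (maxL es)))
      -- An even length that is at least 3 is at least 4, whence ℓ + 3 ≥ 7.
      (farkas 0 (length es′ * maxL es + 3 * length es′) (≤-trans (4≤ (evenLength 3≤ℓ ev₁)) (All.head (≤-maxL es))) (eq₂ (length es′) (maxL es)))
      (mixed-room h (sum (es ++ os)) (length es′) (length os′) (maxL es) (maxL os) k len top bound)
  in e , _ , g , ++⁺ˡ es perm
  where
  4≤ : ∀ {ℓ} → EvenLength ℓ → 4 ≤ ℓ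
  4≤ (0-mod-4 u) = s≤s (m≤n+m 3 (u * 4))
  4≤ (2-mod-4 u) = s≤s (m≤n⇒m≤o+n 2 (m≤n+m 3 (u * 4)))
  eq₁ : ∀ t S r ℓ → 1 * t + (S + 2 * suc r + suc r * ℓ) + suc r ≡ 1 * (suc r * (ℓ + 3)) + (t + S)
  eq₁ = solve-∀
  eq₂ : ∀ r ℓ → 1 * 7 + ℓ + (r * ℓ + 3 * r) ≡ 1 * (suc r * (ℓ + 3)) + 4
  eq₂ = solve-∀

-- Rotations

module Rotation (m : ℕ) where

  n : ℕ
  n = suc m

  _⊞_ : Fin n → Fin n → Fin n
  x ⊞ y = (toℕ x + toℕ y) mod n

  ⊟_ : Fin n → Fin n
  ⊟ x = (n ∸ toℕ x) mod n

  toℕ-mod : ∀ a → toℕ (a mod n) ≡ a % n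
  toℕ-mod a = toℕ-fromℕ< (m%n<n a n)

  %-idemʳ : ∀ a b → (a + b % n) % n ≡ (a + b) % n
  %-idemʳ a b = trans (%-distribˡ-+ a (b % n) n) (trans (cong (λ c → (a % n + c) % n) (m%n%n≡m%n b n)) (sym (%-distribˡ-+ a b n)))

  open import Algebra.Consequences.Setoid (setoid (Fin n)) using (comm∧idˡ⇒id; comm∧invˡ⇒inv)

  ⊞-comm : ∀ x y → x ⊞ y ≡ y ⊞ x
  ⊞-comm x y = cong (_mod n) (+-comm (toℕ x) (toℕ y))

  toℕ-⊞ : ∀ x y → toℕ (x ⊞ y) ≡ (toℕ x + toℕ y) % n
  toℕ-⊞ x y = toℕ-mod (toℕ x + toℕ y)

  toℕ-⊞³ : ∀ x y z → toℕ (x ⊞ (y ⊞ z)) ≡ (toℕ x + (toℕ y + toℕ z)) % n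
  toℕ-⊞³ x y z = trans (toℕ-⊞ x (y ⊞ z)) (trans (cong (λ a → (toℕ x + a) % n) (toℕ-⊞ y z)) (%-idemʳ (toℕ x) (toℕ y + toℕ z)))

  ⊞-assoc : ∀ x y z → (x ⊞ y) ⊞ z ≡ x ⊞ (y ⊞ z)
  ⊞-assoc x y z = toℕ-injective (begin
    toℕ ((x ⊞ y) ⊞ z)                ≡⟨ cong toℕ (⊞-comm (x ⊞ y) z) ⟩
    toℕ (z ⊞ (x ⊞ y))                ≡⟨ toℕ-⊞³ z x y ⟩
    (toℕ z + (toℕ x + toℕ y)) % n    ≡⟨ cong (_% n) (trans (+-comm (toℕ z) (toℕ x + toℕ y)) (+-assoc (toℕ x) (toℕ y) (toℕ z))) ⟩
    (toℕ x + (toℕ y + toℕ z)) % n    ≡⟨ toℕ-⊞³ x y z ⟨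
    toℕ (x ⊞ (y ⊞ z))                ∎)
    where open ≡-Reasoning

  ⊞-identityˡ : ∀ x → Fin.zero ⊞ x ≡ x
  ⊞-identityˡ x = toℕ-injective (trans (toℕ-⊞ Fin.zero x) (m<n⇒m%n≡m (toℕ<n x)))

  ⊞-inverseˡ : ∀ x → (⊟ x) ⊞ x ≡ Fin.zero
  ⊞-inverseˡ x = toℕ-injective (begin
    toℕ ((⊟ x) ⊞ x)                  ≡⟨ cong toℕ (⊞-comm (⊟ x) x) ⟩
    toℕ (x ⊞ (⊟ x))                  ≡⟨ toℕ-⊞ x (⊟ x) ⟩
    (toℕ x + toℕ (⊟ x)) % n          ≡⟨ cong (λ a → (toℕ x + a) % n) (toℕ-mod (n ∸ toℕ x)) ⟩
    (toℕ x + (n ∸ toℕ x) % n) % n    ≡⟨ %-idemʳ (toℕ x) (n ∸ toℕ x) ⟩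
    (toℕ x + (n ∸ toℕ x)) % n        ≡⟨ cong (_% n) (m+[n∸m]≡n (<⇒≤ (toℕ<n x))) ⟩
    n % n                            ≡⟨ n%n≡0 n ⟩
    0                                ∎)
    where open ≡-Reasoning

  ℤₙ : AbelianGroup _ _
  ℤₙ = record
    { Carrier = Fin n
    ; _≈_ = _≡_
    ; _∙_ = _⊞_
    ; ε = Fin.zero
    ; _⁻¹ = ⊟_
    ; isAbelianGroup = record
      { isGroup = record
        { isMonoid = record
          { isSemigroup = record { isMagma = isMagma _⊞_ ; assoc = ⊞-assoc }
          ; identity = comm∧idˡ⇒id ⊞-comm ⊞-identityˡ
          }
        ; inverse = comm∧invˡ⇒inv ⊞-comm ⊞-inverseˡ
        ; ⁻¹-cong = cong ⊟_
        }
      ; comm = ⊞-comm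
      }
    }

  open AbelianGroup ℤₙ using (group)
  open Group group using (_//_; assoc; identityʳ) public
  open import Algebra.Properties.Group group public
    using (//-rightDividesˡ; //-rightDividesʳ; ⁻¹-involutive; ∙-cancelˡ)
  open import Algebra.Properties.AbelianGroup ℤₙ using (⁻¹-∙-comm)

  //-⊞ : ∀ x i a → (x ⊞ a) // (i ⊞ a) ≡ x // i
  //-⊞ x i a = begin
    (x ⊞ a) ⊞ (⊟ (i ⊞ a))          ≡⟨ cong (λ b → (x ⊞ a) ⊞ (⊟ b)) (⊞-comm i a) ⟩
    (x ⊞ a) ⊞ (⊟ (a ⊞ i))          ≡⟨ cong ((x ⊞ a) ⊞_) (⁻¹-∙-comm a i) ⟨
    (x ⊞ a) ⊞ ((⊟ a) ⊞ (⊟ i))      ≡⟨ assoc (x ⊞ a) (⊟ a) (⊟ i) ⟨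
    ((x ⊞ a) // a) ⊞ (⊟ i)         ≡⟨ cong (_⊞ (⊟ i)) (//-rightDividesʳ a x) ⟩
    x // i                         ∎
    where open ≡-Reasoning

  ∙-swap : ∀ {x g a} → x // g ≡ a → g ≡ x // a
  ∙-swap {x} {g} refl = begin
    g                    ≡⟨ //-rightDividesʳ x g ⟨
    (g ⊞ x) // x         ≡⟨ cong (_// x) (⊞-comm g x) ⟩
    (x ⊞ g) // x         ≡⟨ cong (λ b → (x ⊞ b) // x) (⁻¹-involutive g) ⟨
    x // (⊟ g) // x      ≡⟨ assoc x (⊟ (⊟ g)) (⊟ x) ⟩
    x ⊞ ((⊟ (⊟ g)) ⊞ (⊟ x))  ≡⟨ cong (x ⊞_) (trans (⁻¹-∙-comm (⊟ g) x) (cong ⊟_ (⊞-comm (⊟ g) x))) ⟩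
    x // (x // g)        ∎
    where open ≡-Reasoning

  translate : Fin n → Perm n
  translate a = record
    { to      = _⊞ a
    ; from    = _// a
    ; from-to = //-rightDividesʳ a
    ; to-from = //-rightDividesˡ a
    }

  -- zero is the point at infinity.
  rotate : Fin n → Perm (suc n)
  rotate a = record
    { to      = λ { Fin.zero → Fin.zero ; (Fin.suc x) → Fin.suc (x ⊞ a) }
    ; from    = λ { Fin.zero → Fin.zero ; (Fin.suc x) → Fin.suc (x // a) }
    ; from-to = λ { Fin.zero → refl ; (Fin.suc x) → cong Fin.suc (//-rightDividesʳ a x) }
    ; to-from = λ { Fin.zero → refl ; (Fin.suc x) → cong Fin.suc (//-rightDividesˡ a x) }
    }

  module _ (F : Graph (suc n)) (seq : Perm (suc n)) (1≤m : 1 ≤ m)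
    (covers : ∀ x y → x ≢ y → count n (λ g → F (from seq (from (rotate g) x)) (from seq (from (rotate g) y))) ≡ 2) where

    rotated : Fin n → Graph (suc n)
    rotated g x y = F (from seq (from (rotate g) x)) (from seq (from (rotate g) y))

    solution : Factorization2 F
    solution = record
      { n       = n
      ; factor  = rotated
      ; isoF    = λ g → record
          { to      = to (rotate g) ∘ to seq
          ; from    = from seq ∘ from (rotate g)
          ; from-to = λ x → trans (cong (from seq) (from-to (rotate g) (to seq x))) (from-to seq x)
          ; to-from = λ x → trans (cong (to (rotate g)) (to-from seq (from (rotate g) x))) (to-from (rotate g) x)
          } , λ x y → cong₂ F (retract g x) (retract g y)
      ; covers2 = covers
      }
      where
      retract : ∀ g x → from seq (from (rotate g) (to (rotate g) (to seq x))) ≡ x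
      retract g x = trans (cong (from seq) (from-to (rotate g) (to seq x))) (from-to seq x)

    oneRotational : OneRotational solution
    oneRotational = record
      { m          = n
      ; G          = rotate
      ; hasId      = Fin.zero , λ { Fin.zero → refl ; (Fin.suc x) → cong Fin.suc (identityʳ x) }
      ; closed∘    = λ a b → b ⊞ a , λ { Fin.zero → refl ; (Fin.suc x) → cong Fin.suc (sym (assoc x b a)) }
      ; closed⁻¹   = λ a → ⊟ a , λ { Fin.zero → refl ; (Fin.suc x) → refl }
      ; auto       = λ a → translate a , λ i x y → cong₂ F (shifted a i x) (shifted a i y)
      ; ∞          = Fin.zero
      ; fixes∞     = λ _ → refl
      ; onlyFixed  = λ { Fin.zero _ → refl ; (Fin.suc x) fixed → contradiction (all-fixed x fixed) ε≢ }
      ; transitive = λ { Fin.zero _ x≢∞ _ → contradiction refl x≢∞ ; _ Fin.zero _ y≢∞ → contradiction refl y≢∞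
                       ; (Fin.suc x) (Fin.suc y) _ _ → y // x , cong Fin.suc (trans (⊞-comm x (y // x)) (//-rightDividesˡ x y)) }
      ; sharp      = λ { Fin.zero _ _ x≢∞ _ → contradiction refl x≢∞
                       ; (Fin.suc x) a b _ eq z → cong (λ g → to (rotate g) z) (∙-cancelˡ x a b (suc-injectiveF eq)) }
      }
      where
      shifted : ∀ a i x → from seq (from (rotate (i ⊞ a)) (to (rotate a) x)) ≡ from seq (from (rotate i) x)
      shifted a i Fin.zero    = refl
      shifted a i (Fin.suc x) = cong (from seq ∘ Fin.suc) (//-⊞ x i a)
      one : Fin n
      one = Fin.fromℕ< (s≤s 1≤m)
      ε≢ : one ≢ Fin.zero
      ε≢ eq = contradiction (trans (sym (toℕ-fromℕ< (s≤s 1≤m))) (cong toℕ eq)) λ ()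
      all-fixed : ∀ x → (∀ a → to (rotate a) (Fin.suc x) ≡ Fin.suc x) → one ≡ Fin.zero
      all-fixed x fixed = ∙-cancelˡ x one Fin.zero (trans (suc-injectiveF (fixed one)) (sym (identityʳ x)))

-- Edges of a union of cycles

χ : Bool → ℕ
χ b = if b then 1 else 0

-- Edges are stored as ordered pairs, so both orientations are counted. Counting with multiplicity
-- makes everything additive over the edge list, and the sum over all rotations can be taken edge by
-- edge.
incident : ℕ → ℕ → ℕ × ℕ → ℕ
incident x y (a , b) = χ ((x ≡ᵇ a) ∧ (y ≡ᵇ b)) + χ ((x ≡ᵇ b) ∧ (y ≡ᵇ a))

incidence : List (ℕ × ℕ) → ℕ → ℕ → ℕ
incidence es x y = sum (map (incident x y) es)

both : (A → B) → A × A → B × B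
both f (a , b) = f a , f b

pathEdges : ℕ → List (ℕ × ℕ)
pathEdges zero    = []
pathEdges (suc k) = (0 , 1) ∷ map (both suc) (pathEdges k)

circuit : ℕ → List (ℕ × ℕ)
circuit zero    = []
circuit (suc k) = (k , 0) ∷ pathEdges k

circuits : List ℕ → List (ℕ × ℕ)
circuits []       = []
circuits (k ∷ ks) = circuit k ++ map (both (k +_)) (circuits ks)

OnBoth : (A → Set) → A × A → Set
OnBoth P (a , b) = P a × P b

≡ᵇ-false : ∀ {x y} → x ≢ y → (x ≡ᵇ y) ≡ false
≡ᵇ-false {x} {y} = dec-false (x ≟ y)

≡ᵇ-true : ∀ {x y} → x ≡ y → (x ≡ᵇ y) ≡ true
≡ᵇ-true {x} {y} = dec-true (x ≟ y)

≡ᵇ-cong : ∀ {a b c d} → (a ≡ b → c ≡ d) → (c ≡ d → a ≡ b) → (a ≡ᵇ b) ≡ (c ≡ᵇ d)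
≡ᵇ-cong {a} {b} {c} {d} f g with a ≟ b
... | yes p = trans (≡ᵇ-true p) (sym (≡ᵇ-true (f p)))
... | no ¬p = trans (≡ᵇ-false ¬p) (sym (≡ᵇ-false (¬p ∘ g)))

≡ᵇ-sym : ∀ a b → (a ≡ᵇ b) ≡ (b ≡ᵇ a)
≡ᵇ-sym a b = ≡ᵇ-cong {a} {b} {b} {a} sym sym

incident-sym : ∀ x y e → incident x y e ≡ incident y x e
incident-sym x y (a , b) = trans (+-comm (χ ((x ≡ᵇ a) ∧ (y ≡ᵇ b))) _) (cong₂ _+_ (cong χ (∧-comm (x ≡ᵇ b) _)) (cong χ (∧-comm (x ≡ᵇ a) _)))

incidence-sym : ∀ es x y → incidence es x y ≡ incidence es y x
incidence-sym es x y = cong sum (map-cong (incident-sym x y) es)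

incidence-++ : ∀ es es′ x y → incidence (es ++ es′) x y ≡ incidence es x y + incidence es′ x y
incidence-++ es es′ x y = trans (cong sum (map-++ (incident x y) es es′)) (sum-++ (map (incident x y) es) (map (incident x y) es′))

incidence-avoid : ∀ {es} x y → All (OnBoth (x ≢_)) es → incidence es x y ≡ 0
incidence-avoid x y []               = refl
incidence-avoid x y ((≢a , ≢b) ∷ es) rewrite ≡ᵇ-false ≢a | ≡ᵇ-false ≢b = incidence-avoid x y es

incidence-map-cong : ∀ {es} (f : ℕ → ℕ) x′ y′ x y → All (OnBoth λ a → (x′ ≡ᵇ f a) ≡ (x ≡ᵇ a) × (y′ ≡ᵇ f a) ≡ (y ≡ᵇ a)) es →
  incidence (map (both f) es) x′ y′ ≡ incidence es x y
incidence-map-cong f x′ y′ x y []                                = refl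
incidence-map-cong {(a , b) ∷ es} f x′ y′ x y (((p , q) , (p′ , q′)) ∷ hs) rewrite p | q | p′ | q′ =
  cong (incident x y (a , b) +_) (incidence-map-cong f x′ y′ x y hs)

pathEdges-<  : ∀ k → All (OnBoth (_≤ k)) (pathEdges k)
pathEdges-< zero    = []
pathEdges-< (suc k) = (z≤n , s≤s z≤n) ∷ All.map⁺ (All.map (λ (p , q) → s≤s p , s≤s q) (pathEdges-< k))

circuit-< : ∀ k → All (OnBoth (_< k)) (circuit k)
circuit-< zero    = []
circuit-< (suc k) = (≤-refl , s≤s z≤n) ∷ All.map (λ (p , q) → s≤s p , s≤s q) (pathEdges-< k)

circuits-< : ∀ ks → All (OnBoth (_< sum ks)) (circuits ks)
circuits-< []       = []
circuits-< (k ∷ ks) = All.++⁺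
  (All.map (λ (p , q) → m≤n⇒m≤n+o (sum ks) p , m≤n⇒m≤n+o (sum ks) q) (circuit-< k))
  (All.map⁺ (All.map (λ (p , q) → +-monoʳ-< k p , +-monoʳ-< k q) (circuits-< ks)))

incidence-suc-0 : ∀ es y → incidence (map (both suc) es) 0 y ≡ 0
incidence-suc-0 es y = incidence-avoid 0 y (All.map⁺ (All.universal (λ _ → (λ ()) , (λ ())) es))

pathEdges-incidence : ∀ k x y → incidence (pathEdges k) x y ≡ χ ((suc x ≡ᵇ y) ∧ (x <ᵇ k)) + χ ((suc y ≡ᵇ x) ∧ (y <ᵇ k))
pathEdges-incidence zero    x y = sym (cong₂ _+_ (cong χ (∧-zeroʳ (suc x ≡ᵇ y))) (cong χ (∧-zeroʳ (suc y ≡ᵇ x))))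
pathEdges-incidence (suc k) zero zero = incidence-suc-0 (pathEdges k) 0
pathEdges-incidence (suc k) zero (suc zero)    = cong suc (incidence-suc-0 (pathEdges k) 1)
pathEdges-incidence (suc k) zero (suc (suc y)) = incidence-suc-0 (pathEdges k) (2 + y)
pathEdges-incidence (suc k) (suc zero)    zero = cong suc (trans (incidence-sym (map (both suc) (pathEdges k)) 1 0) (incidence-suc-0 (pathEdges k) 1))
pathEdges-incidence (suc k) (suc (suc x)) zero = trans (incidence-sym (map (both suc) (pathEdges k)) (2 + x) 0) (incidence-suc-0 (pathEdges k) (2 + x))
pathEdges-incidence (suc k) (suc x) (suc y) = cong₂ _+_ (cong χ (∧-zeroʳ (x ≡ᵇ 0)))
  (trans (incidence-map-cong suc (suc x) (suc y) x y (All.universal (λ _ → (refl , refl) , (refl , refl)) (pathEdges k))) (pathEdges-incidence k x y))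

χ-∨ : ∀ {a b} → (a ≡ true → b ≡ false) → χ (a ∨ b) ≡ χ a + χ b
χ-∨ {true}  h rewrite h refl = refl
χ-∨ {false} h = refl

suc-%-< : ∀ {x k} → x < k → suc x % suc k ≡ suc x
suc-%-< x<k = m<n⇒m%n≡m (s≤s x<k)

-- Length at least 3 makes the two disjuncts of `cycAdj` exclusive; only then does the Boolean
-- adjacency agree with the number of edges.
circuit-incidence : ∀ k x y → 2 ≤ k → x ≤ k → y ≤ k → incidence (circuit (suc k)) x y ≡ χ (cycAdj (suc k) x y)
circuit-incidence k x y 2≤k x≤k y≤k = trans (cong (incident x y (k , 0) +_) (pathEdges-incidence k x y)) (cases (m≤n⇒m<n∨m≡n x≤k) (m≤n⇒m<n∨m≡n y≤k))
  where
  ≡ᵇ⇒ : ∀ {a b} → (a ≡ᵇ b) ≡ true → a ≡ b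
  ≡ᵇ⇒ {a} {b} eq = ≡ᵇ⇒≡ a b (subst T (sym eq) _)
  0≢k : 0 ≢ k
  0≢k 0≡k = contradiction (subst (2 ≤_) (sym 0≡k) 2≤k) λ ()
  Goal : ℕ → ℕ → Set
  Goal x y = incident x y (k , 0) + (χ ((suc x ≡ᵇ y) ∧ (x <ᵇ k)) + χ ((suc y ≡ᵇ x) ∧ (y <ᵇ k))) ≡ χ (cycAdj (suc k) x y)
  wrap : ∀ {y} → y < k → Goal k y
  wrap {y} y<k rewrite ≡ᵇ-true {k} refl | ≡ᵇ-false (0≢k ∘ sym) | dec-false (k <? k) (n≮n k) | dec-true (y <? k) y<k | n%n≡0 (suc k) {{_}} | suc-%-< y<k
    | ∧-zeroʳ (suc k ≡ᵇ y) | ∧-identityʳ (suc y ≡ᵇ k) | +-identityʳ (χ (y ≡ᵇ 0)) = begin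
      χ (y ≡ᵇ 0) + χ (suc y ≡ᵇ k)   ≡⟨ cong (λ b → χ b + χ (suc y ≡ᵇ k)) (≡ᵇ-sym y 0) ⟩
      χ (0 ≡ᵇ y) + χ (suc y ≡ᵇ k)   ≡⟨ χ-∨ {0 ≡ᵇ y} (λ eq → ≡ᵇ-false λ 1+y≡k → <⇒≢ 2≤k (trans (cong suc (≡ᵇ⇒ {0} {y} eq)) 1+y≡k)) ⟨
      χ ((0 ≡ᵇ y) ∨ (suc y ≡ᵇ k))   ∎
    where open ≡-Reasoning
  Goal-sym : ∀ {x y} → Goal x y → Goal y x
  Goal-sym {x} {y} g = trans (cong₂ _+_ (incident-sym y x (k , 0)) (+-comm (χ ((suc y ≡ᵇ x) ∧ (y <ᵇ k))) _)) (trans g (cong χ (∨-comm (suc x % suc k ≡ᵇ y) _)))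
  cases : x < k ⊎ x ≡ k → y < k ⊎ y ≡ k → Goal x y
  cases (inj₁ x<k) (inj₁ y<k) rewrite ≡ᵇ-false (<⇒≢ x<k) | ≡ᵇ-false (<⇒≢ y<k) | ∧-zeroʳ (x ≡ᵇ 0) | dec-true (x <? k) x<k | dec-true (y <? k) y<k
    | suc-%-< x<k | suc-%-< y<k | ∧-identityʳ (suc x ≡ᵇ y) | ∧-identityʳ (suc y ≡ᵇ x) =
      sym (χ-∨ {suc x ≡ᵇ y} (λ eq → ≡ᵇ-false λ 1+y≡x → <⇒≢ (m≤n⇒m≤1+n ≤-refl) (trans (sym 1+y≡x) (cong suc (sym (≡ᵇ⇒ {suc x} {y} eq))))))
  cases (inj₂ refl) (inj₁ y<k)  = wrap y<k
  cases (inj₁ x<k)  (inj₂ refl) = Goal-sym {k} {x} (wrap x<k)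
  cases (inj₂ refl) (inj₂ refl) rewrite ≡ᵇ-true {k} refl | ≡ᵇ-false (0≢k ∘ sym) | dec-false (k <? k) (n≮n k) | ∧-zeroʳ (suc k ≡ᵇ k)
    | n%n≡0 (suc k) {{_}} | ≡ᵇ-false 0≢k = refl

unionOfCycles-incidence : ∀ ks x y → All (3 ≤_) ks → χ (unionOfCycles ks x y) ≡ incidence (circuits ks) x y
unionOfCycles-incidence []              x y _ = refl
unionOfCycles-incidence (suc k ∷ ks) x y (s≤s 2≤k ∷ 3≤) = trans (split (x <? suc k) (y <? suc k)) (sym (incidence-++ (circuit (suc k)) _ x y))
  where
  tail : List (ℕ × ℕ)
  tail = map (both (suc k +_)) (circuits ks)
  near : ∀ x y → x < suc k → incidence tail x y ≡ 0
  near x y x<k = incidence-avoid x y (All.map⁺ (All.universal (λ _ → <⇒≢ (m≤n⇒m≤n+o _ x<k) , <⇒≢ (m≤n⇒m≤n+o _ x<k)) (circuits ks)))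
  far : ∀ x y → suc k ≤ x → incidence (circuit (suc k)) x y ≡ 0
  far x y k≤x = incidence-avoid x y (All.map (λ (p , q) → (<⇒≢ (<-≤-trans p k≤x) ∘ sym) , (<⇒≢ (<-≤-trans q k≤x) ∘ sym)) (circuit-< (suc k)))
  flipped : ∀ es {x y} → incidence es y x ≡ 0 → incidence es x y ≡ 0
  flipped es {x} {y} h = trans (incidence-sym es x y) h
  Goal : Set
  Goal = χ (unionOfCycles (suc k ∷ ks) x y) ≡ incidence (circuit (suc k)) x y + incidence tail x y
  split : Dec (x < suc k) → Dec (y < suc k) → Goal
  split (yes x<k) (yes y<k) rewrite dec-true (x <? suc k) x<k | dec-true (y <? suc k) y<k | near x y x<k =
    trans (sym (circuit-incidence k x y 2≤k (s≤s⁻¹ x<k) (s≤s⁻¹ y<k))) (sym (+-identityʳ _))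
  split (no x≮k) (no y≮k) rewrite dec-false (x <? suc k) x≮k | dec-true (suc k ≤? x) (≮⇒≥ x≮k) | dec-true (suc k ≤? y) (≮⇒≥ y≮k) | far x y (≮⇒≥ x≮k) =
    trans (unionOfCycles-incidence ks (x ∸ suc k) (y ∸ suc k) 3≤)
      (sym (incidence-map-cong (suc k +_) x y (x ∸ suc k) (y ∸ suc k) (All.universal (λ _ → (shifted x≮k _ , shifted y≮k _) , (shifted x≮k _ , shifted y≮k _)) (circuits ks))))
    where
    shifted : ∀ {x} → ¬ x < suc k → ∀ a → (x ≡ᵇ suc k + a) ≡ (x ∸ suc k ≡ᵇ a)
    shifted {x} x≮k a = ≡ᵇ-cong {x} {suc k + a} {x ∸ suc k} {a} (λ { refl → m+n∸m≡n (suc k) a }) (λ { refl → sym (m+[n∸m]≡n (≮⇒≥ x≮k)) })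
  split (yes x<k) (no y≮k) rewrite dec-true (x <? suc k) x<k | dec-false (y <? suc k) y≮k | dec-false (suc k ≤? x) (<⇒≱ x<k) | near x y x<k
    | flipped (circuit (suc k)) {x} {y} (far y x (≮⇒≥ y≮k)) = refl
  split (no x≮k) (yes y<k) rewrite dec-false (x <? suc k) x≮k | dec-false (suc k ≤? y) (<⇒≱ y<k) | ∧-zeroʳ (suc k ≤ᵇ x) | far x y (≮⇒≥ x≮k)
    | flipped tail {x} {y} (near y x y<k) = refl

-- Standard cycles as positions in the list of labels

at : List ℕ → ℕ → ℕ
at []       _       = 0
at (x ∷ xs) zero    = x
at (x ∷ xs) (suc i) = at xs i

at-length : ∀ xs ys i → at (xs ++ ys) (length xs + i) ≡ at ys i
at-length []       ys i = refl
at-length (x ∷ xs) ys i = at-length xs ys i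

hops : Walk {A} x y → ℕ
hops [ x ]   = 0
hops (x ∷ p) = suc (hops p)

length-verts : (p : Walk {A} x y) → length (verts p) ≡ suc (hops p)
length-verts [ x ]   = refl
length-verts (x ∷ p) = cong suc (length-verts p)

module _ (zs : List ℕ) where

  at-first : (p : Walk x y) → at (verts p ++ zs) 0 ≡ x
  at-first [ x ]   = refl
  at-first (x ∷ p) = refl

  at-last : (p : Walk x y) → at (verts p ++ zs) (hops p) ≡ y
  at-last [ x ]   = refl
  at-last (x ∷ p) = at-last p

  steps-at : (p : Walk x y) → steps _,_ p ≡ map (both (at (verts p ++ zs))) (pathEdges (hops p))
  steps-at [ x ]   = refl
  steps-at (x ∷ p) = cong₂ _∷_ (cong (x ,_) (sym (at-first p))) (trans (steps-at p) (map-∘ (pathEdges (hops p))))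

  csteps-at : ∀ c → csteps _,_ c ≡ map (both (at (cverts c ++ zs))) (circuit (size c))
  csteps-at (⟲ p) rewrite length-verts p = cong₂ _∷_ (cong₂ _,_ (sym (at-last p)) (sym (at-first p))) (steps-at p)

allsteps-at : ∀ cs → allsteps _,_ cs ≡ map (both (at (allverts cs))) (circuits (map size cs))
allsteps-at []       = refl
allsteps-at (c ∷ cs) = trans
  (cong₂ _++_ (csteps-at (allverts cs) c)
    (trans (allsteps-at cs) (trans (map-cong (λ (a , b) → sym (cong₂ _,_ (at-length (cverts c) _ a) (at-length (cverts c) _ b))) (circuits (map size cs))) (map-∘ (circuits (map size cs))))))
  (sym (map-++ (both (at (allverts (c ∷ cs)))) (circuit (size c)) _))

at-lookup : ∀ xs i → at xs (toℕ i) ≡ lookup xs i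
at-lookup (x ∷ xs) Fin.zero    = refl
at-lookup (x ∷ xs) (Fin.suc i) = at-lookup xs i

record Enumeration (N : ℕ) (xs : List ℕ) : Set where
  field
    order : Perm N
    toℕ-order : ∀ i → toℕ (to order i) ≡ at xs (toℕ i)
open Enumeration

enumerate : ∀ {N xs} → xs ↭ downFrom N → Enumeration N xs
enumerate {N} {xs} p = record
  { order = record { to = π ⟨$⟩ʳ_ ; from = π ⟨$⟩ˡ_ ; from-to = λ _ → inverseˡ π ; to-from = λ _ → inverseʳ π }
  ; toℕ-order = λ i → begin
      toℕ (opposite (Fin.cast len (onIndices q ⟨$⟩ʳ Fin.cast (sym len′) i)))
        ≡⟨ opposite-prop _ ⟩
      N ∸ suc (toℕ (Fin.cast len (onIndices q ⟨$⟩ʳ Fin.cast (sym len′) i)))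
        ≡⟨ cong (λ j → N ∸ suc j) (toℕ-cast len _) ⟩
      N ∸ suc (toℕ (onIndices q ⟨$⟩ʳ Fin.cast (sym len′) i))
        ≡⟨ lookup-downFrom N _ ⟨
      lookup (downFrom N) (onIndices q ⟨$⟩ʳ Fin.cast (sym len′) i)
        ≡⟨ onIndices-lookup (setoid ℕ) q _ ⟨
      lookup xs (Fin.cast (sym len′) i)
        ≡⟨ at-lookup xs _ ⟨
      at xs (toℕ (Fin.cast (sym len′) i))
        ≡⟨ cong (at xs) (toℕ-cast (sym len′) i) ⟩
      at xs (toℕ i) ∎
  }
  where
  open ≡-Reasoning
  q = ↭⇒↭ₛ p
  len : length (downFrom N) ≡ N
  len = length-downFrom N
  len′ : length xs ≡ N
  len′ = trans (↭-length p) len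
  π : Permutation N N
  -- The final reversal is due to `downFrom`, which lists the labels in descending order.
  π = cast-id (sym len′) ∘ₚ onIndices q ∘ₚ cast-id len ∘ₚ reverse

graph-incidence : ∀ {N} cs (e : Enumeration N (allverts cs)) → sum (map size cs) ≡ N → All (3 ≤_) (map size cs) → ∀ x y →
  χ (unionOfCycles (map size cs) (toℕ (from (order e) x)) (toℕ (from (order e) y))) ≡ incidence (allsteps _,_ cs) (toℕ x) (toℕ y)
graph-incidence {N} cs e refl 3≤ x y = begin
  χ (unionOfCycles (map size cs) (toℕ (pos x)) (toℕ (pos y)))
    ≡⟨ unionOfCycles-incidence (map size cs) _ _ 3≤ ⟩
  incidence (circuits (map size cs)) (toℕ (pos x)) (toℕ (pos y))
    ≡⟨ incidence-map-cong (at (allverts cs)) (toℕ x) (toℕ y) (toℕ (pos x)) (toℕ (pos y)) (All.map (λ (p , q) → (match x p , match y p) , (match x q , match y q)) (circuits-< (map size cs))) ⟨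
  incidence (map (both (at (allverts cs))) (circuits (map size cs))) (toℕ x) (toℕ y)
    ≡⟨ cong (λ es → incidence es (toℕ x) (toℕ y)) (allsteps-at cs) ⟨
  incidence (allsteps _,_ cs) (toℕ x) (toℕ y) ∎
  where
  open ≡-Reasoning
  pos = from (order e)
  match : ∀ x {a} → a < N → (toℕ x ≡ᵇ at (allverts cs) a) ≡ (toℕ (pos x) ≡ᵇ a)
  match x {a} a<N = ≡ᵇ-cong {toℕ x} {at (allverts cs) a} {toℕ (pos x)} {a}
    (λ eq → trans (cong toℕ (trans (cong pos (toℕ-injective (trans eq (sym at≡)))) (from-to (order e) a′))) (toℕ-fromℕ< a<N))
    (λ eq → trans (cong toℕ (trans (sym (to-from (order e) x)) (cong (to (order e)) (toℕ-injective (trans eq (sym (toℕ-fromℕ< a<N))))))) at≡)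
    where
    a′ = Fin.fromℕ< a<N
    at≡ : toℕ (to (order e) a′) ≡ at (allverts cs) a
    at≡ = trans (toℕ-order e a′) (cong (at (allverts cs)) (toℕ-fromℕ< a<N))

-- Covering every pair twice

-- The odd cycles were sorted by length for the construction; this restores the order in which the
-- lengths are given.
regroup : ∀ {n e ls ls′} → ls ↭ ls′ → Graceful n e ls → Graceful n e ls′
regroup p (graceful path cycles refl m suc-m vs es) with ↭-map-inv size p
... | cycles′ , eq , q = graceful path cycles′ (sym eq) m suc-m
  (↭-trans (++⁺ˡ (verts path) (concatMap-↭ cverts (↭-sym q))) vs)
  (↭-trans (++⁺ˡ (steps ∣_-_∣ path) (concatMap-↭ (csteps ∣_-_∣) (↭-sym q))) es)

length-allverts : (cs : List (Cycle A)) → length (allverts cs) ≡ sum (map size cs)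
length-allverts []       = refl
length-allverts (c ∷ cs) = trans (length-++ (cverts c)) (cong (size c +_) (length-allverts cs))

map-steps : (f : C → D) (d : A → A → C) (p : Walk x y) → map f (steps d p) ≡ steps (λ a b → f (d a b)) p
map-steps f d [ x ]   = refl
map-steps f d (x ∷ p) = cong (_ ∷_) (map-steps f d p)

map-allsteps : (f : C → D) (d : A → A → C) (cs : List (Cycle A)) → map f (allsteps d cs) ≡ allsteps (λ a b → f (d a b)) cs
map-allsteps f d []       = refl
map-allsteps f d (c ∷ cs) = trans (map-++ f (csteps d c) (allsteps d cs)) (cong₂ _++_ (cong (_ ∷_) (map-steps f d (walk c))) (map-allsteps f d cs))

steps-All : {P : A → Set} (p : Walk x y) → All P (verts p) → All (OnBoth P) (steps _,_ p)
steps-All [ x ]   _        = []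
steps-All (x ∷ p) (h ∷ hs) = (h , head-verts p hs) ∷ steps-All p hs

allsteps-All : {P : A → Set} (cs : List (Cycle A)) → All P (allverts cs) → All (OnBoth P) (allsteps _,_ cs)
allsteps-All []       _  = []
allsteps-All (c ∷ cs) hs = (last-verts (walk c) p , head-verts (walk c) p) ∷ All.++⁺ (steps-All (walk c) p) (allsteps-All cs (All.++⁻ʳ (cverts c) hs))
  where p = All.++⁻ˡ (cverts c) hs

count-∑ : ∀ n p → count n p ≡ ∑ (χ ∘ p)
count-∑ zero    p = refl
count-∑ (suc n) p = cong (χ (p Fin.zero) +_) (count-∑ n (p ∘ Fin.suc))

∑-0 : ∀ n → ∑ {n} (λ _ → 0) ≡ 0
∑-0 zero    = refl
∑-0 (suc n) = ∑-0 n

∑-pick : ∀ {n} (i : Fin n) (p : Fin n → Bool) → ∑ (λ g → χ ((toℕ g ≡ᵇ toℕ i) ∧ p g)) ≡ χ (p i)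
∑-pick {suc n} Fin.zero    p = trans (cong (χ (p Fin.zero) +_) (∑-0 n)) (+-identityʳ _)
∑-pick {suc n} (Fin.suc i) p = ∑-pick i (p ∘ Fin.suc)

∑-sum : ∀ {n} (f : Fin n → A → ℕ) (xs : List A) → ∑ (λ g → sum (map (f g) xs)) ≡ sum (map (λ x → ∑ (λ g → f g x)) xs)
∑-sum {n = n} f []       = ∑-0 n
∑-sum         f (x ∷ xs) = trans (∑-distrib-+ (λ g → f g x) (λ g → sum (map (f g) xs))) (cong (∑ (λ g → f g x) +_) (∑-sum f xs))

sum-map-+ : (f g : A → ℕ) (xs : List A) → sum (map (λ x → f x + g x) xs) ≡ sum (map f xs) + sum (map g xs)
sum-map-+ f g []       = refl
sum-map-+ f g (x ∷ xs) = trans (cong (f x + g x +_) (sum-map-+ f g xs)) (eq (f x) (g x) (sum (map f xs)) (sum (map g xs)))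
  where
  eq : ∀ a b c d → a + b + (c + d) ≡ a + c + (b + d)
  eq = solve-∀

occurrences : ℕ → List ℕ → ℕ
occurrences δ = sum ∘ map (λ d → χ (δ ≡ᵇ d))

occurs-never : ∀ {δ} m → m < δ → occurrences δ (map suc (downFrom m)) ≡ 0
occurs-never zero    _   = refl
occurs-never (suc m) m<δ rewrite ≡ᵇ-false (<⇒≢ m<δ ∘ sym) = occurs-never m (<-trans (n<1+n m) m<δ)

occurs-once : ∀ {δ} m → 1 ≤ δ → δ ≤ m → occurrences δ (map suc (downFrom m)) ≡ 1
occurs-once {δ} zero    (s≤s _) ()
occurs-once {δ} (suc m) 1≤δ δ≤ with m≤n⇒m<n∨m≡n δ≤
... | inj₁ (s≤s δ≤m) rewrite ≡ᵇ-false (<⇒≢ (s≤s δ≤m)) = occurs-once m 1≤δ δ≤m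
... | inj₂ refl rewrite ≡ᵇ-true {m} refl = cong suc (occurs-never m ≤-refl)

module Differences (m : ℕ) where

  open Rotation m

  -- Since m is -1 modulo n, adding m · c cancels c without any subtraction.
  %-cancelˡ : ∀ c u v → (c + u) % n ≡ (c + v) % n → u % n ≡ v % n
  %-cancelˡ c u v eq = trans (sym (back u)) (trans (cong (λ w → (m * c + w) % n) eq) (back v))
    where
    regroup′ : ∀ m c u → m * c + (c + u) ≡ u + c * suc m
    regroup′ = solve-∀
    back : ∀ u → (m * c + (c + u) % n) % n ≡ u % n
    back u = trans (%-idemʳ (m * c) (c + u)) (trans (cong (_% n) (regroup′ m c u)) ([m+kn]%n≡m%n u c n))

  equal-shifts : ∀ c {δ d} → δ < n → d < n → ((c + δ) % n ≡ᵇ (c + d) % n) ≡ (δ ≡ᵇ d)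
  equal-shifts c {δ} {d} δ<n d<n = ≡ᵇ-cong
    (λ eq → trans (sym (m<n⇒m%n≡m δ<n)) (trans (%-cancelˡ c δ d eq) (m<n⇒m%n≡m d<n)))
    (cong λ u → (c + u) % n)

  opposite-shifts : ∀ c {δ d} → 1 ≤ δ → δ < n → d < n → ((c + (δ + d)) % n ≡ᵇ c % n) ≡ (n ∸ δ ≡ᵇ d)
  opposite-shifts c {δ} {d} 1≤δ δ<n d<n = ≡ᵇ-cong
    (λ eq → wrapped (%-cancelˡ c (δ + d) 0 (trans eq (cong (_% n) (sym (+-identityʳ c))))))
    (λ { refl → trans (cong (λ u → (c + u) % n) (m+[n∸m]≡n (<⇒≤ δ<n))) ([m+n]%n≡m%n c n) })
    where
    wrapped : (δ + d) % n ≡ 0 → n ∸ δ ≡ d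
    wrapped eq with δ + d <? n
    ... | yes small = contradiction (trans (sym (m<n⇒m%n≡m small)) eq) (<⇒≢ (≤-trans 1≤δ (m≤m+n δ d)) ∘ sym)
    ... | no  large = trans (cong (_∸ δ) (sym δ+d≡n)) (m+n∸m≡n δ d)
      where
      r = δ + d ∸ n
      r+n : r + n ≡ δ + d
      r+n = m∸n+n≡m (≮⇒≥ large)
      r<n : r < n
      r<n = +-cancelʳ-< n r n (≤-trans (≤-reflexive (cong suc r+n)) (+-mono-< δ<n d<n))
      r≡0 : r ≡ 0
      r≡0 = trans (sym (m<n⇒m%n≡m r<n)) (trans (sym ([m+n]%n≡m%n r n)) (trans (cong (_% n) r+n) eq))
      δ+d≡n : δ + d ≡ n
      δ+d≡n = trans (sym r+n) (cong (_+ n) r≡0)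

  -- On the left, the rotation carrying a (or b) to x is tested for carrying the other end to y,
  -- with the subtractions cleared. On the right, the same count in terms of differences.
  Balanced : ℕ → ℕ → ℕ → ℕ → Set
  Balanced x y a b = χ ((y + a) % n ≡ᵇ (b + x) % n) + χ ((y + b) % n ≡ᵇ (a + x) % n)
    ≡ χ (∣ x - y ∣ ≡ᵇ ∣ a - b ∣) + χ (n ∸ ∣ x - y ∣ ≡ᵇ ∣ a - b ∣)

  balanced-< : ∀ {x y a b} → x < y → a ≤ b → y < n → b < n → Balanced x y a b
  balanced-< {x} {y} {a} {b} x<y a≤b y<n b<n = subst₂ (λ y b → Balanced x y a b) (m+[n∸m]≡n (<⇒≤ x<y)) (m+[n∸m]≡n a≤b) (core (y ∸ x) (b ∸ a)
      (m<n⇒0<n∸m x<y) (≤-<-trans (m∸n≤m y x) y<n) (≤-<-trans (m∸n≤m b a) b<n))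
    where
    eq₁ : ∀ x δ a → x + δ + a ≡ x + a + δ
    eq₁ = solve-∀
    eq₂ : ∀ x d a → a + d + x ≡ x + a + d
    eq₂ = solve-∀
    eq₃ : ∀ x δ a d → x + δ + (a + d) ≡ x + a + (δ + d)
    eq₃ = solve-∀
    core : ∀ δ d → 1 ≤ δ → δ < n → d < n → Balanced x (x + δ) a (a + d)
    core δ d 1≤δ δ<n d<n rewrite ∣m-m+n∣≡n x δ | ∣m-m+n∣≡n a d = cong₂ (λ p q → χ p + χ q)
      (trans (cong₂ (λ u v → u % n ≡ᵇ v % n) (eq₁ x δ a) (eq₂ x d a)) (equal-shifts (x + a) δ<n d<n))
      (trans (cong₂ (λ u v → u % n ≡ᵇ v % n) (eq₃ x δ a d) (+-comm a x)) (opposite-shifts (x + a) 1≤δ δ<n d<n))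

  balanced-swap : ∀ {x y a b} → Balanced x y a b → Balanced x y b a
  balanced-swap {x} {y} {a} {b} h = trans (+-comm (χ ((y + b) % n ≡ᵇ (a + x) % n)) _)
    (trans h (cong (λ d → χ (∣ x - y ∣ ≡ᵇ d) + χ (n ∸ ∣ x - y ∣ ≡ᵇ d)) (∣-∣-comm a b)))

  balanced-flip : ∀ {x y a b} → Balanced x y a b → Balanced y x a b
  balanced-flip {x} {y} {a} {b} h = trans (cong₂ (λ p q → χ p + χ q) (turn b a) (turn a b))
    (trans (+-comm (χ ((y + b) % n ≡ᵇ (a + x) % n)) _)
      (trans h (cong (λ δ → χ (δ ≡ᵇ ∣ a - b ∣) + χ (n ∸ δ ≡ᵇ ∣ a - b ∣)) (∣-∣-comm x y))))
    where
    turn : ∀ b a → ((x + a) % n ≡ᵇ (b + y) % n) ≡ ((y + b) % n ≡ᵇ (a + x) % n)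
    turn b a = trans (≡ᵇ-sym ((x + a) % n) _) (cong₂ (λ u v → u % n ≡ᵇ v % n) (+-comm b y) (+-comm x a))

  balanced : ∀ {x y a b} → x ≢ y → x < n → y < n → a < n → b < n → Balanced x y a b
  balanced {x} {y} {a} {b} x≢y x<n y<n a<n b<n with <-cmp x y | ≤-total a b
  ... | tri< x<y _ _ | inj₁ a≤b = balanced-< x<y a≤b y<n b<n
  ... | tri< x<y _ _ | inj₂ b≤a = balanced-swap {x} {y} {b} {a} (balanced-< x<y b≤a y<n a<n)
  ... | tri≈ _ x≡y _ | _        = contradiction x≡y x≢y
  ... | tri> _ _ y<x | inj₁ a≤b = balanced-flip {y} {x} {a} {b} (balanced-< y<x a≤b x<n b<n)
  ... | tri> _ _ y<x | inj₂ b≤a = balanced-flip {y} {x} {a} {b} (balanced-swap {y} {x} {b} {a} (balanced-< y<x b≤a x<n a<n))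

  quotient-test : ∀ x y a b → (toℕ (y // (x // a)) ≡ᵇ toℕ b) ≡ ((toℕ y + toℕ a) % n ≡ᵇ (toℕ b + toℕ x) % n)
  quotient-test x y a b = ≡ᵇ-cong
    (λ eq → trans (sym (toℕ-⊞ y a)) (trans (cong toℕ (forward (toℕ-injective eq))) (toℕ-⊞ b x)))
    (λ eq → cong toℕ (backward (toℕ-injective (trans (toℕ-⊞ y a) (trans eq (sym (toℕ-⊞ b x)))))))
    where
    forward : y // (x // a) ≡ b → y ⊞ a ≡ b ⊞ x
    forward refl = begin
      y ⊞ a                                 ≡⟨ cong (_⊞ a) (//-rightDividesˡ (x // a) y) ⟨
      ((y // (x // a)) ⊞ (x // a)) ⊞ a      ≡⟨ assoc (y // (x // a)) (x // a) a ⟩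
      (y // (x // a)) ⊞ ((x // a) ⊞ a)      ≡⟨ cong ((y // (x // a)) ⊞_) (//-rightDividesˡ a x) ⟩
      (y // (x // a)) ⊞ x                   ∎
      where open ≡-Reasoning
    backward : y ⊞ a ≡ b ⊞ x → y // (x // a) ≡ b
    backward eq = begin
      y // (x // a)                         ≡⟨ cong (_// (x // a)) (//-rightDividesʳ a y) ⟨
      ((y ⊞ a) // a) // (x // a)            ≡⟨ cong (λ z → (z // a) // (x // a)) eq ⟩
      ((b ⊞ x) // a) // (x // a)            ≡⟨ cong (_// (x // a)) (assoc b x (⊟ a)) ⟩
      (b ⊞ (x // a)) // (x // a)            ≡⟨ //-rightDividesʳ (x // a) b ⟩
      b                                     ∎
      where open ≡-Reasoning

  ∑-quotient : ∀ x {a} (a<n : a < n) (p : Fin n → Bool) → ∑ (λ g → χ ((toℕ (x // g) ≡ᵇ a) ∧ p g)) ≡ χ (p (x // Fin.fromℕ< a<n))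
  ∑-quotient x {a} a<n p = trans (sum-cong-≗ (λ g → cong (λ b → χ (b ∧ p g)) (≡ᵇ-cong
      (λ eq → cong toℕ (∙-swap {x} {g} (toℕ-injective (trans eq (sym (toℕ-fromℕ< a<n))))))
      (λ eq → trans (cong toℕ (sym (∙-swap {x} {Fin.fromℕ< a<n} {g} (sym (toℕ-injective eq))))) (toℕ-fromℕ< a<n)))))
    (∑-pick (x // Fin.fromℕ< a<n) p)

  ∑-incident : ∀ {x y a b} → x ≢ y → a < n → b < n → let δ = ∣ toℕ x - toℕ y ∣; d = ∣ a - b ∣ in
    ∑ (λ g → incident (toℕ (x // g)) (toℕ (y // g)) (a , b)) ≡ χ (δ ≡ᵇ d) + χ (n ∸ δ ≡ᵇ d)
  ∑-incident {x} {y} {a} {b} x≢y a<n b<n = trans (∑-distrib-+ {n} (λ g → χ ((toℕ (x // g) ≡ᵇ a) ∧ (toℕ (y // g) ≡ᵇ b))) (λ g → χ ((toℕ (x // g) ≡ᵇ b) ∧ (toℕ (y // g) ≡ᵇ a))))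
    (trans (cong₂ _+_ (half a<n b<n) (half b<n a<n)) (balanced (x≢y ∘ toℕ-injective) (toℕ<n x) (toℕ<n y) a<n b<n))
    where
    half : ∀ {a b} (a<n : a < n) (b<n : b < n) → ∑ (λ g → χ ((toℕ (x // g) ≡ᵇ a) ∧ (toℕ (y // g) ≡ᵇ b))) ≡ χ ((toℕ y + a) % n ≡ᵇ (b + toℕ x) % n)
    half {a} {b} a<n b<n = trans (∑-quotient x a<n (λ g → toℕ (y // g) ≡ᵇ b))
      (cong χ (trans (cong (toℕ (y // (x // Fin.fromℕ< a<n)) ≡ᵇ_) (sym (toℕ-fromℕ< b<n)))
        (trans (quotient-test x y (Fin.fromℕ< a<n) (Fin.fromℕ< b<n))
          (cong₂ (λ a b → (toℕ y + a) % n ≡ᵇ (b + toℕ x) % n) (toℕ-fromℕ< a<n) (toℕ-fromℕ< b<n)))))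

  -- Both δ and n - δ lie between 1 and m, so each is the difference of exactly one edge. If they
  -- coincide, that one edge is carried to the pair by two different rotations and is rightly
  -- counted twice.
  ∑-incidence : ∀ {es x y} → x ≢ y → All (OnBoth (_< n)) es → map (λ (a , b) → ∣ a - b ∣) es ↭ map suc (downFrom m) →
    ∑ (λ g → incidence es (toℕ (x // g)) (toℕ (y // g))) ≡ 2
  ∑-incidence {es} {x} {y} x≢y below perm = begin
    ∑ (λ g → incidence es (toℕ (x // g)) (toℕ (y // g)))
      ≡⟨ ∑-sum (λ g → incident (toℕ (x // g)) (toℕ (y // g))) es ⟩
    sum (map (λ e → ∑ (λ g → incident (toℕ (x // g)) (toℕ (y // g)) e)) es)
      ≡⟨ cong sum (map-congAll (All.map (λ (p , q) → ∑-incident x≢y p q) below)) ⟩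
    sum (map (λ (a , b) → χ (δ ≡ᵇ ∣ a - b ∣) + χ (n ∸ δ ≡ᵇ ∣ a - b ∣)) es)
      ≡⟨ cong sum (map-∘ es) ⟩
    sum (map (λ d → χ (δ ≡ᵇ d) + χ (n ∸ δ ≡ᵇ d)) (map (λ (a , b) → ∣ a - b ∣) es))
      ≡⟨ sum-↭ (map⁺ _ perm) ⟩
    sum (map (λ d → χ (δ ≡ᵇ d) + χ (n ∸ δ ≡ᵇ d)) (map suc (downFrom m)))
      ≡⟨ sum-map-+ (λ d → χ (δ ≡ᵇ d)) (λ d → χ (n ∸ δ ≡ᵇ d)) (map suc (downFrom m)) ⟩
    occurrences δ (map suc (downFrom m)) + occurrences (n ∸ δ) (map suc (downFrom m))
      ≡⟨ cong₂ _+_ (occurs-once m 1≤δ δ≤m) (occurs-once m (m<n⇒0<n∸m (s≤s δ≤m)) n∸δ≤m) ⟩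
    2 ∎
    where
    open ≡-Reasoning
    δ = ∣ toℕ x - toℕ y ∣
    1≤δ : 1 ≤ δ
    1≤δ = n≢0⇒n>0 (x≢y ∘ toℕ-injective ∘ ∣m-n∣≡0⇒m≡n)
    δ≤m : δ ≤ m
    δ≤m = ≤-trans (∣m-n∣≤m⊔n (toℕ x) (toℕ y)) (⊔-lub (s≤s⁻¹ (toℕ<n x)) (s≤s⁻¹ (toℕ<n y)))
    n∸δ≤m : n ∸ δ ≤ m
    n∸δ≤m = ∸-monoʳ-≤ n 1≤δ

-- The solution developed from a graceful labelling

module Starter {m e ls} (g : Graceful (suc m) e ls) (1≤m : 1 ≤ m) where

  open Rotation m
  open Differences m
  open Graceful g using (path; cycles; vs; es; sizes; other) renaming (m to top; suc-m to suc-top)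

  -- The finite labels move up by one to free 0 for the fixed vertex, and closing the path through
  -- it restores the cycle that was cut.
  fullCycles : List (Cycle ℕ)
  fullCycles = (⟲ (0 ∷ mapW suc path)) ∷ map (mapC suc) cycles

  labels : List ℕ
  labels = verts path ++ allverts cycles

  edges : List (ℕ × ℕ)
  edges = steps _,_ path ++ allsteps _,_ cycles

  labels-< : All (_< n) labels
  labels-< = All-resp-↭ (↭-sym vs) (<-downFrom n)

  edges-< : All (OnBoth (_< n)) edges
  edges-< = All.++⁺ (steps-All path (All.++⁻ˡ _ labels-<)) (allsteps-All cycles (All.++⁻ʳ (verts path) labels-<))

  differences : map (λ (a , b) → ∣ a - b ∣) edges ↭ map suc (downFrom m)
  differences = ↭-trans (↭-reflexive (trans (map-++ _ (steps _,_ path) (allsteps _,_ cycles)) (cong₂ _++_ (map-steps _ _,_ path) (map-allsteps _ _,_ cycles))))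
    (subst (λ m → steps ∣_-_∣ path ++ allsteps ∣_-_∣ cycles ↭ map suc (downFrom m)) (suc-injective suc-top) es)

  fullEdges : allsteps _,_ fullCycles ≡ (suc other , 0) ∷ (0 , suc e) ∷ map (both suc) edges
  fullEdges = cong (λ es → (suc other , 0) ∷ (0 , suc e) ∷ es) (trans
    (cong₂ _++_ (steps-map _,_ _,_ suc (both suc) (λ _ _ _ _ → refl) path (All.++⁻ˡ _ labels-<))
      (allsteps-map _,_ _,_ suc (both suc) (λ _ _ _ _ → refl) cycles (All.++⁻ʳ (verts path) labels-<)))
    (sym (map-++ (both suc) (steps _,_ path) (allsteps _,_ cycles))))

  fullVerts : allverts fullCycles ↭ downFrom (suc n)
  fullVerts = begin
    0 ∷ verts (mapW suc path) ++ allverts (map (mapC suc) cycles)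
      ≡⟨ cong (0 ∷_) (trans (cong₂ _++_ (verts-map suc path) (allverts-map suc cycles)) (sym (map-++ suc (verts path) (allverts cycles)))) ⟩
    0 ∷ map suc labels            ↭⟨ prep 0 (map⁺ suc vs) ⟩
    0 ∷ map suc (downFrom n)      ↭⟨ ++-comm (0 ∷ []) (map suc (downFrom n)) ⟩
    map suc (downFrom n) ++ 0 ∷ [] ↭⟨ downFrom-suc n ⟨
    downFrom (suc n)              ∎
    where open PermutationReasoning

  total : sum (map size fullCycles) ≡ suc n
  total = trans (sym (length-allverts fullCycles)) (trans (↭-length fullVerts) (length-downFrom (suc n)))

  enumeration : Enumeration (suc n) (allverts fullCycles)
  enumeration = enumerate fullVerts

  e<n : e < n
  e<n = head-verts path (All.++⁻ˡ _ labels-<)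

  other<n : other < n
  other<n = last-verts path (All.++⁻ˡ _ labels-<)

  -- The fixed vertex has one edge to each end of the path, and each end meets a given residue under
  -- one rotation. The conjunctions with `true` match the form of `∑-quotient`.
  at-infinity : ∀ z → incidence (allsteps _,_ fullCycles) 0 (suc z) ≡ χ ((z ≡ᵇ other) ∧ true) + χ ((z ≡ᵇ e) ∧ true)
  at-infinity z = trans (cong (λ es → incidence es 0 (suc z)) fullEdges) (cong₂ _+_ (cong χ (sym (∧-identityʳ (z ≡ᵇ other))))
    (trans (cong₂ _+_ (trans (+-identityʳ _) (cong χ (sym (∧-identityʳ (z ≡ᵇ e))))) (incidence-suc-0 edges (suc z))) (+-identityʳ _)))

  at-finite : ∀ u v → incidence (allsteps _,_ fullCycles) (suc u) (suc v) ≡ incidence edges u v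
  at-finite u v = trans (cong (λ es → incidence es (suc u) (suc v)) fullEdges)
    (cong₂ _+_ (trans (+-identityʳ _) (cong χ (∧-zeroʳ (u ≡ᵇ other))))
      (cong₂ _+_ (cong χ (∧-zeroʳ (u ≡ᵇ e)))
        (incidence-map-cong suc (suc u) (suc v) u v (All.universal (λ _ → (refl , refl) , (refl , refl)) edges))))

  covered : ∀ x y → x ≢ y → ∑ (λ g → incidence (allsteps _,_ fullCycles) (toℕ (from (rotate g) x)) (toℕ (from (rotate g) y))) ≡ 2
  covered Fin.zero    Fin.zero    x≢y = contradiction refl x≢y
  covered Fin.zero    (Fin.suc y) _   = trans (sum-cong-≗ (λ g → at-infinity (toℕ (y // g))))
    (trans (∑-distrib-+ (λ g → χ ((toℕ (y // g) ≡ᵇ other) ∧ true)) (λ g → χ ((toℕ (y // g) ≡ᵇ e) ∧ true)))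
      (cong₂ _+_ (∑-quotient y other<n (λ _ → true)) (∑-quotient y e<n (λ _ → true))))
  covered (Fin.suc x) Fin.zero    x≢y = trans (sum-cong-≗ (λ g → incidence-sym (allsteps _,_ fullCycles) (suc (toℕ (x // g))) 0))
    (covered Fin.zero (Fin.suc x) (x≢y ∘ sym))
  covered (Fin.suc x) (Fin.suc y) x≢y = trans (sum-cong-≗ (λ g → at-finite (toℕ (x // g)) (toℕ (y // g))))
    (∑-incidence (x≢y ∘ cong Fin.suc) edges-< differences)

  graph : Graph (suc n)
  graph x y = unionOfCycles (map size fullCycles) (toℕ x) (toℕ y)

  rotational : All (3 ≤_) (map size fullCycles) → OP2-1rot (cyclesGraph (map size fullCycles))
  rotational 3≤ = resize total (solution graph (order enumeration) 1≤m covers , oneRotational graph (order enumeration) 1≤m covers)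
    where
    resize : ∀ {N} → sum (map size fullCycles) ≡ N → OP2-1rot {N} (λ x y → unionOfCycles (map size fullCycles) (toℕ x) (toℕ y)) →
      OP2-1rot (cyclesGraph (map size fullCycles))
    resize refl s = s
    position : Fin n → Fin (suc n) → Fin (suc n)
    position g x = from (order enumeration) (from (rotate g) x)
    covers : ∀ x y → x ≢ y → count n (λ g → graph (position g x) (position g y)) ≡ 2
    covers x y x≢y = trans (count-∑ n (λ g → graph (position g x) (position g y))) (trans
      (sum-cong-≗ (λ g → graph-incidence fullCycles enumeration total 3≤ (from (rotate g) x) (from (rotate g) y)))
      (covered x y x≢y))

one-rotational : ∀ h {e ls} → Graceful (suc (suc h) + sum ls) e ls → All (3 ≤_) ls → OP2-1rot (cyclesGraph (suc (suc (suc h)) ∷ ls))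
one-rotational h {e} {ls} g 3≤ = subst (OP2-1rot ∘ cyclesGraph) shape
    (rotational (subst (All (3 ≤_)) (sym shape) (s≤s (s≤s (s≤s z≤n)) ∷ 3≤)))
  where
  open Starter g (s≤s z≤n) using (fullCycles; total; rotational)
  tail≡ : map size (map (mapC suc) (Graceful.cycles g)) ≡ ls
  tail≡ = trans (sizes-map suc (Graceful.cycles g)) (Graceful.sizes g)
  shape : map size fullCycles ≡ suc (suc (suc h)) ∷ ls
  -- The length of the path is recorded nowhere; it follows from the total number of vertices by
  -- cancelling the other cycles.
  shape = cong₂ _∷_ (+-cancelʳ-≡ (sum ls) _ _ (trans (cong (λ ls → suc (length (verts (mapW suc (Graceful.path g)))) + sum ls) (sym tail≡)) total)) tail≡

theorem1p4 : (h : ℕ) (evens odds : List ℕ) →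
    3 ≤ h → All (λ k → 3 ≤ k) evens → All (λ k → 3 ≤ k) odds →
    All Even evens → All Odd odds →
    Bound h (length evens) (length odds) (maxL evens) (maxL odds) →
    OP2-1rot (cyclesGraph (h ∷ evens ++ odds))
theorem1p4 (suc (suc (suc h))) evens odds (s≤s (s≤s (s≤s _))) 3≤e 3≤o ev od bound =
  let (e , ls , g , p) = labelling (2 + h) evens odds 3≤e 3≤o ev od bound
  in one-rotational h (regroup p g) (All.++⁺ 3≤e 3≤o)
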